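{- There exists a positive integer $n_0$ such that every $3$-connected graph $G$ with $n\ge n_0$ vertices and minimum degree $\delta(G)\ge (2n+3)/5$ contains a spanning generalized Halin graph.
   Context: All graphs are finite and simple. For a tree $T$, $L(T)$ denotes its set of leaves. A HIST of a graph $G$ is a spanning tree of $G$ with no vertex of degree $2$. A spanning generalized Halin graph of $G$ is a spanning subgraph $H=T\cup C$ of $G$ where $T$ is a HIST of $G$ and $C$ is a cycle in $G$ with $V(C)=L(T)$. -}

module Defs where

open import Data.Nat using (ℕ; zero; suc; _+_; _*_; _≤_; _<_)
open import Data.Bool using (Bool; true; false; if_then_else_)
open import Data.Fin using (Fin)
open import Data.Fin.Subset using (Subset; _∉_; ∣_∣)
open import Data.List using (List; []; _∷_; _++_; length; map; allFin)
open import Data.Nat.ListAction using (sum)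
open import Data.List.Relation.Unary.Unique.Propositional using (Unique)
open import Data.List.Membership.Propositional using (_∈_)
open import Data.Product using (Σ; _×_; ∃)
open import Data.Empty using (⊥)
open import Relation.Nullary using (¬_)
open import Relation.Binary.PropositionalEquality using (_≡_; _≢_)
open import Function.Bundles using (_⇔_)

record Graph (n : ℕ) : Set where
  field
    adj   : Fin n → Fin n → Bool
    sym   : ∀ u v → adj u v ≡ adj v u
    irrefl : ∀ v → adj v v ≡ false
open Graph public

degree : ∀ {n} → Graph n → Fin n → ℕ
degree {n} G v = sum (map (λ w → if adj G v w then 1 else 0) (allFin n))

data Walk {n} (G : Graph n) (ok : Fin n → Set) : Fin n → Fin n → Set where
  here : ∀ {u} → ok u → Walk G ok u u
  step : ∀ {u w v} → ok u → adj G u w ≡ true → Walk G ok w v → Walk G ok u v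

Connected : ∀ {n} → Graph n → Set
Connected {n} G = ∀ (u v : Fin n) → Walk G (λ _ → Fin n) u v

KConnected : ∀ {n} → ℕ → Graph n → Set
KConnected {n} k G =
  k < n × (∀ (S : Subset n) → ∣ S ∣ < k →
           ∀ u v → u ∉ S → v ∉ S → Walk G (λ x → x ∉ S) u v)

data Chain {n} (G : Graph n) : List (Fin n) → Set where
  nil    : Chain G []
  single : ∀ {u} → Chain G (u ∷ [])
  cons   : ∀ {u w ws} → adj G u w ≡ true → Chain G (w ∷ ws) → Chain G (u ∷ w ∷ ws)

record Cycle {n} (G : Graph n) : Set where
  field
    start  : Fin n
    rest   : List (Fin n)
    len≥2  : 2 ≤ length rest
    unique : Unique (start ∷ rest)
    closed : Chain G (start ∷ rest ++ start ∷ [])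
open Cycle public

_∈C_ : ∀ {n} {G : Graph n} → Fin n → Cycle G → Set
v ∈C C = v ∈ (start C ∷ rest C)

_⊆G_ : ∀ {n} → Graph n → Graph n → Set
H ⊆G G = ∀ u v → adj H u v ≡ true → adj G u v ≡ true

IsTree : ∀ {n} → Graph n → Set
IsTree T = Connected T × ¬ Cycle T

IsSpanningTree : ∀ {n} → Graph n → Graph n → Set
IsSpanningTree G T = T ⊆G G × IsTree T

IsHIST : ∀ {n} → Graph n → Graph n → Set
IsHIST G T = IsSpanningTree G T × (∀ v → degree T v ≢ 2)

IsLeaf : ∀ {n} → Graph n → Fin n → Set
IsLeaf T v = degree T v ≡ 1

-- G contains a spanning generalized Halin graph T ∪ C
HasSpanningGenHalin : ∀ {n} → Graph n → Set
HasSpanningGenHalin G =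
  Σ _ λ T → IsHIST G T ×
    Σ (Cycle G) λ C → ∀ v → (v ∈C C) ⇔ IsLeaf T v

{-# OPTIONS --safe #-}
module Submission where

-- Let d be the least integer with 5d ≥ 2n + 3, so that all degrees are at least d.
-- A totally dominating tree U of O(log n) vertices is grown greedily; by 3-connectedness it can be
-- chosen so that H = G − U is 2-connected: if H has a cut vertex, then G consists of two dense halves
-- joined by three disjoint edges, and one regrows U around one of these edges, avoiding the other two.
-- As 3 δ(H) exceeds |H|, a longest cycle C of H has an independent complement R in H (otherwise three
-- vertices, two of them successors on C of neighbours of H − C, violate the degree sum condition).
-- If R is not too large, a greedy choice gives each vertex of U ∪ R two private neighbours on C, every
-- other vertex of C hangs on U, and the resulting tree has precisely C as its set of leaves.
-- Otherwise |R| is about n/5, and R together with the vertices b of C for which the predecessor and the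
-- successor of b are neighbours of a fixed r ∈ R is an independent set I with |I| ≥ 3n/5 − O(log n).
-- Then G is almost complete bipartite between I and J = V − I.  With |J| = d + s, let X be the set of the
-- p ≤ s vertices of J with few neighbours in I.  The tree consists of X, of s − p + 1 hubs in J, which
-- dominate I, and of a part N of I, while the cycle alternates between the remaining d − 1 vertices of J
-- and I − N.  Each vertex of X ∪ N gets two leaves in J, which is possible exactly because 5d ≥ 2n + 3.

-- One principle carries most of the argument: as 3d exceeds `n` by a linear amount, no three
-- neighbourhoods are pairwise disjoint. It bounds the length of connecting paths, yields a vertex
-- dominating a third of any given set, leaves a disconnected remainder only two dense sides, and
-- makes `R` independent. These steps have room linear in `n`, while the losses to be absorbed are
-- of order log n, or its cube in the extremal case; hence a logarithmic tree is harmless, and hence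
-- the size of `n₀`. The supply of leaves in the extremal case has no such room. As `I` is
-- independent, the vertices of `I` inside the tree find their two leaves only among the d - 1
-- vertices of `J` on the cycle, and every vertex of `J` that is a hub or belongs to `X` is lost for
-- this purpose. So the number of hubs is the least for which they are sure to dominate `I`, and the
-- vertices of `I` that see `X`, which may have fewer candidates, are few and are served first.

open import Defs renaming (sym to adj-sym; irrefl to adj-irrefl)
open import Data.Nat
open import Data.Nat.Properties
open import Data.Nat.DivMod using (_/_; _%_; m≡m%n+[m/n]*n; m%n<n; m/n*n≤m)
open import Data.Nat.ListAction using (sum)
open import Data.Nat.ListAction.Properties using (sum-↭; sum-++)
open import Data.Integer as ℤ using (ℤ; -[1+_]; _⊖_)
open import Data.Bool using (Bool; true; false; not; _∧_; _∨_; T; if_then_else_)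
import Data.Bool.Properties as Boolₚ
open import Data.Unit using (tt)
open import Data.Empty using (⊥; ⊥-elim)
open import Data.Maybe using (Maybe; just; nothing)
open import Data.Product using (Σ; ∃; ∃₂; _×_; _,_; proj₁; proj₂)
open import Data.Sum using (_⊎_; inj₁; inj₂)
open import Data.Fin as Fin using (Fin; zero; suc)
import Data.Fin.Properties as Finₚ
open import Data.Fin.Subset as S using (Subset; ⁅_⁆; _∪_; ∣_∣)
import Data.Fin.Subset.Properties as Sₚ
open import Data.Vec as V using (Vec; []; _∷_)
open import Data.Vec.Properties using (≡-dec)
open import Data.Vec.N-ary using (N-ary; _$ⁿ_)
open import Data.List as L using (List; []; _∷_; _++_; length; map; allFin; reverse)
open import Data.List.Properties using (map-++; ++-assoc; ++-identityʳ; length-++; unfold-reverse; ∷-injectiveʳ; length-tabulate)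
open import Data.List.Relation.Unary.All as All using (All; []; _∷_)
open import Data.List.Relation.Unary.All.Properties using (++⁺)
open import Data.List.Relation.Unary.AllPairs using ([]; _∷_)
open import Data.List.Relation.Unary.Any using (here; there)
open import Data.List.Relation.Unary.Unique.Propositional using (Unique)
open import Data.List.Relation.Unary.Unique.Propositional.Properties using (allFin⁺)
open import Data.List.Membership.Propositional using (_∈_; _∉_)
open import Data.List.Membership.Propositional.Properties
open import Data.List.Relation.Binary.Permutation.Propositional using (_↭_; prep; ↭-refl; ↭-sym; ↭-trans; ↭-reflexive; ↭⇒↭ₛ; module PermutationReasoning)
import Data.List.Relation.Binary.Permutation.Propositional.Properties as ↭ₚ
import Data.List.Relation.Binary.Permutation.Setoid.Properties as ↭Sₚ
open import Relation.Nullary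
open import Relation.Nullary.Decidable using (⌊_⌋; toWitness; map′; _×-dec_)
open import Relation.Binary.PropositionalEquality hiding ([_])
open import Function using (_∘_; case_of_)
open import Function.Bundles using (mk⇔)

-- Linear arithmetic

infix  4 _:≤_ _:≡_ _:<_
infixl 6 _:+_
infixl 7 _:*_
infix  3 ⊢_
infixr 2 _⇒_

data Expr (n : ℕ) : Set where
  var  : Fin n → Expr n
  con  : ℕ → Expr n
  _:+_ : Expr n → Expr n → Expr n
  _:*_ : ℕ → Expr n → Expr n

data Con (n : ℕ) : Set where
  _:≤_ _:<_ _:≡_ : Expr n → Expr n → Con n
  :⊥ : Con n

data Problem (n : ℕ) : Set where
  ⊢_  : Con n → Problem n
  _⇒_ : Con n → Problem n → Problem n

⟦_⟧ : ∀ {n} → Expr n → Vec ℕ n → ℕ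
⟦ var i ⟧ ρ = V.lookup ρ i
⟦ con k ⟧ ρ = k
⟦ e :+ f ⟧ ρ = ⟦ e ⟧ ρ + ⟦ f ⟧ ρ
⟦ k :* e ⟧ ρ = k * ⟦ e ⟧ ρ

⟦_⟧ᶜ : ∀ {n} → Con n → Vec ℕ n → Set
⟦ e :≤ f ⟧ᶜ ρ = ⟦ e ⟧ ρ ≤ ⟦ f ⟧ ρ
⟦ e :< f ⟧ᶜ ρ = ⟦ e ⟧ ρ < ⟦ f ⟧ ρ
⟦ e :≡ f ⟧ᶜ ρ = ⟦ e ⟧ ρ ≡ ⟦ f ⟧ ρ
⟦ :⊥ ⟧ᶜ ρ = ⊥

⟦_⟧ᵖ : ∀ {n} → Problem n → Vec ℕ n → Set
⟦ ⊢ c ⟧ᵖ ρ = ⟦ c ⟧ᶜ ρ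
⟦ c ⇒ p ⟧ᵖ ρ = ⟦ c ⟧ᶜ ρ → ⟦ p ⟧ᵖ ρ

Row : ℕ → Set
Row n = Expr n × Expr n

rows : ∀ {n} → Con n → List (Row n)
rows (e :≤ f) = (e , f) ∷ []
rows (e :< f) = (con 1 :+ e , f) ∷ []
rows (e :≡ f) = (e , f) ∷ (f , e) ∷ []
rows :⊥ = []

-- A constraint is proved by refuting its negation; an equality has two negations.
negations : ∀ {n} → Con n → List (Row n)
negations (e :≤ f) = (con 1 :+ f , e) ∷ []
negations (e :< f) = (f , e) ∷ []
negations (e :≡ f) = (con 1 :+ f , e) ∷ (con 1 :+ e , f) ∷ []
negations :⊥ = (con 0 , con 0) ∷ []

Holds : ∀ {n} → Vec ℕ n → Row n → Set
Holds ρ (e , f) = ⟦ e ⟧ ρ ≤ ⟦ f ⟧ ρ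

zeros : ∀ n → Vec ℕ n
zeros n = V.replicate n 0

unit : ∀ {n} → Fin n → Vec ℕ n
unit zero = 1 ∷ zeros _
unit (suc i) = 0 ∷ unit i

Linear : ℕ → Set
Linear n = ℕ × Vec ℕ n

dot : ∀ {n} → Vec ℕ n → Vec ℕ n → ℕ
dot [] [] = 0
dot (a ∷ as) (x ∷ xs) = a * x + dot as xs

value : ∀ {n} → Linear n → Vec ℕ n → ℕ
value (k , as) ρ = k + dot as ρ

_⊞_ : ∀ {n} → Linear n → Linear n → Linear n
(k , as) ⊞ (l , bs) = k + l , V.zipWith _+_ as bs

_⊠_ : ∀ {n} → ℕ → Linear n → Linear n
c ⊠ (k , as) = c * k , V.map (c *_) as

normal : ∀ {n} → Expr n → Linear n
normal (var i) = 0 , unit i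
normal (con k) = k , zeros _
normal (e :+ f) = normal e ⊞ normal f
normal (k :* e) = k ⊠ normal e

dot-zeros : ∀ {n} (ρ : Vec ℕ n) → dot (zeros n) ρ ≡ 0
dot-zeros [] = refl
dot-zeros (x ∷ ρ) = dot-zeros ρ

dot-unit : ∀ {n} (i : Fin n) (ρ : Vec ℕ n) → dot (unit i) ρ ≡ V.lookup ρ i
dot-unit zero (x ∷ ρ) = trans (cong₂ _+_ (+-identityʳ x) (dot-zeros ρ)) (+-identityʳ x)
dot-unit (suc i) (x ∷ ρ) = dot-unit i ρ

interchange : ∀ a b c d → (a + b) + (c + d) ≡ (a + c) + (b + d)
interchange a b c d = trans (+-assoc a b (c + d)) (trans (cong (a +_) (trans (sym (+-assoc b c d))
  (trans (cong (_+ d) (+-comm b c)) (+-assoc c b d)))) (sym (+-assoc a c (b + d))))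

dot-⊞ : ∀ {n} (as bs ρ : Vec ℕ n) → dot (V.zipWith _+_ as bs) ρ ≡ dot as ρ + dot bs ρ
dot-⊞ [] [] [] = refl
dot-⊞ (a ∷ as) (b ∷ bs) (x ∷ ρ) = trans (cong₂ _+_ (*-distribʳ-+ x a b) (dot-⊞ as bs ρ))
  (interchange (a * x) (b * x) _ _)

dot-⊠ : ∀ {n} c (as ρ : Vec ℕ n) → dot (V.map (c *_) as) ρ ≡ c * dot as ρ
dot-⊠ c [] [] = sym (*-zeroʳ c)
dot-⊠ c (a ∷ as) (x ∷ ρ) = trans (cong₂ _+_ (*-assoc c a x) (dot-⊠ c as ρ)) (sym (*-distribˡ-+ c _ _))

value-⊞ : ∀ {n} (u v : Linear n) ρ → value (u ⊞ v) ρ ≡ value u ρ + value v ρ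
value-⊞ (k , as) (l , bs) ρ = trans (cong (k + l +_) (dot-⊞ as bs ρ)) (interchange k l _ _)

value-⊠ : ∀ {n} c (u : Linear n) ρ → value (c ⊠ u) ρ ≡ c * value u ρ
value-⊠ c (k , as) ρ = trans (cong (c * k +_) (dot-⊠ c as ρ)) (sym (*-distribˡ-+ c _ _))

normal-correct : ∀ {n} (e : Expr n) ρ → value (normal e) ρ ≡ ⟦ e ⟧ ρ
normal-correct (var i) ρ = dot-unit i ρ
normal-correct (con k) ρ = trans (cong (k +_) (dot-zeros ρ)) (+-identityʳ k)
normal-correct (e :+ f) ρ = trans (value-⊞ (normal e) (normal f) ρ)
  (cong₂ _+_ (normal-correct e ρ) (normal-correct f ρ))
normal-correct (k :* e) ρ = trans (value-⊠ k (normal e) ρ) (cong (k *_) (normal-correct e ρ))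

combine : ∀ {n} → List ℕ → List (Row n) → Linear n × Linear n
combine (c ∷ cs) ((e , f) ∷ rs) = (c ⊠ normal e) ⊞ proj₁ (combine cs rs) , (c ⊠ normal f) ⊞ proj₂ (combine cs rs)
combine _ _ = (0 , zeros _) , (0 , zeros _)

combine-holds : ∀ {n} cs (rs : List (Row n)) ρ → All (Holds ρ) rs →
  value (proj₁ (combine cs rs)) ρ ≤ value (proj₂ (combine cs rs)) ρ
combine-holds [] rs ρ hs = ≤-refl
combine-holds (c ∷ cs) [] ρ hs = ≤-refl
combine-holds (c ∷ cs) ((e , f) ∷ rs) ρ (h ∷ hs) = subst₂ _≤_ (sym (weighted e (proj₁ (combine cs rs)))) (sym (weighted f (proj₂ (combine cs rs))))
  (+-mono-≤ (*-monoʳ-≤ c h) (combine-holds cs rs ρ hs))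
  where
  weighted : ∀ e v → value ((c ⊠ normal e) ⊞ v) ρ ≡ c * ⟦ e ⟧ ρ + value v ρ
  weighted e v = trans (value-⊞ (c ⊠ normal e) v ρ)
    (cong (_+ value v ρ) (trans (value-⊠ c (normal e) ρ) (cong (c *_) (normal-correct e ρ))))

_≤ᵛ_ : ∀ {n} → Vec ℕ n → Vec ℕ n → Bool
[] ≤ᵛ [] = true
(a ∷ as) ≤ᵛ (b ∷ bs) = if a ≤ᵇ b then as ≤ᵛ bs else false

≤ᵛ-sound : ∀ {n} (as bs : Vec ℕ n) → T (as ≤ᵛ bs) → ∀ ρ → dot as ρ ≤ dot bs ρ
≤ᵛ-sound [] [] _ [] = z≤n
≤ᵛ-sound (a ∷ as) (b ∷ bs) t (x ∷ ρ) with a ≤ᵇ b in eq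
... | true = +-mono-≤ (*-monoˡ-≤ x (≤ᵇ⇒≤ a b (subst T (sym eq) tt))) (≤ᵛ-sound as bs t ρ)

-- The certificate check. The weighted sum of the rows is contradictory when its left side has the
-- larger constant and, coefficient by coefficient, at least the weight of its right side; the
-- variables being natural numbers, no equality of coefficients is required.
refutes : ∀ {n} → List ℕ → List (Row n) → Bool
refutes cs rs with combine cs rs
... | (k , as) , (l , bs) = if l <ᵇ k then bs ≤ᵛ as else false

refutes-sound : ∀ {n} cs (rs : List (Row n)) → T (refutes cs rs) → ∀ ρ → ¬ All (Holds ρ) rs
refutes-sound cs rs t ρ hs with combine cs rs | combine-holds cs rs ρ hs
... | (k , as) , (l , bs) | le with l <ᵇ k in eq
... | true = <-irrefl refl (≤-trans (+-mono-≤ (<ᵇ⇒< l k (subst T (sym eq) tt)) (≤ᵛ-sound bs as t ρ)) le)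

-- Fourier–Motzkin elimination in search of a refuting combination.  A row a ≤ b carries the integer
-- coefficients of b − a and its multipliers; as variables are natural numbers, a negative
-- coefficient may be dropped, and a row without negative entries is void.
record FMRow : Set where
  constructor fm
  field
    coefs : List ℤ
    bound : ℤ
    mults : List ℕ

scale : ℕ → FMRow → FMRow
scale k (fm as c ms) = fm (L.map (ℤ._*_ (ℤ.+ k)) as) (ℤ.+ k ℤ.* c) (L.map (k *_) ms)

addRow : FMRow → FMRow → FMRow
addRow (fm as c ms) (fm bs d ns) = fm (L.zipWith ℤ._+_ as bs) (c ℤ.+ d) (L.zipWith _+_ ms ns)

nonneg : ℤ → Bool
nonneg (ℤ.+ _) = true
nonneg -[1+ _ ] = false

void : FMRow → Bool
void (fm as c _) = L.foldr (λ a b → nonneg a ∧ b) true (c ∷ as)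

eliminate : List FMRow → List FMRow × List (ℕ × FMRow) × List (ℕ × FMRow)
eliminate [] = [] , [] , []
eliminate (fm [] c ms ∷ rs) = eliminate rs
eliminate (fm (a ∷ as) c ms ∷ rs) with eliminate rs
... | zs , ps , ns with a
... | ℤ.+ zero = fm as c ms ∷ zs , ps , ns
... | ℤ.+ suc k = zs , (suc k , fm as c ms) ∷ ps , ns
... | -[1+ k ] = fm as c ms ∷ zs , ps , (suc k , fm as c ms) ∷ ns

search : ℕ → List FMRow → Maybe (List ℕ)
search zero rs with L.filterᵇ (λ r → not (nonneg (FMRow.bound r))) rs
... | [] = nothing
... | r ∷ _ = just (FMRow.mults r)
search (suc n) rs with eliminate rs
... | zs , ps , ns = search n (L.filterᵇ (λ r → not (void r))
  (zs ++ L.concatMap (λ (k , p) → L.map (λ (l , q) → addRow (scale l p) (scale k q)) ns) ps))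

fmRows : ∀ {n} → ℕ → ℕ → List (Row n) → List FMRow
fmRows i zero _ = []
fmRows i (suc j) [] = []
fmRows i (suc j) ((e , f) ∷ rs) with normal e | normal f
... | (k , as) | (l , bs) = fm (V.toList (V.zipWith (λ a b → b ⊖ a) as bs)) (l ⊖ k)
  (L.replicate i 0 ++ 1 ∷ L.replicate j 0) ∷ fmRows (suc i) j rs

-- Nothing is proved about the search. Whatever it returns, the empty list on failure included, is
-- tested by `refutes`, so that correctness rests on `refutes-sound` alone.
multipliers : ∀ {n} → List (Row n) → List ℕ
multipliers {n} rs with search n (fmRows 0 (L.length rs) rs)
... | just ms = ms
... | nothing = []

refutesAll : ∀ {n} → List (Row n) → List (Row n) → Bool
refutesAll [] rs = true
refutesAll (g ∷ gs) rs = if refutes (multipliers (g ∷ rs)) (g ∷ rs) then refutesAll gs rs else false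

valid : ∀ {n} → List (Row n) → Problem n → Bool
valid rs (⊢ c) = refutesAll (negations c) rs
valid rs (c ⇒ p) = valid (rows c ++ rs) p

refutesAll-sound : ∀ {n} gs {rs : List (Row n)} → T (refutesAll gs rs) → ∀ {ρ} → All (Holds ρ) rs → All (λ g → ¬ Holds ρ g) gs
refutesAll-sound [] t hs = []
refutesAll-sound (g ∷ gs) {rs} t {ρ} hs with refutes (multipliers (g ∷ rs)) (g ∷ rs) in eq
... | true = (λ h → refutes-sound (multipliers (g ∷ rs)) (g ∷ rs) (subst T (sym eq) tt) ρ (h ∷ hs))
           ∷ refutesAll-sound gs t hs

rows-hold : ∀ {n} (c : Con n) {ρ} → ⟦ c ⟧ᶜ ρ → All (Holds ρ) (rows c)
rows-hold (e :≤ f) h = h ∷ []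
rows-hold (e :< f) h = h ∷ []
rows-hold (e :≡ f) h = ≤-reflexive h ∷ ≤-reflexive (sym h) ∷ []
rows-hold :⊥ h = []

negations-fail : ∀ {n} (c : Con n) {ρ} → All (λ g → ¬ Holds ρ g) (negations c) → ⟦ c ⟧ᶜ ρ
negations-fail (e :≤ f) (h ∷ []) = ≮⇒≥ h
negations-fail (e :< f) (h ∷ []) = ≰⇒> h
negations-fail (e :≡ f) (h ∷ h′ ∷ []) = ≤-antisym (≮⇒≥ h) (≮⇒≥ h′)
negations-fail :⊥ (h ∷ []) = h z≤n

valid-sound : ∀ {n} {rs : List (Row n)} p → T (valid rs p) → ∀ {ρ} → All (Holds ρ) rs → ⟦ p ⟧ᵖ ρ
valid-sound (⊢ c) t hs = negations-fail c (refutesAll-sound (negations c) t hs)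
valid-sound (c ⇒ p) t hs h = valid-sound p t (++⁺ (rows-hold c h) hs)

curryᵖ : ∀ n → (Vec ℕ n → Set) → Set
curryᵖ zero P = P []
curryᵖ (suc n) P = ∀ x → curryᵖ n (λ ρ → P (x ∷ ρ))

curry-proof : ∀ n {P : Vec ℕ n → Set} → (∀ ρ → P ρ) → curryᵖ n P
curry-proof zero f = f []
curry-proof (suc n) f x = curry-proof n (λ ρ → f (x ∷ ρ))

problem : ∀ n → N-ary n (Expr n) (Problem n) → Problem n
problem n p = p $ⁿ V.map var (V.allFin n)

-- The hidden argument is settled by evaluation: `valid` runs the search on the closed problem, and
-- when it succeeds the type reduces to the unit type. The variables are instantiated only
-- afterwards, so nonlinear terms may take their place.
linarith : ∀ n (p : N-ary n (Expr n) (Problem n)) {_ : T (valid [] (problem n p))} → curryᵖ n (⟦ problem n p ⟧ᵖ)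
linarith n p {t} = curry-proof n (λ ρ → valid-sound (problem n p) t [])

-- Permutations

infixr 6 _⊕_
infix  4 _≋_
infix  3 ⊢ₚ_
infixr 2 _⇒ₚ_

-- Reversal belongs to the syntax because rerouted cycles run through segments backwards; it does
-- not change the multiplicities of the atoms.
data LExpr (n : ℕ) : Set where
  atom : Fin n → LExpr n
  ε    : LExpr n
  _⊕_  : LExpr n → LExpr n → LExpr n
  rev  : LExpr n → LExpr n

data PCon (n : ℕ) : Set where
  _≋_ : LExpr n → LExpr n → PCon n

data PProblem (n : ℕ) : Set where
  ⊢ₚ_  : PCon n → PProblem n
  _⇒ₚ_ : PCon n → PProblem n → PProblem n

module _ {A : Set} where

  ⟦_⟧ˡ : ∀ {n} → LExpr n → Vec (List A) n → List A
  ⟦ atom i ⟧ˡ ρ = V.lookup ρ i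
  ⟦ ε ⟧ˡ ρ = []
  ⟦ e ⊕ f ⟧ˡ ρ = ⟦ e ⟧ˡ ρ ++ ⟦ f ⟧ˡ ρ
  ⟦ rev e ⟧ˡ ρ = reverse (⟦ e ⟧ˡ ρ)

  ⟦_⟧ᵖˡ : ∀ {n} → PProblem n → Vec (List A) n → Set
  ⟦ ⊢ₚ e ≋ f ⟧ᵖˡ ρ = ⟦ e ⟧ˡ ρ ↭ ⟦ f ⟧ˡ ρ
  ⟦ e ≋ f ⇒ₚ p ⟧ᵖˡ ρ = ⟦ e ⟧ˡ ρ ↭ ⟦ f ⟧ˡ ρ → ⟦ p ⟧ᵖˡ ρ

  mult : ∀ {n} → LExpr n → Vec ℕ n
  mult (atom i) = unit i
  mult ε = zeros _
  mult (e ⊕ f) = V.zipWith _+_ (mult e) (mult f)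
  mult (rev e) = mult e

  copies : ℕ → List A → List A
  copies zero xs = []
  copies (suc k) xs = xs ++ copies k xs

  expand : ∀ {n} → Vec ℕ n → Vec (List A) n → List A
  expand [] [] = []
  expand (k ∷ ks) (xs ∷ ρ) = copies k xs ++ expand ks ρ

  ++-interchange : (ws xs ys zs : List A) → (ws ++ xs) ++ (ys ++ zs) ↭ (ws ++ ys) ++ (xs ++ zs)
  ++-interchange ws xs ys zs = begin
    (ws ++ xs) ++ (ys ++ zs) ≡⟨ ++-assoc ws xs (ys ++ zs) ⟩
    ws ++ (xs ++ (ys ++ zs)) ↭⟨ ↭ₚ.++⁺ˡ ws (↭ₚ.shifts xs ys) ⟩
    ws ++ (ys ++ (xs ++ zs)) ≡⟨ ++-assoc ws ys (xs ++ zs) ⟨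
    (ws ++ ys) ++ (xs ++ zs) ∎
    where open PermutationReasoning

  copies-+ : ∀ k l xs → copies (k + l) xs ≡ copies k xs ++ copies l xs
  copies-+ zero l xs = refl
  copies-+ (suc k) l xs = trans (cong (xs ++_) (copies-+ k l xs)) (sym (++-assoc xs (copies k xs) (copies l xs)))

  expand-+ : ∀ {n} (ks ls : Vec ℕ n) ρ → expand (V.zipWith _+_ ks ls) ρ ↭ expand ks ρ ++ expand ls ρ
  expand-+ [] [] [] = ↭-refl
  expand-+ (k ∷ ks) (l ∷ ls) (xs ∷ ρ) = ↭-trans
    (↭ₚ.++⁺ (↭-reflexive (copies-+ k l xs)) (expand-+ ks ls ρ)) (++-interchange (copies k xs) _ _ _)

  expand-zeros : ∀ {n} (ρ : Vec (List A) n) → expand (zeros n) ρ ≡ []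
  expand-zeros [] = refl
  expand-zeros (xs ∷ ρ) = expand-zeros ρ

  expand-unit : ∀ {n} (i : Fin n) ρ → expand (unit i) ρ ≡ V.lookup ρ i
  expand-unit zero (xs ∷ ρ) = trans (cong₂ _++_ (++-identityʳ xs) (expand-zeros ρ)) (++-identityʳ xs)
  expand-unit (suc i) (xs ∷ ρ) = expand-unit i ρ

  expand-mult : ∀ {n} (e : LExpr n) ρ → ⟦ e ⟧ˡ ρ ↭ expand (mult e) ρ
  expand-mult (atom i) ρ = ↭-reflexive (sym (expand-unit i ρ))
  expand-mult ε ρ = ↭-reflexive (sym (expand-zeros ρ))
  expand-mult (e ⊕ f) ρ = ↭-trans (↭ₚ.++⁺ (expand-mult e ρ) (expand-mult f ρ)) (↭-sym (expand-+ (mult e) (mult f) ρ))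
  expand-mult (rev e) ρ = ↭-trans (↭ₚ.↭-reverse _) (expand-mult e ρ)

  ++-cancelʳ-↭ : ∀ (xs : List A) {ys zs} → ys ++ xs ↭ zs ++ xs → ys ↭ zs
  ++-cancelʳ-↭ [] {ys} {zs} p = subst₂ _↭_ (++-identityʳ ys) (++-identityʳ zs) p
  ++-cancelʳ-↭ (x ∷ xs) {ys} {zs} p = ++-cancelʳ-↭ xs (↭ₚ.drop-mid ys zs p)

  -- The hypotheses are accumulated as one permutation l ↭ r; each is used exactly once, from left to right.
  balanced : ∀ {n} → LExpr n → LExpr n → PProblem n → Bool
  balanced l r (⊢ₚ e ≋ f) = ⌊ ≡-dec _≟_ (mult (e ⊕ r)) (mult (f ⊕ l)) ⌋
  balanced l r (e ≋ f ⇒ₚ p) = balanced (e ⊕ l) (f ⊕ r) p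

  -- Lists up to permutation form a cancellative commutative monoid. If `e ⊕ r` and `f ⊕ l` contain
  -- each atom equally often, then `e ⊕ l`, which the hypotheses turn into `e ⊕ r`, is a permutation
  -- of `f ⊕ l`, and `l` cancels.
  balanced-sound : ∀ {n} l r (p : PProblem n) → T (balanced l r p) → ∀ ρ → ⟦ l ⟧ˡ ρ ↭ ⟦ r ⟧ˡ ρ → ⟦ p ⟧ᵖˡ ρ
  balanced-sound l r (⊢ₚ e ≋ f) t ρ h = ++-cancelʳ-↭ (⟦ l ⟧ˡ ρ) (begin
    ⟦ e ⟧ˡ ρ ++ ⟦ l ⟧ˡ ρ   ↭⟨ ↭ₚ.++⁺ˡ (⟦ e ⟧ˡ ρ) h ⟩
    ⟦ e ⊕ r ⟧ˡ ρ           ↭⟨ expand-mult (e ⊕ r) ρ ⟩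
    expand (mult (e ⊕ r)) ρ ≡⟨ cong (λ m → expand m ρ) (toWitness t) ⟩
    expand (mult (f ⊕ l)) ρ ↭⟨ ↭-sym (expand-mult (f ⊕ l) ρ) ⟩
    ⟦ f ⟧ˡ ρ ++ ⟦ l ⟧ˡ ρ   ∎)
    where open PermutationReasoning
  balanced-sound l r (e ≋ f ⇒ₚ p) t ρ h k = balanced-sound (e ⊕ l) (f ⊕ r) p t ρ (↭ₚ.++⁺ k h)

  curryˡ : ∀ n → (Vec (List A) n → Set) → Set
  curryˡ zero P = P []
  curryˡ (suc n) P = ∀ xs → curryˡ n (λ ρ → P (xs ∷ ρ))

  curryˡ-proof : ∀ n {P : Vec (List A) n → Set} → (∀ ρ → P ρ) → curryˡ n P
  curryˡ-proof zero f = f []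
  curryˡ-proof (suc n) f xs = curryˡ-proof n (λ ρ → f (xs ∷ ρ))

pproblem : ∀ n → N-ary n (LExpr n) (PProblem n) → PProblem n
pproblem n p = p $ⁿ V.map atom (V.allFin n)

permute : ∀ {A : Set} n (p : N-ary n (LExpr n) (PProblem n)) {_ : T (balanced {A} ε ε (pproblem n p))} →
  curryˡ {A} n (⟦ pproblem n p ⟧ᵖˡ)
permute n p {t} = curryˡ-proof n (λ ρ → balanced-sound ε ε (pproblem n p) t ρ ↭-refl)

-- Counting

true≢false : ∀ {b} → b ≡ true → b ≡ false → ⊥
true≢false refl ()

bool : ∀ b → b ≡ true ⊎ b ≡ false
bool true = inj₁ refl
bool false = inj₂ refl

∧-true : ∀ a {b} → a ∧ b ≡ true → a ≡ true × b ≡ true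
∧-true true h = refl , h

∧-intro : ∀ {a b} → a ≡ true → b ≡ true → a ∧ b ≡ true
∧-intro refl refl = refl

not-true : ∀ {a} → not a ≡ true → a ≡ false
not-true {false} _ = refl

𝟙 : Bool → ℕ
𝟙 b = if b then 1 else 0

𝟙≤1 : ∀ b → 𝟙 b ≤ 1
𝟙≤1 true = ≤-refl
𝟙≤1 false = z≤n

𝟙-true : ∀ {b} → b ≡ true → 𝟙 b ≡ 1
𝟙-true refl = refl

𝟙-false : ∀ {b} → b ≡ false → 𝟙 b ≡ 0
𝟙-false refl = refl

𝟙-mono : ∀ {a b} → (a ≡ true → b ≡ true) → 𝟙 a ≤ 𝟙 b
𝟙-mono {false} h = z≤n
𝟙-mono {true} h rewrite h refl = ≤-refl

𝟙-or : ∀ {a b c} → (a ≡ true → b ≡ false → c ≡ true) → 𝟙 a ≤ 𝟙 b + 𝟙 c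
𝟙-or {false} h = z≤n
𝟙-or {true} {true} h = s≤s z≤n
𝟙-or {true} {false} h rewrite h refl refl = ≤-refl

𝟙-excl : ∀ {a b} → (a ≡ true → b ≡ true → ⊥) → 𝟙 a + 𝟙 b ≤ 1
𝟙-excl {false} {b} h = 𝟙≤1 b
𝟙-excl {true} {false} h = ≤-refl
𝟙-excl {true} {true} h = ⊥-elim (h refl refl)

𝟙-excl₃ : ∀ {a b c} → (a ≡ true → b ≡ true → ⊥) → (a ≡ true → c ≡ true → ⊥) →
  (b ≡ true → c ≡ true → ⊥) → 𝟙 a + 𝟙 b + 𝟙 c ≤ 1
𝟙-excl₃ {false} h h′ h″ = 𝟙-excl h″
𝟙-excl₃ {true} {false} h h′ h″ = 𝟙-excl h′
𝟙-excl₃ {true} {true} h h′ h″ = ⊥-elim (h refl refl)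

-- Written like the body of `degree`, so that `degree G v` and the count of `adj G v` over all
-- vertices agree by definition.
cnt : {A : Set} → (A → Bool) → List A → ℕ
cnt P xs = sum (map (λ x → if P x then 1 else 0) xs)

module _ {A : Set} where

  cnt-++ : ∀ (P : A → Bool) xs ys → cnt P (xs ++ ys) ≡ cnt P xs + cnt P ys
  cnt-++ P xs ys = trans (cong sum (map-++ _ xs ys)) (sum-++ (map _ xs) (map _ ys))

  cnt-↭ : ∀ (P : A → Bool) {xs ys} → xs ↭ ys → cnt P xs ≡ cnt P ys
  cnt-↭ P p = sum-↭ (↭ₚ.map⁺ _ p)

  cnt-↭-++ : ∀ (P : A → Bool) {xs} ys zs → xs ↭ ys ++ zs → cnt P xs ≡ cnt P ys + cnt P zs
  cnt-↭-++ P ys zs p = trans (cnt-↭ P p) (cnt-++ P ys zs)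

  length-↭-++ : ∀ {xs : List A} ys zs → xs ↭ ys ++ zs → length xs ≡ length ys + length zs
  length-↭-++ ys zs p = trans (↭ₚ.↭-length p) (length-++ ys)

  cnt≤length : ∀ (P : A → Bool) xs → cnt P xs ≤ length xs
  cnt≤length P [] = z≤n
  cnt≤length P (x ∷ xs) = +-mono-≤ (𝟙≤1 (P x)) (cnt≤length P xs)

  cnt-mono : ∀ {P Q : A → Bool} xs → (∀ {x} → x ∈ xs → P x ≡ true → Q x ≡ true) → cnt P xs ≤ cnt Q xs
  cnt-mono [] h = z≤n
  cnt-mono (x ∷ xs) h = +-mono-≤ (𝟙-mono (h (here refl))) (cnt-mono xs (h ∘ there))

  cnt-or : ∀ {P Q R : A → Bool} xs → (∀ {x} → x ∈ xs → P x ≡ true → Q x ≡ false → R x ≡ true) →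
    cnt P xs ≤ cnt Q xs + cnt R xs
  cnt-or [] h = z≤n
  cnt-or {P} {Q} {R} (x ∷ xs) h = ≤-trans (+-mono-≤ (𝟙-or (h (here refl))) (cnt-or xs (h ∘ there)))
    (≤-reflexive (interchange (𝟙 (Q x)) (𝟙 (R x)) (cnt Q xs) (cnt R xs)))

  cnt-all : ∀ {P : A → Bool} xs → (∀ {x} → x ∈ xs → P x ≡ true) → cnt P xs ≡ length xs
  cnt-all [] h = refl
  cnt-all (x ∷ xs) h = cong₂ _+_ (𝟙-true (h (here refl))) (cnt-all xs (h ∘ there))

  cnt-none : ∀ {P : A → Bool} xs → (∀ {x} → x ∈ xs → P x ≡ false) → cnt P xs ≡ 0
  cnt-none [] h = refl
  cnt-none (x ∷ xs) h = cong₂ _+_ (𝟙-false (h (here refl))) (cnt-none xs (h ∘ there))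

  cnt-both : ∀ (P Q : A → Bool) xs → cnt P xs + cnt Q xs ≤ length xs + cnt (λ x → P x ∧ Q x) xs
  cnt-both P Q [] = z≤n
  cnt-both P Q (x ∷ xs) = ≤-trans (≤-reflexive (interchange (𝟙 (P x)) _ (𝟙 (Q x)) _))
    (≤-trans (+-mono-≤ (one (P x) (Q x)) (cnt-both P Q xs)) (≤-reflexive (interchange 1 (𝟙 (P x ∧ Q x)) (length xs) (cnt (λ y → P y ∧ Q y) xs))))
    where
    one : ∀ a b → 𝟙 a + 𝟙 b ≤ 1 + 𝟙 (a ∧ b)
    one true b = ≤-refl
    one false b = ≤-trans (𝟙≤1 b) (m≤m+n 1 0)

  cnt-not : ∀ (P : A → Bool) xs → cnt P xs + cnt (not ∘ P) xs ≡ length xs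
  cnt-not P [] = refl
  cnt-not P (x ∷ xs) = trans (interchange (𝟙 (P x)) _ _ _) (cong₂ _+_ (one (P x)) (cnt-not P xs))
    where
    one : ∀ a → 𝟙 a + 𝟙 (not a) ≡ 1
    one true = refl
    one false = refl

  cnt-excl₃ : ∀ {P Q R : A → Bool} xs → (∀ {x} → x ∈ xs → P x ≡ true → Q x ≡ true → ⊥) →
    (∀ {x} → x ∈ xs → P x ≡ true → R x ≡ true → ⊥) → (∀ {x} → x ∈ xs → Q x ≡ true → R x ≡ true → ⊥) →
    cnt P xs + cnt Q xs + cnt R xs ≤ length xs
  cnt-excl₃ [] h h′ h″ = z≤n
  cnt-excl₃ {P} {Q} {R} (x ∷ xs) h h′ h″ = linarith 7
    (λ p q r a b c l → p :+ q :+ r :≤ con 1 ⇒ a :+ b :+ c :≤ l ⇒ ⊢ (p :+ a) :+ (q :+ b) :+ (r :+ c) :≤ con 1 :+ l)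
    (𝟙 (P x)) (𝟙 (Q x)) (𝟙 (R x)) (cnt P xs) (cnt Q xs) (cnt R xs) (length xs)
    (𝟙-excl₃ (h (here refl)) (h′ (here refl)) (h″ (here refl)))
    (cnt-excl₃ xs (h ∘ there) (h′ ∘ there) (h″ ∘ there))

  pick : ∀ (P : A → Bool) xs → 1 ≤ cnt P xs → ∃₂ λ x ys → xs ↭ x ∷ ys × P x ≡ true
  pick P (x ∷ xs) h with P x in eq
  ... | true = x , xs , ↭-refl , eq
  ... | false with pick P xs h
  ... | y , ys , p , Py = y , x ∷ ys , ↭-trans (prep x p) (permute 3 (λ a b c → ⊢ₚ a ⊕ b ⊕ c ≋ b ⊕ a ⊕ c) (x ∷ []) (y ∷ []) ys) , Py

  member-pick : ∀ {x : A} {xs} → x ∈ xs → ∃ λ ys → xs ↭ x ∷ ys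
  member-pick x∈xs with ∈-∃++ x∈xs
  ... | ys , zs , refl = ys ++ zs , ↭ₚ.shift _ ys zs

  ∈-↭ : ∀ {x : A} {xs ys} → xs ↭ ys → x ∈ xs → x ∈ ys
  ∈-↭ p = ↭ₚ.∈-resp-↭ p

  record Split (P : A → Bool) (xs : List A) : Set where
    constructor parts
    field
      yeses nos : List A
      partition : xs ↭ yeses ++ nos
      yes-true  : ∀ {y} → y ∈ yeses → P y ≡ true
      no-false  : ∀ {z} → z ∈ nos → P z ≡ false
      size-yes  : length yeses ≡ cnt P xs

  split : ∀ P xs → Split P xs
  split P [] = parts [] [] ↭-refl (λ ()) (λ ()) refl
  split P (x ∷ xs) with split P xs | P x in eq
  ... | parts ys zs p Pys Pzs len | true = parts (x ∷ ys) zs (prep x p)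
    (λ { (here refl) → eq ; (there h) → Pys h }) Pzs (cong₂ _+_ (sym (𝟙-true eq)) len)
  ... | parts ys zs p Pys Pzs len | false = parts ys (x ∷ zs)
    (↭-trans (prep x p) (↭-sym (↭ₚ.shift x ys zs))) Pys (λ { (here refl) → eq ; (there h) → Pzs h }) (cong₂ _+_ (sym (𝟙-false eq)) len)

  anyᵇ : (A → Bool) → List A → Bool
  anyᵇ P [] = false
  anyᵇ P (x ∷ xs) = P x ∨ anyᵇ P xs

  any-true : ∀ (P : A → Bool) xs → anyᵇ P xs ≡ true → ∃ λ x → x ∈ xs × P x ≡ true
  any-true P (x ∷ xs) h with P x in eq
  ... | true = x , here refl , eq
  ... | false with any-true P xs h
  ... | y , y∈xs , Py = y , there y∈xs , Py

  any-false : ∀ (P : A → Bool) xs → anyᵇ P xs ≡ false → ∀ {x} → x ∈ xs → P x ≡ false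
  any-false P (x ∷ xs) h (here refl) with P x
  ... | false = refl
  any-false P (x ∷ xs) h (there x∈xs) with P x
  ... | false = any-false P xs h x∈xs

  all-true : ∀ (P : A → Bool) xs → anyᵇ (not ∘ P) xs ≡ false → ∀ {x} → x ∈ xs → P x ≡ true
  all-true P xs h {x} x∈xs with P x | any-false (not ∘ P) xs h x∈xs
  ... | true | _ = refl

  -- Each element of xs is charged by F, its successor by E and its predecessor by A.
  segment-count : ∀ {E F A′ : A → Bool} xs →
    (∀ α x y β → xs ≡ α ++ x ∷ y ∷ β → F x ≡ true → E y ≡ true → ⊥) →
    (∀ α x y β → xs ≡ α ++ x ∷ y ∷ β → A′ x ≡ true → F y ≡ true → ⊥) →
    (∀ α x y z β → xs ≡ α ++ x ∷ y ∷ z ∷ β → A′ x ≡ true → E z ≡ true → ⊥) →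
    cnt E xs + cnt F xs + cnt A′ xs ≤ length xs + 2
  segment-count [] h₁ h₂ h₃ = z≤n
  segment-count {E} {F} {A′} (x ∷ []) h₁ h₂ h₃ = linarith 3
    (λ e f a → e :≤ con 1 ⇒ f :≤ con 1 ⇒ a :≤ con 1 ⇒ ⊢ (e :+ con 0) :+ (f :+ con 0) :+ (a :+ con 0) :≤ con 3)
    (𝟙 (E x)) (𝟙 (F x)) (𝟙 (A′ x)) (𝟙≤1 (E x)) (𝟙≤1 (F x)) (𝟙≤1 (A′ x))
  segment-count {E} {F} {A′} (x ∷ y ∷ zs) h₁ h₂ h₃ = linarith 10
    (λ ex fx ax ey fy ay e f a l → ex :≤ con 1 ⇒ fx :+ ey :≤ con 1 ⇒ ax :+ (fy :+ f) :+ e :+ (ay :+ a) :≤ con 2 :+ l ⇒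
      ⊢ (ex :+ (ey :+ e)) :+ (fx :+ (fy :+ f)) :+ (ax :+ (ay :+ a)) :≤ con 2 :+ l :+ con 2)
    (𝟙 (E x)) (𝟙 (F x)) (𝟙 (A′ x)) (𝟙 (E y)) (𝟙 (F y)) (𝟙 (A′ y)) (cnt E zs) (cnt F zs) (cnt A′ zs) (length zs)
    (𝟙≤1 (E x)) (𝟙-excl (h₁ [] x y zs refl)) (go x y zs h₁ h₂ h₃)
    where
    -- The counts are added along the shift: `A′` at an entry, `F` at the next and `E` at the one
    -- after exclude each other. There are `length xs + 2` such windows, those overlapping the ends
    -- included.
    go : ∀ x y zs →
      (∀ α u v β → x ∷ y ∷ zs ≡ α ++ u ∷ v ∷ β → F u ≡ true → E v ≡ true → ⊥) →
      (∀ α u v β → x ∷ y ∷ zs ≡ α ++ u ∷ v ∷ β → A′ u ≡ true → F v ≡ true → ⊥) →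
      (∀ α u v w β → x ∷ y ∷ zs ≡ α ++ u ∷ v ∷ w ∷ β → A′ u ≡ true → E w ≡ true → ⊥) →
      𝟙 (A′ x) + cnt F (y ∷ zs) + cnt E zs + cnt A′ (y ∷ zs) ≤ 2 + length zs
    go x y [] h₁ h₂ h₃ = linarith 3
      (λ ax fy ay → ax :+ fy :≤ con 1 ⇒ ay :≤ con 1 ⇒ ⊢ ax :+ (fy :+ con 0) :+ con 0 :+ (ay :+ con 0) :≤ con 2)
      (𝟙 (A′ x)) (𝟙 (F y)) (𝟙 (A′ y)) (𝟙-excl (h₂ [] x y [] refl)) (𝟙≤1 (A′ y))
    go x y (z ∷ zs) h₁ h₂ h₃ = linarith 8
      (λ ax fy ez ay f e a l → ax :+ fy :+ ez :≤ con 1 ⇒ ay :+ f :+ e :+ a :≤ con 2 :+ l ⇒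
        ⊢ ax :+ (fy :+ f) :+ (ez :+ e) :+ (ay :+ a) :≤ con 3 :+ l)
      (𝟙 (A′ x)) (𝟙 (F y)) (𝟙 (E z)) (𝟙 (A′ y)) (cnt F (z ∷ zs)) (cnt E zs) (cnt A′ (z ∷ zs)) (length zs)
      (𝟙-excl₃ (h₂ [] x y (z ∷ zs) refl) (h₃ [] x y z zs refl) (h₁ (x ∷ []) y z zs refl))
      (go y z zs (λ α u v β e → h₁ (x ∷ α) u v β (cong (x ∷_) e)) (λ α u v β e → h₂ (x ∷ α) u v β (cong (x ∷_) e))
        (λ α u v w β e → h₃ (x ∷ α) u v w β (cong (x ∷_) e)))

-- Paths and cycles as vertex lists, and reroutings that lengthen a cycle

module Paths {n : ℕ} (G : Graph n) where

  V : Set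
  V = Fin n

  infix 4 _~_

  _~_ : V → V → Set
  u ~ v = adj G u v ≡ true

  ~-sym : ∀ {u v} → u ~ v → v ~ u
  ~-sym {u} {v} e = trans (adj-sym G v u) e

  ~-irrefl : ∀ {u} → u ~ u → ⊥
  ~-irrefl {u} e = true≢false e (adj-irrefl G u)

  non-adjacent : ∀ {u v} → (u ~ v → ⊥) → adj G u v ≡ false
  non-adjacent {u} {v} h with bool (adj G u v)
  ... | inj₁ e = ⊥-elim (h e)
  ... | inj₂ e = e

  data Path : V → List V → V → Set where
    [-] : ∀ {a} → Path a (a ∷ []) a
    _∷_ : ∀ {a b c xs} → a ~ b → Path b xs c → Path a (a ∷ xs) c

  -- A single edge counts as a cycle of length two, so the search for a longest cycle can begin with
  -- any edge. Distinctness of the entries comes from outside, through a complement `R` with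
  -- `C ++ R ↭ H` and `H` unique.
  Cyc : List V → Set
  Cyc xs = ∃₂ λ a b → Path a xs b × b ~ a

  join : ∀ {a b c d xs ys} → Path a xs b → b ~ c → Path c ys d → Path a (xs ++ ys) d
  join [-] e q = e ∷ q
  join (f ∷ p) e q = f ∷ join p e q

  flip : ∀ {a b xs} → Path a xs b → Path b (reverse xs) a
  flip [-] = [-]
  flip (_∷_ {a} {xs = xs} e p) = subst (λ ys → Path _ ys a) (sym (unfold-reverse a xs)) (join (flip p) (~-sym e) [-])

  head≡ : ∀ {a b x xs} → Path a (x ∷ xs) b → a ≡ x
  head≡ [-] = refl
  head≡ (_ ∷ _) = refl

  first∈ : ∀ {a xs b} → Path a xs b → a ∈ xs
  first∈ [-] = here refl
  first∈ (_ ∷ _) = here refl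

  last∈ : ∀ {a xs b} → Path a xs b → b ∈ xs
  last∈ [-] = here refl
  last∈ (_ ∷ p) = there (last∈ p)

  path-length : ∀ {a b xs} → Path a xs b → 1 ≤ length xs
  path-length [-] = s≤s z≤n
  path-length (_ ∷ _) = s≤s z≤n

  cut-at : ∀ α {s β a b} → Path a (α ++ s ∷ β) b → Path a (α ++ s ∷ []) s × Path s (s ∷ β) b
  cut-at [] p with head≡ p
  ... | refl = [-] , p
  cut-at (_ ∷ []) (e ∷ p) with head≡ p
  ... | refl = e ∷ [-] , p
  cut-at (_ ∷ α@(_ ∷ _)) (e ∷ p) with cut-at α p
  ... | p₁ , p₂ = e ∷ p₁ , p₂

  cut : ∀ α {s t β a b} → Path a (α ++ s ∷ t ∷ β) b → Path a (α ++ s ∷ []) s × s ~ t × Path t (t ∷ β) b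
  cut α p with cut-at α p
  ... | p₁ , e ∷ p₂ with head≡ p₂
  ... | refl = p₁ , e , p₂

  tail : ∀ δ {a b y x} → Path a (y ∷ δ ++ x ∷ []) b → ∃ λ c → y ~ c × Path c (δ ++ x ∷ []) b
  tail [] (e ∷ p) = _ , e , p
  tail (_ ∷ _) (e ∷ p) = _ , e , p

  -- The two arcs of the cycle γ y δ x β from after y to x and from after x to y.
  arcs : ∀ γ {y} δ {x} β → Cyc (γ ++ y ∷ δ ++ x ∷ β) →
    ∃₂ λ a c → ∃₂ λ s₁ s₂ → Path a s₁ x × Path c s₂ y × x ~ c × y ~ a × s₁ ++ s₂ ↭ γ ++ y ∷ δ ++ x ∷ β
  arcs γ {y} δ {x} β (a , b , p , e) with cut-at γ p
  ... | p₁ , p₂ with cut-at (y ∷ δ) p₂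
  ... | p₃ , p₄ with tail δ p₃ | p₄
  ... | _ , f , p₅ | [-] = _ , a , δ ++ x ∷ [] , γ ++ y ∷ [] , p₅ , p₁ , e , f ,
    permute 4 (λ γ y δ x → ⊢ₚ (δ ⊕ x) ⊕ γ ⊕ y ≋ γ ⊕ y ⊕ δ ⊕ x) γ (y ∷ []) δ (x ∷ [])
  ... | _ , f , p₅ | g ∷ p₆ = _ , _ , δ ++ x ∷ [] , β ++ γ ++ y ∷ [] , p₅ , join p₆ e p₁ , g , f ,
    permute 5 (λ γ y δ x β → ⊢ₚ (δ ⊕ x) ⊕ β ⊕ γ ⊕ y ≋ γ ⊕ y ⊕ δ ⊕ x ⊕ β) γ (y ∷ []) δ (x ∷ []) β

  segments : ∀ {C x y} → Cyc C → x ∈ C → y ∈ C → x ≢ y →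
    ∃₂ λ a c → ∃₂ λ s₁ s₂ → Path a s₁ x × Path c s₂ y × x ~ c × y ~ a × s₁ ++ s₂ ↭ C
  segments {C} {x} {y} cyc x∈C y∈C x≢y with ∈-∃++ x∈C
  ... | α , β , refl with ∈-++⁻ α y∈C
  ... | inj₂ (here refl) = ⊥-elim (x≢y refl)
  ... | inj₂ (there y∈β) with ∈-∃++ y∈β
  ... | γ , δ , refl with arcs α γ δ cyc
  ... | c , a , s₂ , s₁ , p₂ , p₁ , e , f , p = a , c , s₁ , s₂ , p₁ , p₂ , f , e , ↭-trans (↭ₚ.++-comm s₁ s₂) p
  segments {C} {x} {y} cyc x∈C y∈C x≢y | α , β , refl | inj₁ y∈α with ∈-∃++ y∈α
  ... | γ , δ , refl rewrite ++-assoc γ (y ∷ δ) (x ∷ β) = arcs γ δ β cyc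

  -- The cycle runs through `s₁` from `a` to `b`, then through `s₂` from `c` to `d`, and back to
  -- `a`; `Π` leads outside it from a neighbour of `b` to a neighbour of `d`. So `c` and `a` are the
  -- successors of the two attachment vertices, and each lemma below turns further edges at them
  -- into a longer cycle.
  module Config {s₁ s₂ Π R₁ R Hs a b c d p q} (P₁ : Path a s₁ b) (P₂ : Path c s₂ d) (bc : b ~ c) (da : d ~ a)
    (P : Path p Π q) (pb : p ~ b) (qd : q ~ d) (splitR : Π ++ R₁ ↭ R) (perm : (s₁ ++ s₂) ++ R ↭ Hs)
    (longest : ∀ C′ R′ → C′ ++ R′ ↭ Hs → Cyc C′ → length C′ ≤ length (s₁ ++ s₂)) where

    -- A rerouting gives up `K` and takes in `X`, so it contradicts maximality as soon as `X` is
    -- larger.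
    too-long : ∀ C′ K X Y → C′ ++ K ↭ (s₁ ++ s₂) ++ X → X ++ Y ↭ R → length K < length X → Cyc C′ → ⊥
    too-long C′ K X Y e f lt cyc = linarith 4
      (λ c′ k s x → c′ :+ k :≡ s :+ x ⇒ k :< x ⇒ c′ :≤ s ⇒ ⊢ :⊥)
      (length C′) (length K) (length (s₁ ++ s₂)) (length X)
      (trans (sym (length-++ C′)) (trans (↭ₚ.↭-length e) (length-++ (s₁ ++ s₂)))) lt
      (longest C′ (K ++ Y) (permute 7 (λ c k s x y r h → c ⊕ k ≋ s ⊕ x ⇒ₚ x ⊕ y ≋ r ⇒ₚ s ⊕ r ≋ h ⇒ₚ ⊢ₚ c ⊕ k ⊕ y ≋ h)
        C′ K (s₁ ++ s₂) X Y R Hs e f perm) cyc)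

    -- The longer cycle follows `s₁` and `Π`, runs backwards through `s₂` from `d` to `s′`, jumps to
    -- `c`, and goes forward to `s`, a neighbour of `a`.
    cross : ∀ α s s′ β → s₂ ≡ α ++ s ∷ s′ ∷ β → a ~ s → c ~ s′ → ⊥
    cross α s s′ β refl as cs′ with cut α P₂
    ... | p₁ , e , p₂ = too-long (s₁ ++ Π ++ reverse (s′ ∷ β) ++ α ++ s ∷ []) [] Π R₁
      (permute 6 (λ s₁ Π α s s′ β → ⊢ₚ (s₁ ⊕ Π ⊕ rev (s′ ⊕ β) ⊕ α ⊕ s) ⊕ ε ≋ (s₁ ⊕ α ⊕ s ⊕ s′ ⊕ β) ⊕ Π) s₁ Π α (s ∷ []) (s′ ∷ []) β)
      splitR (path-length P)
      (_ , _ , join P₁ (~-sym pb) (join P qd (join (flip p₂) (~-sym cs′) p₁)) , ~-sym as)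

    off-cross : ∀ w R₂ → R₁ ↭ w ∷ R₂ → c ~ w → a ~ w → ⊥
    off-cross w R₂ e cw aw = too-long (s₁ ++ Π ++ reverse s₂ ++ w ∷ []) [] (Π ++ w ∷ []) R₂
      (permute 4 (λ s₁ s₂ Π w → ⊢ₚ (s₁ ⊕ Π ⊕ rev s₂ ⊕ w) ⊕ ε ≋ (s₁ ⊕ s₂) ⊕ Π ⊕ w) s₁ s₂ Π (w ∷ []))
      (permute 5 (λ Π w R₁ R₂ R → w ⊕ R₂ ≋ R₁ ⇒ₚ Π ⊕ R₁ ≋ R ⇒ₚ ⊢ₚ (Π ⊕ w) ⊕ R₂ ≋ R) Π (w ∷ []) R₁ R₂ R (↭-sym e) splitR)
      (≤-trans (path-length P) (≤-trans (m≤m+n (length Π) 1) (≤-reflexive (sym (length-++ Π)))))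
      (_ , _ , join P₁ (~-sym pb) (join P qd (join (flip P₂) cw [-])) , ~-sym aw)

    insert₁ : ∀ π₁ w π₂ → Π ≡ π₁ ++ w ∷ π₂ → c ~ w → ⊥
    insert₁ π₁ w π₂ refl cw = too-long (s₁ ++ (π₁ ++ w ∷ []) ++ s₂) π₂ Π R₁
      (permute 5 (λ s₁ s₂ π₁ w π₂ → ⊢ₚ (s₁ ⊕ (π₁ ⊕ w) ⊕ s₂) ⊕ π₂ ≋ (s₁ ⊕ s₂) ⊕ π₁ ⊕ w ⊕ π₂) s₁ s₂ π₁ (w ∷ []) π₂)
      splitR (≤-trans (m≤n+m (suc (length π₂)) (length π₁)) (≤-reflexive (sym (length-++ π₁))))
      (_ , _ , join P₁ (~-sym pb) (join (proj₁ (cut-at π₁ P)) (~-sym cw) P₂) , da)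

    start₁ : ∀ w R₂ → R₁ ↭ w ∷ R₂ → c ~ w → p ~ w → ⊥
    start₁ w R₂ e cw pw = go Π refl P
      where
      go : ∀ Π′ → Π ≡ Π′ → Path p Π′ q → ⊥
      go (_ ∷ Π′) refl P′ with head≡ P′
      ... | refl = too-long (s₁ ++ (p ∷ w ∷ []) ++ s₂) Π′ (Π ++ w ∷ []) R₂
        (permute 5 (λ s₁ s₂ p w Π′ → ⊢ₚ (s₁ ⊕ (p ⊕ w) ⊕ s₂) ⊕ Π′ ≋ (s₁ ⊕ s₂) ⊕ (p ⊕ Π′) ⊕ w) s₁ s₂ (p ∷ []) (w ∷ []) Π′)
        (permute 5 (λ Π w R₁ R₂ R → w ⊕ R₂ ≋ R₁ ⇒ₚ Π ⊕ R₁ ≋ R ⇒ₚ ⊢ₚ (Π ⊕ w) ⊕ R₂ ≋ R) Π (w ∷ []) R₁ R₂ R (↭-sym e) splitR)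
        (s≤s (≤-trans (m≤m+n (length Π′) 1) (≤-reflexive (sym (length-++ Π′)))))
        (_ , _ , join P₁ (~-sym pb) (join (pw ∷ [-]) (~-sym cw) P₂) , da)

    start₂ : ∀ w R₂ → R₁ ↭ w ∷ R₂ → a ~ w → p ~ w → ⊥
    start₂ w R₂ e aw pw = too-long (s₂ ++ reverse Π ++ (w ∷ []) ++ s₁) [] (Π ++ w ∷ []) R₂
      (permute 4 (λ s₁ s₂ Π w → ⊢ₚ (s₂ ⊕ rev Π ⊕ w ⊕ s₁) ⊕ ε ≋ (s₁ ⊕ s₂) ⊕ Π ⊕ w) s₁ s₂ Π (w ∷ []))
      (permute 5 (λ Π w R₁ R₂ R → w ⊕ R₂ ≋ R₁ ⇒ₚ Π ⊕ R₁ ≋ R ⇒ₚ ⊢ₚ (Π ⊕ w) ⊕ R₂ ≋ R) Π (w ∷ []) R₁ R₂ R (↭-sym e) splitR)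
      (≤-trans (path-length P) (≤-trans (m≤m+n (length Π) 1) (≤-reflexive (sym (length-++ Π)))))
      (_ , _ , join P₂ (~-sym qd) (join (flip P) pw (join [-] (~-sym aw) P₁)) , bc)

  -- The special case of a single vertex v = p = q with a further neighbour u off the cycle.
  module Config₂ {s₁ s₂ R₁ R Hs a b c d v u} (P₁ : Path a s₁ b) (P₂ : Path c s₂ d) (bc : b ~ c) (da : d ~ a)
    (vb : v ~ b) (vd : v ~ d) (vu : v ~ u) (splitR : v ∷ u ∷ R₁ ↭ R) (perm : (s₁ ++ s₂) ++ R ↭ Hs)
    (longest : ∀ C′ R′ → C′ ++ R′ ↭ Hs → Cyc C′ → length C′ ≤ length (s₁ ++ s₂)) where

    open Config P₁ P₂ bc da [-] vb vd splitR perm longest public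

    step₁ : ∀ α s s′ β → s₂ ≡ α ++ s ∷ s′ ∷ β → u ~ s → a ~ s′ → ⊥
    step₁ α s s′ β refl us as′ with cut α P₂
    ... | p₁ , e , p₂ = too-long (s₁ ++ (α ++ s ∷ []) ++ (u ∷ v ∷ []) ++ reverse (s′ ∷ β)) [] (v ∷ u ∷ []) R₁
      (permute 7 (λ s₁ α s s′ β u v → ⊢ₚ (s₁ ⊕ (α ⊕ s) ⊕ (u ⊕ v) ⊕ rev (s′ ⊕ β)) ⊕ ε ≋ (s₁ ⊕ α ⊕ s ⊕ s′ ⊕ β) ⊕ (v ⊕ u))
        s₁ α (s ∷ []) (s′ ∷ []) β (u ∷ []) (v ∷ []))
      splitR (s≤s z≤n)
      (_ , _ , join P₁ bc (join p₁ (~-sym us) (join (~-sym vu ∷ [-]) vd (flip p₂))) , ~-sym as′)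

    -- The detour through `v` and `u` skips `s′`: one vertex is lost and two are gained.
    step₂ : ∀ α s s′ s″ β → s₂ ≡ α ++ s ∷ s′ ∷ s″ ∷ β → u ~ s → c ~ s″ → ⊥
    step₂ α s s′ s″ β refl us cs″ with cut α P₂
    ... | p₁ , e , p₂ with cut [] p₂
    ... | _ , _ , p₃ = too-long (s₁ ++ (v ∷ u ∷ []) ++ reverse (α ++ s ∷ []) ++ s″ ∷ β) (s′ ∷ []) (v ∷ u ∷ []) R₁
      (permute 8 (λ s₁ α s s′ s″ β u v → ⊢ₚ (s₁ ⊕ (v ⊕ u) ⊕ rev (α ⊕ s) ⊕ s″ ⊕ β) ⊕ s′ ≋ (s₁ ⊕ α ⊕ s ⊕ s′ ⊕ s″ ⊕ β) ⊕ (v ⊕ u))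
        s₁ α (s ∷ []) (s′ ∷ []) (s″ ∷ []) β (u ∷ []) (v ∷ []))
      splitR (s≤s (s≤s z≤n))
      (_ , _ , join P₁ (~-sym vb) (join (vu ∷ [-]) us (join (flip p₁) cs″ p₃)) , da)

    detour₁ : c ~ u → ⊥
    detour₁ cu = too-long (s₁ ++ (v ∷ u ∷ []) ++ s₂) [] (v ∷ u ∷ []) R₁
      (permute 4 (λ s₁ s₂ v u → ⊢ₚ (s₁ ⊕ (v ⊕ u) ⊕ s₂) ⊕ ε ≋ (s₁ ⊕ s₂) ⊕ v ⊕ u) s₁ s₂ (v ∷ []) (u ∷ []))
      splitR (s≤s z≤n) (_ , _ , join P₁ (~-sym vb) (join (vu ∷ [-]) (~-sym cu) P₂) , da)

    detour₂ : ∀ w R₂ → R₁ ↭ w ∷ R₂ → c ~ w → u ~ w → ⊥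
    detour₂ w R₂ e cw uw = too-long (s₁ ++ (v ∷ u ∷ w ∷ []) ++ s₂) [] (v ∷ u ∷ w ∷ []) R₂
      (permute 5 (λ s₁ s₂ v u w → ⊢ₚ (s₁ ⊕ (v ⊕ u ⊕ w) ⊕ s₂) ⊕ ε ≋ (s₁ ⊕ s₂) ⊕ v ⊕ u ⊕ w) s₁ s₂ (v ∷ []) (u ∷ []) (w ∷ []))
      (permute 6 (λ v u w R₁ R₂ R → w ⊕ R₂ ≋ R₁ ⇒ₚ v ⊕ u ⊕ R₁ ≋ R ⇒ₚ ⊢ₚ (v ⊕ u ⊕ w) ⊕ R₂ ≋ R) (v ∷ []) (u ∷ []) (w ∷ []) R₁ R₂ R (↭-sym e) splitR)
      (s≤s z≤n) (_ , _ , join P₁ (~-sym vb) (join (vu ∷ uw ∷ [-]) (~-sym cw) P₂) , da)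

-- Degree counts around a longest cycle

module LongestCycles {n : ℕ} (G : Graph n) where

  open Paths G

  -- A connected set with an order of construction, in which every vertex but the first has an older
  -- neighbour. Induction on it yields paths inside the set and, later, spanning trees.
  data Grown : List V → Set where
    root : ∀ {v} → Grown (v ∷ [])
    grow : ∀ {v p L} → p ∈ L → v ~ p → Grown L → Grown (v ∷ L)

  _∈ᵇ_ : V → List V → Bool
  v ∈ᵇ L = anyᵇ (λ w → ⌊ v Fin.≟ w ⌋) L

  ∈ᵇ⇒∈ : ∀ {v L} → v ∈ᵇ L ≡ true → v ∈ L
  ∈ᵇ⇒∈ {v} {L} h with any-true (λ w → ⌊ v Fin.≟ w ⌋) L h
  ... | w , w∈L , e with v Fin.≟ w
  ... | yes refl = w∈L

  ∈⇒∈ᵇ : ∀ {v L} → v ∈ L → v ∈ᵇ L ≡ true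
  ∈⇒∈ᵇ {v} {L} h with bool (v ∈ᵇ L)
  ... | inj₁ e = e
  ... | inj₂ e with v Fin.≟ v | any-false (λ w → ⌊ v Fin.≟ w ⌋) L e h
  ... | yes _ | ()
  ... | no v≢v | _ = ⊥-elim (v≢v refl)

  ∉⇒∈ᵇ : ∀ {v L} → v ∉ L → v ∈ᵇ L ≡ false
  ∉⇒∈ᵇ {v} {L} h with bool (v ∈ᵇ L)
  ... | inj₁ e = ⊥-elim (h (∈ᵇ⇒∈ e))
  ... | inj₂ e = e

  ∈ᵇ⇒∉ : ∀ {v L} → v ∈ᵇ L ≡ false → v ∉ L
  ∈ᵇ⇒∉ e h = true≢false (∈⇒∈ᵇ h) e

  closure : ∀ k D R → length R ≤ k → Grown D → ∃₂ λ D′ R′ → Grown D′ × D′ ++ R′ ↭ D ++ R ×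
    (∀ {x} → x ∈ D → x ∈ D′) × (∀ {x y} → x ∈ D′ → y ∈ R′ → y ~ x → ⊥)
  closure k D R le g with bool (anyᵇ (λ y → anyᵇ (adj G y) D) R)
  ... | inj₂ e = D , R , g , ↭-refl , (λ h → h) , λ {x} {y} x∈D y∈R yx →
    true≢false yx (any-false (adj G y) D (any-false (λ y → anyᵇ (adj G y) D) R e y∈R) x∈D)
  ... | inj₁ e with any-true (λ y → anyᵇ (adj G y) D) R e
  ... | y , y∈R , e′ with any-true (adj G y) D e′ | member-pick y∈R
  closure zero D (_ ∷ _) () g | inj₁ e | y , y∈R , e′ | x , x∈D , yx | R₁ , p
  closure (suc k) D R le g | inj₁ e | y , y∈R , e′ | x , x∈D , yx | R₁ , p
    with closure k (y ∷ D) R₁ (s≤s⁻¹ (≤-trans (≤-reflexive (sym (↭ₚ.↭-length p))) le)) (grow x∈D yx g)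
  ... | D′ , R′ , g′ , q , sub , none = D′ , R′ , g′ ,
    permute 6 (λ D′ R′ D R y R₁ → y ⊕ R₁ ≋ R ⇒ₚ D′ ⊕ R′ ≋ y ⊕ D ⊕ R₁ ⇒ₚ ⊢ₚ D′ ⊕ R′ ≋ D ⊕ R) D′ R′ D R (y ∷ []) R₁ (↭-sym p) q ,
    sub ∘ there , none

  -- The complement `L′` is recorded to guarantee that `Π` repeats no vertex, as a rerouted cycle
  -- requires.
  grown-path : ∀ {L p q} → Grown L → p ∈ L → q ∈ L → ∃₂ λ Π L′ → Π ++ L′ ↭ L × Path p Π q
  grown-path root (here refl) (here refl) = _ , [] , ↭-refl , [-]
  grown-path (grow {v} {w} {L} w∈L vw g) (here refl) (here refl) = v ∷ [] , L , ↭-refl , [-]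
  grown-path (grow {v} {w} {L} w∈L vw g) (here refl) (there q∈L) with grown-path g w∈L q∈L
  ... | Π , L′ , e , P = v ∷ Π , L′ , prep v e , vw ∷ P
  grown-path (grow {v} {w} {L} w∈L vw g) (there p∈L) (here refl) with grown-path g p∈L w∈L
  ... | Π , L′ , e , P = Π ++ v ∷ [] , L′ ,
    permute 4 (λ Π L′ L v → Π ⊕ L′ ≋ L ⇒ₚ ⊢ₚ (Π ⊕ v) ⊕ L′ ≋ v ⊕ L) Π L′ L (v ∷ []) e , join P (~-sym vw) [-]
  grown-path (grow {v} {w} {L} w∈L vw g) (there p∈L) (there q∈L) with grown-path g p∈L q∈L
  ... | Π , L′ , e , P = Π , v ∷ L′ , permute 4 (λ Π L′ L v → Π ⊕ L′ ≋ L ⇒ₚ ⊢ₚ Π ⊕ v ⊕ L′ ≋ v ⊕ L) Π L′ L (v ∷ []) e , P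

  unique-↭ : ∀ {xs ys : List V} → xs ↭ ys → Unique xs → Unique ys
  unique-↭ p u = ↭Sₚ.Unique-resp-↭ (setoid V) (↭⇒↭ₛ p) u
    where import Data.List.Relation.Binary.Permutation.Setoid.Properties as ↭S

  unique-apart : ∀ {L} xs ys {x y} → Unique L → L ↭ xs ++ ys → x ∈ xs → y ∈ ys → x ≢ y
  unique-apart xs ys {x} u p x∈xs y∈ys refl with member-pick x∈xs | member-pick y∈ys
  ... | xs′ , e | ys′ , e′ with unique-↭ (permute 6 (λ L xs ys x xs′ ys′ → L ≋ xs ⊕ ys ⇒ₚ xs ≋ x ⊕ xs′ ⇒ₚ ys ≋ x ⊕ ys′ ⇒ₚ
      ⊢ₚ L ≋ x ⊕ x ⊕ xs′ ⊕ ys′) _ xs ys (x ∷ []) xs′ ys′ p e e′) u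
  ... | (x≢x ∷ _) ∷ _ = x≢x refl

  record Longest (H C R : List V) : Set where
    field
      cyc     : Cyc C
      perm    : C ++ R ↭ H
      longest : ∀ C′ R′ → C′ ++ R′ ↭ H → Cyc C′ → length C′ ≤ length C

  -- The margin 6 beats the boundary terms of the two counts below: three degrees would add up to at
  -- most `length H + 4` in `pendant-edge` and to at most `length H + 5` in `pendant-path`.
  module Dominating {H : List V} (uniq : Unique H) (δ : ℕ) (mindeg : ∀ v → δ ≤ cnt (adj G v) H)
    (dense : length H + 6 ≤ 3 * δ) where

    reindex : ∀ {C R s₁ s₂} (l : Longest H C R) → s₁ ++ s₂ ↭ C → (s₁ ++ s₂) ++ R ↭ H ×
      (∀ C′ R′ → C′ ++ R′ ↭ H → Cyc C′ → length C′ ≤ length (s₁ ++ s₂))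
    reindex l e = ↭-trans (↭ₚ.++⁺ʳ _ e) (Longest.perm l) , λ C′ R′ p c →
      ≤-trans (Longest.longest l C′ R′ p c) (≤-reflexive (sym (↭ₚ.↭-length e)))

    count-parts : ∀ P s₁ s₂ R → (s₁ ++ s₂) ++ R ↭ H → cnt P H ≡ cnt P s₁ + cnt P s₂ + cnt P R
    count-parts P s₁ s₂ R e = trans (cnt-↭ P (↭-sym e)) (trans (cnt-++ P (s₁ ++ s₂) R) (cong (_+ cnt P R) (cnt-++ P s₁ s₂)))

    length-parts : ∀ s₁ s₂ R → (s₁ ++ s₂) ++ R ↭ H → length H ≡ length s₁ + length s₂ + length R
    length-parts s₁ s₂ R e = trans (↭ₚ.↭-length (↭-sym e)) (trans (length-++ (s₁ ++ s₂)) (cong (_+ length R) (length-++ s₁)))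

    -- Let `x` and `y` be two neighbours of `v` on the cycle and `c`, `a` their successors. Along
    -- each of the two arcs the neighbours of `c`, `a` and `u` exclude each other after a shift, and
    -- off the cycle they are disjoint; so the sum of the three degrees is too small.
    pendant-edge : ∀ {C R R₁ v u} → Longest H C R → v ∷ u ∷ R₁ ↭ R → v ~ u → 2 ≤ cnt (adj G v) C → ⊥
    pendant-edge {C} {R} {R₁} {v} {u} l eR vu two
      with pick (adj G v) C (≤-trans (s≤s z≤n) two)
    ... | x , C₁ , e₁ , vx with pick (adj G v) C₁ (≤-pred (≤-trans two (≤-trans (≤-reflexive (cnt-↭ (adj G v) e₁))
        (+-monoˡ-≤ (cnt (adj G v) C₁) (𝟙≤1 (adj G v x))))))
    ... | y , C₂ , e₂ , vy
      with segments (Longest.cyc l) (∈-↭ (↭-sym e₁) (here refl)) (∈-↭ (↭-sym (↭-trans e₁ (prep x e₂))) (there (here refl)))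
        (unique-apart (x ∷ []) (y ∷ C₂ ++ R) uniq (permute 7 (λ C R H x C₁ y C₂ → H ≋ C ⊕ R ⇒ₚ C ≋ x ⊕ C₁ ⇒ₚ C₁ ≋ y ⊕ C₂ ⇒ₚ ⊢ₚ H ≋ x ⊕ y ⊕ C₂ ⊕ R)
          C R H (x ∷ []) C₁ (y ∷ []) C₂ (↭-sym (Longest.perm l)) e₁ e₂) (here refl) (here refl))
    ... | a , c , s₁ , s₂ , P₁ , P₂ , xc , ya , es with reindex {s₁ = s₁} {s₂} l es
    ... | perm , longest = linarith 14
      (λ δ h e₁ e₂ e₃ f₁ f₂ f₃ g₁ g₂ g₃ l₁ l₂ r → h :+ con 6 :≤ 3 :* δ ⇒ h :≡ l₁ :+ l₂ :+ r ⇒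
        δ :≤ e₁ :+ e₂ :+ e₃ ⇒ δ :≤ f₁ :+ f₂ :+ f₃ ⇒ δ :≤ g₁ :+ g₂ :+ g₃ ⇒ e₂ :+ f₂ :+ g₂ :≤ l₂ :+ con 2 ⇒
        f₁ :+ e₁ :+ g₁ :≤ l₁ :+ con 2 ⇒ e₃ :+ f₃ :+ g₃ :≤ r ⇒ ⊢ :⊥)
      δ (length H) (cnt (adj G c) s₁) (cnt (adj G c) s₂) (cnt (adj G c) R) (cnt (adj G a) s₁) (cnt (adj G a) s₂) (cnt (adj G a) R)
      (cnt (adj G u) s₁) (cnt (adj G u) s₂) (cnt (adj G u) R) (length s₁) (length s₂) (length R)
      dense (length-parts s₁ s₂ R perm)
      (≤-trans (mindeg c) (≤-reflexive (count-parts _ s₁ s₂ R perm)))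
      (≤-trans (mindeg a) (≤-reflexive (count-parts _ s₁ s₂ R perm)))
      (≤-trans (mindeg u) (≤-reflexive (count-parts _ s₁ s₂ R perm)))
      (segment-count s₂ C₁.cross C₁.step₁ C₁.step₂)
      (segment-count s₁ C₂.cross C₂.step₁ C₂.step₂)
      (cnt-excl₃ R (λ w∈R → ef (where-is w∈R)) (λ w∈R → eg (where-is w∈R)) (λ w∈R → fg (where-is w∈R)))
      where
      module C₁ = Config₂ {s₁} {s₂} P₁ P₂ xc ya vx vy vu eR perm longest
      -- The same configuration with the arcs exchanged, for the count along `s₁`.
      module C₂ = Config₂ {s₂} {s₁} P₂ P₁ ya xc vy vx vu eR (↭-trans (↭ₚ.++⁺ʳ R (↭ₚ.++-comm s₂ s₁)) perm)
        (λ C′ R′ p c → ≤-trans (longest C′ R′ p c) (≤-reflexive (↭ₚ.↭-length (↭ₚ.++-comm s₁ s₂))))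
      where-is : ∀ {w} → w ∈ R → w ≡ v ⊎ w ≡ u ⊎ ∃ λ R₂ → R₁ ↭ w ∷ R₂
      where-is w∈R with ∈-↭ (↭-sym eR) w∈R
      ... | here e = inj₁ e
      ... | there (here e) = inj₂ (inj₁ e)
      ... | there (there h) = inj₂ (inj₂ (member-pick h))
      ef : ∀ {w} → w ≡ v ⊎ w ≡ u ⊎ (∃ λ R₂ → R₁ ↭ w ∷ R₂) → c ~ w → a ~ w → ⊥
      ef (inj₁ refl) cw aw = C₁.insert₁ [] v [] refl cw
      ef (inj₂ (inj₁ refl)) cw aw = C₁.detour₁ cw
      ef {w} (inj₂ (inj₂ (R₂ , e))) cw aw = C₁.off-cross w (u ∷ R₂) (permute 4 (λ R₁ R₂ u w → R₁ ≋ w ⊕ R₂ ⇒ₚ ⊢ₚ u ⊕ R₁ ≋ w ⊕ u ⊕ R₂)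
        R₁ R₂ (u ∷ []) (w ∷ []) e) cw aw
      eg : ∀ {w} → w ≡ v ⊎ w ≡ u ⊎ (∃ λ R₂ → R₁ ↭ w ∷ R₂) → c ~ w → u ~ w → ⊥
      eg (inj₁ refl) cw uw = C₁.insert₁ [] v [] refl cw
      eg (inj₂ (inj₁ refl)) cw uw = C₁.detour₁ cw
      eg {w} (inj₂ (inj₂ (R₂ , e))) cw uw = C₁.detour₂ w R₂ e cw uw
      fg : ∀ {w} → w ≡ v ⊎ w ≡ u ⊎ (∃ λ R₂ → R₁ ↭ w ∷ R₂) → a ~ w → u ~ w → ⊥
      fg (inj₁ refl) aw uw = C₂.insert₁ [] v [] refl aw
      fg (inj₂ (inj₁ refl)) aw uw = C₂.detour₁ aw
      fg {w} (inj₂ (inj₂ (R₂ , e))) aw uw = C₂.detour₂ w R₂ e aw uw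

    -- Now the third vertex of the count is `p` itself: it has at most one neighbour on the cycle
    -- and, off the cycle, none in common with the successors `c` and `a`.
    pendant-path : ∀ {C R R₁ Π p q x y} → Longest H C R → Π ++ R₁ ↭ R → Path p Π q → p ~ x → q ~ y →
      x ∈ C → y ∈ C → x ≢ y → cnt (adj G p) C ≤ 1 → ⊥
    pendant-path {C} {R} {R₁} {Π} {p} {q} {x} {y} l eR P px qy x∈C y∈C x≢y few
      with segments (Longest.cyc l) x∈C y∈C x≢y
    ... | a , c , s₁ , s₂ , P₁ , P₂ , xc , ya , es with reindex {s₁ = s₁} {s₂} l es
    ... | perm , longest = linarith 14
      (λ δ h e₁ e₂ e₃ f₁ f₂ f₃ g₁ g₂ g₃ l₁ l₂ r → h :+ con 6 :≤ 3 :* δ ⇒ h :≡ l₁ :+ l₂ :+ r ⇒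
        δ :≤ e₁ :+ e₂ :+ e₃ ⇒ δ :≤ f₁ :+ f₂ :+ f₃ ⇒ δ :≤ g₁ :+ g₂ :+ g₃ ⇒ e₂ :+ f₂ :≤ l₂ :+ con 2 ⇒
        f₁ :+ e₁ :≤ l₁ :+ con 2 ⇒ g₁ :+ g₂ :≤ con 1 ⇒ e₃ :+ f₃ :+ g₃ :≤ r ⇒ ⊢ :⊥)
      δ (length H) (cnt (adj G c) s₁) (cnt (adj G c) s₂) (cnt (adj G c) R) (cnt (adj G a) s₁) (cnt (adj G a) s₂) (cnt (adj G a) R)
      (cnt (adj G p) s₁) (cnt (adj G p) s₂) (cnt (adj G p) R) (length s₁) (length s₂) (length R)
      dense (length-parts s₁ s₂ R perm)
      (≤-trans (mindeg c) (≤-reflexive (count-parts _ s₁ s₂ R perm)))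
      (≤-trans (mindeg a) (≤-reflexive (count-parts _ s₁ s₂ R perm)))
      (≤-trans (mindeg p) (≤-reflexive (count-parts _ s₁ s₂ R perm)))
      (≤-trans (m≤m+n _ _) (segment-count {A′ = λ _ → false} s₂ C₁.cross (λ _ _ _ _ _ ()) (λ _ _ _ _ _ _ ())))
      (≤-trans (m≤m+n _ _) (segment-count {A′ = λ _ → false} s₁ C₂.cross (λ _ _ _ _ _ ()) (λ _ _ _ _ _ _ ())))
      (≤-trans (≤-reflexive (trans (sym (cnt-++ _ s₁ s₂)) (cnt-↭ _ es))) few)
      (cnt-excl₃ R (λ w∈R → ef (where-is w∈R)) (λ w∈R → eg (where-is w∈R)) (λ w∈R → fg (where-is w∈R)))
      where
      module C₁ = Config {s₁} {s₂} P₁ P₂ xc ya P px qy eR perm longest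
      module C₂ = Config {s₂} {s₁} P₂ P₁ ya xc (flip P) qy px (↭-trans (↭ₚ.++⁺ʳ R₁ (↭ₚ.↭-reverse Π)) eR)
        (↭-trans (↭ₚ.++⁺ʳ R (↭ₚ.++-comm s₂ s₁)) perm)
        (λ C′ R′ p c → ≤-trans (longest C′ R′ p c) (≤-reflexive (↭ₚ.↭-length (↭ₚ.++-comm s₁ s₂))))
      where-is : ∀ {w} → w ∈ R → (∃₂ λ α β → Π ≡ α ++ w ∷ β) ⊎ ∃ λ R₂ → R₁ ↭ w ∷ R₂
      where-is w∈R with ∈-++⁻ Π (∈-↭ (↭-sym eR) w∈R)
      ... | inj₁ h = inj₁ (∈-∃++ h)
      ... | inj₂ h = inj₂ (member-pick h)
      ef : ∀ {w} → (∃₂ λ α β → Π ≡ α ++ w ∷ β) ⊎ (∃ λ R₂ → R₁ ↭ w ∷ R₂) → c ~ w → a ~ w → ⊥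
      ef {w} (inj₁ (α , β , e)) cw aw = C₁.insert₁ α w β e cw
      ef {w} (inj₂ (R₂ , e)) cw aw = C₁.off-cross w R₂ e cw aw
      eg : ∀ {w} → (∃₂ λ α β → Π ≡ α ++ w ∷ β) ⊎ (∃ λ R₂ → R₁ ↭ w ∷ R₂) → c ~ w → p ~ w → ⊥
      eg {w} (inj₁ (α , β , e)) cw pw = C₁.insert₁ α w β e cw
      eg {w} (inj₂ (R₂ , e)) cw pw = C₁.start₁ w R₂ e cw pw
      fg : ∀ {w} → (∃₂ λ α β → Π ≡ α ++ w ∷ β) ⊎ (∃ λ R₂ → R₁ ↭ w ∷ R₂) → a ~ w → p ~ w → ⊥
      fg {w} (inj₁ (α , β , e)) aw pw =
        let α′ , β′ , e′ = ∈-∃++ (∈-↭ (↭-sym (↭ₚ.↭-reverse Π)) (subst (w ∈_) (sym e) (∈-++⁺ʳ α (here refl)))) in C₂.insert₁ α′ w β′ e′ aw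
      fg {w} (inj₂ (R₂ , e)) aw pw = C₁.start₂ w R₂ e aw pw

-- Existence of a longest cycle, and the independent set it produces

module IndependentSets {n : ℕ} (G : Graph n) where

  open Paths G
  open LongestCycles G

  path? : ∀ a xs b → Dec (Path a xs b)
  path? a [] b = no λ ()
  path? a (x ∷ []) b with a Fin.≟ x | a Fin.≟ b
  ... | yes refl | yes refl = yes [-]
  ... | no a≢x | _ = no λ p → a≢x (head≡ p)
  ... | yes refl | no a≢b = no λ { [-] → a≢b refl }
  path? a (x ∷ y ∷ xs) b with a Fin.≟ x | adj G a y Boolₚ.≟ true | path? y (y ∷ xs) b
  ... | no a≢x | _ | _ = no λ p → a≢x (head≡ p)
  ... | yes refl | no a≁y | _ = no λ { (e ∷ p) → a≁y (subst (a ~_) (head≡ p) e) }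
  ... | yes refl | yes _ | no ¬p = no λ { (e ∷ p) → ¬p (subst (λ c → Path c (y ∷ xs) b) (head≡ p) p) }
  ... | yes refl | yes e | yes p = yes (e ∷ p)

  cyc? : ∀ xs → Dec (Cyc xs)
  cyc? xs = Finₚ.any? λ a → Finₚ.any? λ b → path? a xs b ×-dec (adj G b a Boolₚ.≟ true)

  subset? : ∀ xs H → Dec (∃ λ R → xs ++ R ↭ H)
  subset? [] H = yes (H , ↭-refl)
  subset? (x ∷ xs) H with x ∈ᵇ H in eq
  ... | false = no λ (R , p) → ∈ᵇ⇒∉ eq (∈-↭ p (here refl))
  ... | true with member-pick (∈ᵇ⇒∈ eq)
  ... | H′ , e with subset? xs H′
  ... | yes (R , p) = yes (R , ↭-trans (prep x p) (↭-sym e))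
  ... | no ¬p = no λ (R , p) → ¬p (R , ↭ₚ.drop-∷ (↭-trans p e))

  search-lists : ∀ k {P : List V → Set} → (∀ xs → Dec (P xs)) → Dec (∃ λ xs → length xs ≡ k × P xs)
  search-lists zero P? = map′ (λ p → [] , refl , p) (λ { ([] , _ , p) → p }) (P? [])
  search-lists (suc k) P? = map′ (λ (x , xs , e , p) → x ∷ xs , cong suc e , p)
    (λ { (x ∷ xs , e , p) → x , xs , suc-injective e , p }) (Finₚ.any? λ x → search-lists k (λ xs → P? (x ∷ xs)))

  -- The maximum is found constructively by lowering the bound `k`: whether `H` contains a cycle on
  -- exactly `k` vertices is decided by exhaustive search.
  longest-below : ∀ k {H C R} → C ++ R ↭ H → Cyc C → (∀ C′ R′ → C′ ++ R′ ↭ H → Cyc C′ → length C′ ≤ k) →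
    ∃₂ λ C R → Longest H C R
  longest-below k {H} p c bound with search-lists k (λ xs → cyc? xs ×-dec subset? xs H)
  ... | yes (C′ , e , c′ , R′ , p′) = C′ , R′ , record { cyc = c′ ; perm = p′ ;
    longest = λ C″ R″ p″ c″ → ≤-trans (bound C″ R″ p″ c″) (≤-reflexive (sym e)) }
  longest-below zero {H} {C} {R} p (a , b , P , e) bound | no none =
    ⊥-elim (<-irrefl refl (≤-trans (path-length P) (bound C R p (a , b , P , e))))
  longest-below (suc k) p c bound | no none = longest-below k p c λ C′ R′ p′ c′ →
    ≤-pred (≤∧≢⇒< (bound C′ R′ p′ c′) (λ e → none (C′ , e , c′ , R′ , p′)))

  longest-cycle : ∀ {H C R} → C ++ R ↭ H → Cyc C → ∃₂ λ C R → Longest H C R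
  longest-cycle {H} p c = longest-below (length H) p c λ C′ R′ p′ _ →
    ≤-trans (m≤m+n (length C′) (length R′)) (≤-reflexive (sym (length-↭-++ C′ R′ (↭-sym p′))))

  -- Connectivity of `H` without `x` in cut form: a colouring that uses both colours has an edge
  -- between them. A component can thus be plugged in as a colouring, without following walks.
  TwoConnected : List V → Set
  TwoConnected H = ∀ x (f : V → Bool) y z → y ∈ H → z ∈ H → y ≢ x → z ≢ x → f y ≡ true → f z ≡ false →
    ∃₂ λ u w → u ∈ H × w ∈ H × u ≢ x × w ≢ x × f u ≡ true × f w ≡ false × u ~ w

  pair-pick : ∀ {v u R} → v ∈ R → u ∈ R → v ~ u → ∃ λ R₁ → v ∷ u ∷ R₁ ↭ R
  pair-pick {v} v∈R u∈R vu with member-pick v∈R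
  ... | R₀ , e with ∈-↭ e u∈R
  ... | here refl = ⊥-elim (~-irrefl vu)
  ... | there u∈R₀ with member-pick u∈R₀
  ... | R₁ , e′ = R₁ , ↭-sym (↭-trans e (prep v e′))

  -- The middle vertices of the triples x b z of consecutive entries with x and z marked.
  middles : ∀ (A : V → Bool) xs → (∀ α x y β → xs ≡ α ++ x ∷ y ∷ β → A x ≡ true → A y ≡ true → ⊥) →
    ∃₂ λ Bs rest → Bs ++ rest ↭ xs ×
      (∀ {b} → b ∈ Bs → ∃₂ λ α x → ∃₂ λ z β → xs ≡ α ++ x ∷ b ∷ z ∷ β × A x ≡ true × A z ≡ true) ×
      3 * cnt A xs ≤ length xs + length Bs + 2
  middles A [] h = [] , [] , ↭-refl , (λ ()) , z≤n
  middles A (x ∷ []) h = [] , x ∷ [] , ↭-refl , (λ ()) , linarith 1 (λ a → a :≤ con 1 ⇒ ⊢ 3 :* (a :+ con 0) :≤ con 3) (𝟙 (A x)) (𝟙≤1 (A x))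
  middles A (x ∷ y ∷ []) h with A x in ax | A y in ay
  ... | true | true = ⊥-elim (h [] x y [] refl ax ay)
  ... | true | false = [] , x ∷ y ∷ [] , ↭-refl , (λ ()) , s≤s (s≤s (s≤s z≤n))
  ... | false | true = [] , x ∷ y ∷ [] , ↭-refl , (λ ()) , s≤s (s≤s (s≤s z≤n))
  ... | false | false = [] , x ∷ y ∷ [] , ↭-refl , (λ ()) , z≤n
  -- Every marked entry is charged three units: itself and two entries of the gap behind it, or, if
  -- the gap has a single entry, itself, that entry, and the same entry once more as a middle. The 2
  -- in the bound pays for the end of the list.
  middles A (x ∷ y ∷ z ∷ zs) h with A x in ax | A y in ay | A z in az
    | middles A (y ∷ z ∷ zs) (λ α u v β e → h (x ∷ α) u v β (cong (x ∷_) e))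
    | middles A (z ∷ zs) (λ α u v β e → h (x ∷ y ∷ α) u v β (cong (λ l → x ∷ y ∷ l) e))
    | middles A zs (λ α u v β e → h (x ∷ y ∷ z ∷ α) u v β (cong (λ l → x ∷ y ∷ z ∷ l) e))
  ... | false | s | t | Bs , rest , p , mid , le | _ | _ = Bs , x ∷ rest , ↭-trans (↭ₚ.shift x Bs rest) (prep x p) ,
    (λ b∈Bs → case mid b∈Bs of λ { (α , u , w , β , e , s) → x ∷ α , u , w , β , cong (x ∷_) e , s }) ,
    linarith 3 (λ c l b → 3 :* c :≤ con 2 :+ l :+ b :+ con 2 ⇒ ⊢ 3 :* c :≤ con 3 :+ l :+ b :+ con 2) (𝟙 s + (𝟙 t + cnt A zs)) (length zs) (length Bs) le
  ... | true | true | _ | _ | _ | _ = ⊥-elim (h [] x y (z ∷ zs) refl ax ay)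
  ... | true | false | false | _ | _ | Bs , rest , p , mid , le = Bs , x ∷ y ∷ z ∷ rest ,
    permute 6 (λ B r x y z zs → B ⊕ r ≋ zs ⇒ₚ ⊢ₚ B ⊕ x ⊕ y ⊕ z ⊕ r ≋ x ⊕ y ⊕ z ⊕ zs) Bs rest (x ∷ []) (y ∷ []) (z ∷ []) zs p ,
    (λ b∈Bs → case mid b∈Bs of λ { (α , u , w , β , e , s) → x ∷ y ∷ z ∷ α , u , w , β , cong (λ l → x ∷ y ∷ z ∷ l) e , s }) ,
    linarith 3 (λ c l b → 3 :* c :≤ l :+ b :+ con 2 ⇒ ⊢ 3 :* (con 1 :+ c) :≤ con 3 :+ l :+ b :+ con 2) (cnt A zs) (length zs) (length Bs) le
  ... | true | false | true | _ | Bs , rest , p , mid , le | _ = y ∷ Bs , x ∷ rest ,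
    permute 5 (λ B r x y zs → B ⊕ r ≋ zs ⇒ₚ ⊢ₚ (y ⊕ B) ⊕ x ⊕ r ≋ x ⊕ y ⊕ zs) Bs rest (x ∷ []) (y ∷ []) (z ∷ zs) p ,
    (λ { (here refl) → [] , x , z , zs , refl , ax , az
       ; (there b∈Bs) → case mid b∈Bs of λ { (α , u , w , β , e , s) → x ∷ y ∷ α , u , w , β , cong (λ l → x ∷ y ∷ l) e , s } }) ,
    linarith 3 (λ c l b → 3 :* c :≤ con 1 :+ l :+ b :+ con 2 ⇒ ⊢ 3 :* (con 1 :+ c) :≤ con 3 :+ l :+ (con 1 :+ b) :+ con 2)
      (1 + cnt A zs) (length zs) (length Bs) le

  prefixes : ∀ {A : Set} (α₁ : List A) {l₁} α₂ {l₂} → α₁ ++ l₁ ≡ α₂ ++ l₂ →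
    (∃ λ δ → l₁ ≡ δ ++ l₂) ⊎ (∃ λ δ → l₂ ≡ δ ++ l₁)
  prefixes [] α₂ e = inj₁ (α₂ , e)
  prefixes (x ∷ α₁) [] e = inj₂ (x ∷ α₁ , sym e)
  prefixes (x ∷ α₁) (y ∷ α₂) e = prefixes α₁ α₂ (∷-injectiveʳ e)

  module Structure {H : List V} (uniq : Unique H) (δ : ℕ) (mindeg : ∀ v → δ ≤ cnt (adj G v) H)
    (dense : length H + 6 ≤ 3 * δ) (two : TwoConnected H) where

    open Dominating uniq δ mindeg dense

    -- Let `D` be the component of `v` in `R`. Two-connectedness attaches it at distinct vertices
    -- `x` and `y` of the cycle, through `p` and `q`. Since `p` has a neighbour in `D`,
    -- `pendant-edge` leaves it at most one neighbour on the cycle, and `pendant-path` applies.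
    off-independent : ∀ {C R v u} → Longest H C R → v ∈ R → u ∈ R → v ~ u → ⊥
    off-independent {C} {R} {v} {u} l v∈R u∈R vu with member-pick v∈R
    ... | R₀ , eR₀ with closure (length R₀) (v ∷ []) R₀ ≤-refl root
    ... | D , R′ , g , e , sub , none = contra
      where
      eR : D ++ R′ ↭ R
      eR = ↭-trans e (↭-sym eR₀)
      eH : H ↭ C ++ R
      eH = ↭-sym (Longest.perm l)
      v∈D : v ∈ D
      v∈D = sub (here refl)
      u∈D : u ∈ D
      u∈D with ∈-++⁻ D (∈-↭ (↭-sym eR) u∈R)
      ... | inj₁ h = h
      ... | inj₂ h = ⊥-elim (none v∈D h (~-sym vu))
      D⊆R : ∀ {w} → w ∈ D → w ∈ R
      D⊆R h = ∈-↭ eR (∈-++⁺ˡ h)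
      other : ∀ x → ∃ λ z → z ∈ C × z ≢ x
      other x with Longest.cyc l
      ... | a , b , P , ba with x Fin.≟ a
      ... | no x≢a = a , first∈ P , x≢a ∘ sym
      ... | yes refl = b , last∈ P , λ { refl → ~-irrefl ba }
      attach : ∀ x → x ∈ C → ∃₂ λ p y → p ∈ D × y ∈ C × y ≢ x × p ~ y
      attach x x∈C with other x
      ... | z , z∈C , z≢x with two x (_∈ᵇ D) v z (∈-↭ (↭-sym eH) (∈-++⁺ʳ C v∈R)) (∈-↭ (↭-sym eH) (∈-++⁺ˡ z∈C))
        (λ { refl → unique-apart C R uniq eH x∈C v∈R refl }) z≢x (∈⇒∈ᵇ v∈D)
        (∉⇒∈ᵇ (λ z∈D → unique-apart C R uniq eH z∈C (D⊆R z∈D) refl))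
      ... | p , w , _ , w∈H , _ , w≢x , p∈D , w∉D , pw with ∈-++⁻ C (∈-↭ eH w∈H)
      ... | inj₁ w∈C = p , w , ∈ᵇ⇒∈ p∈D , w∈C , w≢x , pw
      ... | inj₂ w∈R with ∈-++⁻ D (∈-↭ (↭-sym eR) w∈R)
      ... | inj₁ w∈D = ⊥-elim (∈ᵇ⇒∉ w∉D w∈D)
      ... | inj₂ w∈R′ = ⊥-elim (none (∈ᵇ⇒∈ p∈D) w∈R′ (~-sym pw))
      neighbour : ∀ {p} → p ∈ D → ∃ λ w → w ∈ D × p ~ w
      neighbour p∈D with grown-path g p∈D v∈D
      ... | _ , _ , _ , [-] = u , u∈D , vu
      ... | _ , _ , e′ , pw ∷ P = _ , ∈-↭ e′ (∈-++⁺ˡ (there (first∈ P))) , pw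
      few : ∀ {p} → p ∈ D → cnt (adj G p) C ≤ 1
      few {p} p∈D = ≮⇒≥ λ many →
        let w , w∈D , pw = neighbour p∈D
            R₁ , e₁ = pair-pick (D⊆R p∈D) (D⊆R w∈D) pw
        in pendant-edge l e₁ pw many
      contra : ⊥
      contra =
        let a , _ , P₀ , _ = Longest.cyc l
            p , x , p∈D , x∈C , _ , px = attach a (first∈ P₀)
            q , y , q∈D , y∈C , y≢x , qy = attach x x∈C
            Π , L′ , eD , P = grown-path g p∈D q∈D
        in pendant-path l (permute 5 (λ Π L D R′ R → Π ⊕ L ≋ D ⇒ₚ D ⊕ R′ ≋ R ⇒ₚ ⊢ₚ Π ⊕ L ⊕ R′ ≋ R) Π L′ D R′ R eD eR)
          P px qy x∈C y∈C (y≢x ∘ sym) (few p∈D)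

    no-insertion : ∀ {C R r} → Longest H C R → r ∈ R → ∀ α x y β → C ≡ α ++ x ∷ y ∷ β → r ~ x → r ~ y → ⊥
    no-insertion {R = R} {r} l r∈R α x y β refl rx ry with member-pick r∈R | Longest.cyc l
    ... | R₁ , e | a , b , P , ba with cut α P
    ... | p₁ , _ , p₂ = linarith 2 (λ c′ c → c′ :≡ c :+ con 1 ⇒ c′ :≤ c ⇒ ⊢ :⊥) (length C′) (length C)
      (trans (↭ₚ.↭-length (permute 5 (λ α x y β r → ⊢ₚ (α ⊕ x) ⊕ r ⊕ y ⊕ β ≋ (α ⊕ x ⊕ y ⊕ β) ⊕ r) α (x ∷ []) (y ∷ []) β (r ∷ []))) (length-++ C))
      (Longest.longest l C′ R₁
        (permute 8 (λ α x y β r R₁ R H → r ⊕ R₁ ≋ R ⇒ₚ (α ⊕ x ⊕ y ⊕ β) ⊕ R ≋ H ⇒ₚ ⊢ₚ ((α ⊕ x) ⊕ r ⊕ y ⊕ β) ⊕ R₁ ≋ H)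
          α (x ∷ []) (y ∷ []) β (r ∷ []) R₁ R H (↭-sym e) (Longest.perm l))
        (_ , _ , join p₁ (~-sym rx) (join [-] ry p₂) , ba))
      where
      C C′ : List V
      C = α ++ x ∷ y ∷ β
      C′ = (α ++ x ∷ []) ++ (r ∷ []) ++ y ∷ β

    -- Exchanging `b` for `r` keeps the length, so `b` lies off another longest cycle and inherits
    -- what is known about the vertices of `R`.
    swap : ∀ {R r R₁} α x b z β → Longest H (α ++ x ∷ b ∷ z ∷ β) R → R ↭ r ∷ R₁ → r ~ x → r ~ z →
      Longest H ((α ++ x ∷ []) ++ (r ∷ []) ++ z ∷ β) (b ∷ R₁)
    swap {R} {r} {R₁} α x b z β l e rx rz with Longest.cyc l
    ... | a , c , P , ca with cut α P
    ... | p₁ , _ , p₂ with cut [] p₂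
    ... | _ , _ , p₃ = record
      { cyc = _ , _ , join p₁ (~-sym rx) (join [-] rz p₃) , ca
      ; perm = permute 9 (λ α x b z β r R₁ R H → r ⊕ R₁ ≋ R ⇒ₚ (α ⊕ x ⊕ b ⊕ z ⊕ β) ⊕ R ≋ H ⇒ₚ ⊢ₚ ((α ⊕ x) ⊕ r ⊕ z ⊕ β) ⊕ b ⊕ R₁ ≋ H)
          α (x ∷ []) (b ∷ []) (z ∷ []) β (r ∷ []) R₁ R H (↭-sym e) (Longest.perm l)
      ; longest = λ C′ R′ p c → ≤-trans (Longest.longest l C′ R′ p c) (≤-reflexive (+-cancelʳ-≡ 1 _ _ (trans (sym (length-++ (α ++ x ∷ b ∷ z ∷ β)))
          (trans (↭ₚ.↭-length (permute 6 (λ α x b z β r → ⊢ₚ (α ⊕ x ⊕ b ⊕ z ⊕ β) ⊕ r ≋ ((α ⊕ x) ⊕ r ⊕ z ⊕ β) ⊕ b)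
            α (x ∷ []) (b ∷ []) (z ∷ []) β (r ∷ []))) (length-++ ((α ++ x ∷ []) ++ (r ∷ []) ++ z ∷ β))))))
      }

    -- The classical rerouting: `r` leads from `x` to `x′`, the segment from `b` to `x′` is
    -- reversed, and the edge from `b` to `b′` continues.
    no-chord : ∀ {R r} α x b γ x′ b′ β → Longest H (α ++ x ∷ b ∷ γ ++ x′ ∷ b′ ∷ β) R → r ∈ R →
      r ~ x → r ~ x′ → b ~ b′ → ⊥
    no-chord {R} {r} α x b γ x′ b′ β l r∈R rx rx′ bb′ with member-pick r∈R | Longest.cyc l
    ... | R₁ , e | a , c , P , ca with cut α P
    ... | p₁ , _ , p₂ with cut (b ∷ γ) p₂
    ... | p₃ , _ , p₄ = linarith 2 (λ c′ c → c′ :≡ c :+ con 1 ⇒ c′ :≤ c ⇒ ⊢ :⊥) (length C′) (length C)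
      (trans (↭ₚ.↭-length (permute 8 (λ α x b γ x′ b′ β r → ⊢ₚ (α ⊕ x) ⊕ r ⊕ rev (b ⊕ γ ⊕ x′) ⊕ b′ ⊕ β ≋ (α ⊕ x ⊕ b ⊕ γ ⊕ x′ ⊕ b′ ⊕ β) ⊕ r)
        α (x ∷ []) (b ∷ []) γ (x′ ∷ []) (b′ ∷ []) β (r ∷ []))) (length-++ C))
      (Longest.longest l C′ R₁
        (permute 11 (λ α x b γ x′ b′ β r R₁ R H → r ⊕ R₁ ≋ R ⇒ₚ (α ⊕ x ⊕ b ⊕ γ ⊕ x′ ⊕ b′ ⊕ β) ⊕ R ≋ H ⇒ₚ
          ⊢ₚ ((α ⊕ x) ⊕ r ⊕ rev (b ⊕ γ ⊕ x′) ⊕ b′ ⊕ β) ⊕ R₁ ≋ H)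
          α (x ∷ []) (b ∷ []) γ (x′ ∷ []) (b′ ∷ []) β (r ∷ []) R₁ R H (↭-sym e) (Longest.perm l))
        (_ , _ , join p₁ (~-sym rx) (join [-] rx′ (join (flip p₃) bb′ p₄)) , ca))
      where
      C C′ : List V
      C = α ++ x ∷ b ∷ γ ++ x′ ∷ b′ ∷ β
      C′ = (α ++ x ∷ []) ++ (r ∷ []) ++ reverse (b ∷ γ ++ x′ ∷ []) ++ b′ ∷ β

    -- A vertex of `Bs` can be exchanged for `r`, so it has no neighbour in `R`; two vertices of
    -- `Bs` are successors of neighbours of `r`, so `no-chord` separates them. All neighbours of `r`
    -- in `H` lie on the cycle, and `middles` turns their number into the size of `Bs`.
    independent-set : ∀ {C R r} → Longest H C R → r ∈ R → ∃₂ λ I rest → I ++ rest ↭ H ×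
      (∀ {v w} → v ∈ I → w ∈ I → v ~ w → ⊥) × 3 * δ + 2 * length R ≤ length I + length H + 2
    independent-set {C} {R} {r} l r∈R with middles (adj G r) C (no-insertion l r∈R)
    ... | Bs , rest , eC , mid , le = R ++ Bs , rest ,
      permute 5 (λ R Bs rest C H → Bs ⊕ rest ≋ C ⇒ₚ C ⊕ R ≋ H ⇒ₚ ⊢ₚ (R ⊕ Bs) ⊕ rest ≋ H) R Bs rest C H eC (Longest.perm l) ,
      (λ v∈I w∈I → indep (∈-++⁻ R v∈I) (∈-++⁻ R w∈I)) ,
      linarith 7 (λ δ c l b r h i → δ :≤ c ⇒ 3 :* c :≤ l :+ b :+ con 2 ⇒ h :≡ l :+ r ⇒ i :≡ r :+ b ⇒
        ⊢ 3 :* δ :+ 2 :* r :≤ i :+ h :+ con 2) δ (cnt (adj G r) C) (length C) (length Bs) (length R) (length H) (length (R ++ Bs))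
        (≤-trans (mindeg r) (≤-reflexive (trans (cnt-↭-++ (adj G r) C R (↭-sym (Longest.perm l)))
          (trans (cong (cnt (adj G r) C +_) (cnt-none R λ x∈R → non-adjacent (off-independent l r∈R x∈R))) (+-identityʳ _)))))
        le (length-↭-++ C R (↭-sym (Longest.perm l))) (length-++ R)
      where
      mixed : ∀ {b w} → b ∈ Bs → w ∈ R → b ~ w → ⊥
      mixed {b} {w} b∈Bs w∈R bw with mid b∈Bs
      ... | α , x , z , β , refl , rx , rz with member-pick r∈R
      ... | R₁ , e with ∈-↭ e w∈R
      ... | here refl = no-insertion l r∈R α x b (z ∷ β) refl rx (~-sym bw)
      ... | there w∈R₁ = off-independent (swap α x b z β l e rx rz) (here refl) (there w∈R₁) bw
      ordered : ∀ {α x b β x′ b′ β′} δ → C ≡ α ++ x ∷ b ∷ β → x ∷ b ∷ β ≡ δ ++ x′ ∷ b′ ∷ β′ →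
        r ~ x → r ~ x′ → b ~ b′ → ⊥
      ordered [] eC refl rx rx′ bb′ = ~-irrefl bb′
      -- Here `x′` is `b`, so `r` would have two consecutive neighbours.
      ordered {α} {x} {b} (_ ∷ []) eC refl rx rx′ bb′ = no-insertion l r∈R α x b _ eC rx rx′
      ordered {α} (_ ∷ _ ∷ γ) refl refl rx rx′ bb′ = no-chord α _ _ γ _ _ _ l r∈R rx rx′ bb′
      indep : ∀ {v w} → v ∈ R ⊎ v ∈ Bs → w ∈ R ⊎ w ∈ Bs → v ~ w → ⊥
      indep (inj₁ v∈R) (inj₁ w∈R) vw = off-independent l v∈R w∈R vw
      indep (inj₁ v∈R) (inj₂ w∈B) vw = mixed w∈B v∈R (~-sym vw)
      indep (inj₂ v∈B) (inj₁ w∈R) vw = mixed v∈B w∈R vw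
      indep (inj₂ v∈B) (inj₂ w∈B) vw with mid v∈B | mid w∈B
      ... | α , x , z , β , e , rx , _ | α′ , x′ , z′ , β′ , e′ , rx′ , _ with prefixes α α′ (trans (sym e) e′)
      ... | inj₁ (δ , eq) = ordered {α} δ e eq rx rx′ vw
      ... | inj₂ (δ , eq) = ordered {α′} δ e′ eq rx′ rx (~-sym vw)

-- Small totally dominating trees that avoid a given set

module DominatingTrees {n : ℕ} (G : Graph n) where

  open Paths G
  open LongestCycles G
  open IndependentSets G

  vertices : List V
  vertices = allFin n

  vertices-unique : Unique vertices
  vertices-unique = allFin⁺ n

  ∈-vertices : ∀ v → v ∈ vertices
  ∈-vertices = ∈-allFin

  length-vertices : length vertices ≡ n
  length-vertices = length-tabulate (λ i → i)

  order : ∀ xs ys → xs ++ ys ↭ vertices → n ≡ length xs + length ys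
  order xs ys e = trans (sym length-vertices) (length-↭-++ xs ys (↭-sym e))

  degree-parts : ∀ v xs ys → xs ++ ys ↭ vertices → degree G v ≡ cnt (adj G v) xs + cnt (adj G v) ys
  degree-parts v xs ys e = cnt-↭-++ (adj G v) xs ys (↭-sym e)

  independent-degree : ∀ {I J i} → I ++ J ↭ vertices → (∀ {v w} → v ∈ I → w ∈ I → v ~ w → ⊥) → i ∈ I → degree G i ≡ cnt (adj G i) J
  independent-degree {I} {J} {i} e indep i∈I = trans (degree-parts i I J e)
    (cong (_+ cnt (adj G i) J) (cnt-none I λ w∈I → non-adjacent (indep i∈I w∈I)))

  ConnectedOff : List V → Set
  ConnectedOff Q = ∀ (f : V → Bool) y z → y ∉ Q → z ∉ Q → f y ≡ true → f z ≡ false →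
    ∃₂ λ u w → u ∉ Q × w ∉ Q × f u ≡ true × f w ≡ false × u ~ w

  toSubset : List V → Subset n
  toSubset [] = S.⊥
  toSubset (x ∷ xs) = ⁅ x ⁆ ∪ toSubset xs

  ∈-toSubset : ∀ {v} Q → v ∈ Q → v S.∈ toSubset Q
  ∈-toSubset (x ∷ Q) (here refl) = Sₚ.x∈p∪q⁺ (inj₁ (Sₚ.x∈⁅x⁆ x))
  ∈-toSubset (x ∷ Q) (there h) = Sₚ.x∈p∪q⁺ (inj₂ (∈-toSubset Q h))

  toSubset-∈ : ∀ {v} Q → v S.∈ toSubset Q → v ∈ Q
  toSubset-∈ [] h = ⊥-elim (Sₚ.∉⊥ h)
  toSubset-∈ (x ∷ Q) h with Sₚ.x∈p∪q⁻ ⁅ x ⁆ (toSubset Q) h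
  ... | inj₁ e = here (Sₚ.x∈⁅y⁆⇒x≡y x e)
  ... | inj₂ e = there (toSubset-∈ Q e)

  ∣∪∣≤ : ∀ {m} (p q : Subset m) → ∣ p ∪ q ∣ ≤ ∣ p ∣ + ∣ q ∣
  ∣∪∣≤ V.[] V.[] = z≤n
  ∣∪∣≤ (true V.∷ p) (true V.∷ q) = s≤s (≤-trans (∣∪∣≤ p q) (+-monoʳ-≤ ∣ p ∣ (n≤1+n ∣ q ∣)))
  ∣∪∣≤ (true V.∷ p) (false V.∷ q) = s≤s (∣∪∣≤ p q)
  ∣∪∣≤ (false V.∷ p) (true V.∷ q) = ≤-trans (s≤s (∣∪∣≤ p q)) (≤-reflexive (sym (+-suc ∣ p ∣ ∣ q ∣)))
  ∣∪∣≤ (false V.∷ p) (false V.∷ q) = ∣∪∣≤ p q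

  ∣toSubset∣ : ∀ Q → ∣ toSubset Q ∣ ≤ length Q
  ∣toSubset∣ [] = ≤-reflexive (Sₚ.∣⊥∣≡0 n)
  ∣toSubset∣ (x ∷ Q) = ≤-trans (∣∪∣≤ ⁅ x ⁆ (toSubset Q))
    (+-mono-≤ (≤-reflexive (Sₚ.∣⁅x⁆∣≡1 x)) (∣toSubset∣ Q))

  walk-start : ∀ {P : V → Set} {y z} → Walk G P y z → P y
  walk-start (here p) = p
  walk-start (step p _ _) = p

  walk-crosses : ∀ {P : V → Set} {y z} (f : V → Bool) → Walk G P y z → f y ≡ true → f z ≡ false →
    ∃₂ λ u w → P u × P w × f u ≡ true × f w ≡ false × u ~ w
  walk-crosses f (here _) fy fz = ⊥-elim (true≢false fy fz)
  walk-crosses f (step {u} {w} p e walk) fy fz with bool (f w)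
  ... | inj₁ fw = walk-crosses f walk fw fz
  ... | inj₂ fw = u , w , p , walk-start walk , fy , fw , e

  kconnected-off : ∀ {k} → KConnected k G → ∀ Q → length Q < k → ConnectedOff Q
  kconnected-off (_ , conn) Q lt f y z y∉Q z∉Q fy fz
    with walk-crosses f (conn (toSubset Q) (≤-<-trans (∣toSubset∣ Q) lt) y z (y∉Q ∘ toSubset-∈ Q) (z∉Q ∘ toSubset-∈ Q)) fy fz
  ... | u , w , u∉ , w∉ , fu , fw , e = u , w , u∉ ∘ ∈-toSubset Q , w∉ ∘ ∈-toSubset Q , fu , fw , e

  cnt-≟ : ∀ (x : V) {L : List V} → Unique L → cnt (λ w → ⌊ w Fin.≟ x ⌋) L ≤ 1
  cnt-≟ x [] = z≤n
  cnt-≟ x (_∷_ {x = y} {xs = L} y∉ u) with y Fin.≟ x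
  ... | no _ = cnt-≟ x u
  ... | yes refl = s≤s (≤-reflexive (cnt-none L λ {w} w∈L → none w∈L (w Fin.≟ y)))
    where
    none : ∀ {w} → w ∈ L → (d : Dec (w ≡ y)) → ⌊ d ⌋ ≡ false
    none w∈L (yes refl) = ⊥-elim (All.lookup y∉ w∈L refl)
    none w∈L (no _) = refl

  cnt-∈ᵇ : ∀ Q {L} → Unique L → cnt (_∈ᵇ Q) L ≤ length Q
  cnt-∈ᵇ [] {L} u = ≤-reflexive (cnt-none L λ _ → refl)
  cnt-∈ᵇ (x ∷ Q) {L} u = ≤-trans (cnt-or {P = _∈ᵇ (x ∷ Q)} {Q = λ w → ⌊ w Fin.≟ x ⌋} {R = _∈ᵇ Q} L
      (λ {w} _ h e → subst (λ b → b ∨ (w ∈ᵇ Q) ≡ true) e h))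
    (+-mono-≤ (cnt-≟ x u) (cnt-∈ᵇ Q u))

  _without_ : (V → Bool) → List V → V → Bool
  (P without Q) v = P v ∧ not (v ∈ᵇ Q)

  cnt-without : ∀ P Q {L} → Unique L → cnt P L ≤ cnt (P without Q) L + length Q
  cnt-without P Q {L} u = ≤-trans (cnt-or {P = P} {Q = P without Q} {R = _∈ᵇ Q} L (λ {w} _ h e → go (P w) h e))
    (+-monoʳ-≤ (cnt (P without Q) L) (cnt-∈ᵇ Q u))
    where
    go : ∀ a {b} → a ≡ true → a ∧ not b ≡ false → b ≡ true
    go true {true} _ _ = refl

  without-true : ∀ {P Q v} → (P without Q) v ≡ true → P v ≡ true × v ∉ Q
  without-true {P} {Q} {v} h with ∧-true (P v) h
  ... | a , b = a , ∈ᵇ⇒∉ (not-true b)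

  total : {A : Set} → (A → ℕ) → List A → ℕ
  total f xs = sum (map f xs)

  module _ {A : Set} where

    total-+ : ∀ (f g : A → ℕ) xs → total (λ x → f x + g x) xs ≡ total f xs + total g xs
    total-+ f g [] = refl
    total-+ f g (x ∷ xs) = trans (cong (f x + g x +_) (total-+ f g xs)) (interchange (f x) (g x) _ _)

    total-0 : ∀ (xs : List A) → total (λ _ → 0) xs ≡ 0
    total-0 [] = refl
    total-0 (x ∷ xs) = total-0 xs

    total-≥ : ∀ (f : A → ℕ) k xs → (∀ {x} → x ∈ xs → k ≤ f x) → k * length xs ≤ total f xs
    total-≥ f k [] h = ≤-reflexive (*-zeroʳ k)
    total-≥ f k (x ∷ xs) h = ≤-trans (≤-reflexive (*-suc k (length xs))) (+-mono-≤ (h (here refl)) (total-≥ f k xs (h ∘ there)))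

    total-≤ : ∀ (f : A → ℕ) k xs → (∀ {x} → x ∈ xs → f x ≤ k) → total f xs ≤ k * length xs
    total-≤ f k [] h = z≤n
    total-≤ f k (x ∷ xs) h = ≤-trans (+-mono-≤ (h (here refl)) (total-≤ f k xs (h ∘ there))) (≤-reflexive (sym (*-suc k (length xs))))

    total-scale : ∀ c (f : A → ℕ) xs → total (λ x → c * f x) xs ≡ c * total f xs
    total-scale c f [] = sym (*-zeroʳ c)
    total-scale c f (x ∷ xs) = trans (cong (c * f x +_) (total-scale c f xs)) (sym (*-distribˡ-+ c (f x) _))

  double-count : ∀ {A B : Set} (R : A → B → Bool) xs ys →
    total (λ x → cnt (R x) ys) xs ≡ total (λ y → cnt (λ x → R x y) xs) ys
  double-count R [] ys = sym (total-0 ys)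
  double-count R (x ∷ xs) ys = trans (cong (cnt (R x) ys +_) (double-count R xs ys))
    (sym (total-+ (λ y → 𝟙 (R x y)) (λ y → cnt (λ x → R x y) xs) ys))

  -- The set `Q` to be avoided is empty at first and later consists of the four ends of two edges
  -- kept in reserve. Each of three neighbourhoods loses at most four vertices to it, hence 13 = 3 *
  -- 4 + 1.
  module Trees (d : ℕ) (mindeg : ∀ v → d ≤ degree G v) (Q : List V) (few : length Q ≤ 4) (dense : n + 13 ≤ 3 * d) where

    degree-off : ∀ v → d ≤ cnt (adj G v without Q) vertices + 4
    degree-off v = ≤-trans (mindeg v) (≤-trans (cnt-without (adj G v) Q vertices-unique) (+-monoʳ-≤ _ few))

    record Tree (U : List V) : Set where
      field
        grown : Grown U
        off   : ∀ {u} → u ∈ U → u ∉ Q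
        uniq  : Unique U

    record Extension (U : List V) (k : ℕ) : Set where
      field
        U′    : List V
        tree  : Tree U′
        above : ∀ {u} → u ∈ U → u ∈ U′
        small : length U′ ≤ k + length U

    open Extension

    Reach : List V → ℕ → V → Set
    Reach U k w = Σ (Extension U k) λ E → w ∈ U′ E

    reach-step : ∀ {U k z y} → Reach U k z → y ~ z → y ∉ Q → Reach U (suc k) y
    reach-step {y = y} (E , z∈U′) yz y∉Q with y ∈ᵇ U′ E in eq
    ... | true = record { U′ = U′ E ; tree = tree E ; above = above E ; small = m≤n⇒m≤1+n (small E) } , ∈ᵇ⇒∈ eq
    ... | false = record
      { U′ = y ∷ U′ E
      ; tree = record
        { grown = grow z∈U′ yz (Tree.grown (tree E))
        ; off = λ { (here refl) → y∉Q ; (there h) → Tree.off (tree E) h }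
        ; uniq = All.tabulate (λ h e → ∈ᵇ⇒∉ eq (subst (_∈ U′ E) (sym e) h)) ∷ Tree.uniq (tree E)
        }
      ; above = there ∘ above E
      ; small = s≤s (small E)
      } , here refl

    widen : (V → Bool) → V → Bool
    widen P y = P y ∨ (not (y ∈ᵇ Q) ∧ anyᵇ (λ z → P z ∧ adj G y z) vertices)

    widen-reach : ∀ {U k P y} → (∀ {z} → P z ≡ true → Reach U k z) → widen P y ≡ true → Reach U (suc k) y
    widen-reach {P = P} {y} h e with P y in eq
    ... | true with h eq
    ... | E , y∈ = record { U′ = U′ E ; tree = tree E ; above = above E ; small = m≤n⇒m≤1+n (small E) } , y∈
    widen-reach {P = P} {y} h e | false with ∧-true (not (y ∈ᵇ Q)) e
    ... | y∉ , e′ with any-true (λ z → P z ∧ adj G y z) vertices e′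
    ... | z , _ , e″ with ∧-true (P z) e″
    ... | Pz , yz = reach-step (h Pz) yz (∈ᵇ⇒∉ (not-true y∉))

    widen-⊇ : ∀ {P y} → P y ≡ true → widen P y ≡ true
    widen-⊇ {P} {y} e rewrite e = refl

    widen-∋ : ∀ {P y z} → P z ≡ true → y ~ z → y ∉ Q → widen P y ≡ true
    widen-∋ {P} {y} {z} Pz yz y∉Q with bool (widen P y)
    ... | inj₁ e = e
    ... | inj₂ e with P y | not (y ∈ᵇ Q) | cong not (∉⇒∈ᵇ y∉Q)
    ... | false | true | _ = ⊥-elim (true≢false (∧-intro Pz yz) (any-false (λ z → P z ∧ adj G y z) vertices e (∈-vertices z)))

    -- A vertex at distance at least 3 shares a neighbour with the far end of an edge leaving the ball of
    -- radius 2, because three neighbourhoods of size d cannot be disjoint.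
    reach : ConnectedOff Q → ∀ {U u w} → Tree U → u ∈ U → w ∉ Q → Reach U 5 w
    reach conn {U} {u} {w} T u∈U w∉Q = by (bool (Z₂ w))
      where
      Z₁ Z₂ : V → Bool
      Z₁ = widen (_∈ᵇ U)
      Z₂ = widen Z₁
      later : ∀ {j} k {y} → Reach U j y → j ≤ k → Reach U k y
      later k (E , h) le = record { U′ = U′ E ; tree = tree E ; above = above E ; small = ≤-trans (small E) (+-monoˡ-≤ (length U) le) } , h
      r₂ : ∀ {y} → Z₂ y ≡ true → Reach U 2 y
      r₂ = widen-reach (widen-reach λ h → record { U′ = U ; tree = T ; above = λ h → h ; small = ≤-refl } , ∈ᵇ⇒∈ h)
      far : ∀ {y} → y ∉ Q → Z₂ y ≡ false → ∀ {x} → (adj G y without Q) x ≡ true → (adj G u without Q) x ≡ true → ⊥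
      far {y} y∉Q e {x} yx ux with without-true {adj G y} {Q} yx | without-true {adj G u} {Q} ux
      ... | yx′ , _ | ux′ , x∉Q = true≢false (widen-∋ {Z₁} (widen-∋ {_∈ᵇ U} (∈⇒∈ᵇ u∈U) (~-sym ux′) x∉Q) yx′ y∉Q) e
      by : Z₂ w ≡ true ⊎ Z₂ w ≡ false → Reach U 5 w
      by (inj₁ e) = later 5 (r₂ e) (s≤s (s≤s z≤n))
      by (inj₂ e) with conn Z₂ u w (Tree.off T u∈U) w∉Q (widen-⊇ {Z₁} (widen-⊇ {_∈ᵇ U} (∈⇒∈ᵇ u∈U))) e
      ... | y , y′ , y∉Q , y′∉Q , e₁ , e₂ , yy′ = common (bool (anyᵇ both vertices))
        where
        both : V → Bool
        both x = (adj G y′ without Q) x ∧ (adj G w without Q) x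
        common : anyᵇ both vertices ≡ true ⊎ anyᵇ both vertices ≡ false → Reach U 5 w
        common (inj₁ h) with any-true both vertices h
        ... | x , _ , h′ with ∧-true ((adj G y′ without Q) x) h′
        ... | h₁ , h₂ with without-true {adj G y′} {Q} h₁ | without-true {adj G w} {Q} h₂
        -- At most two new vertices lead to `y`; then `y′`, `x` and `w` follow, five in all.
        ... | y′x , x∉Q | wx , _ = reach-step (reach-step (reach-step (r₂ e₁) (~-sym yy′) y′∉Q) (~-sym y′x) x∉Q) wx w∉Q
        common (inj₂ h) = ⊥-elim (linarith 5 (λ d n a b c → n :+ con 13 :≤ 3 :* d ⇒ d :≤ a :+ con 4 ⇒ d :≤ b :+ con 4 ⇒ d :≤ c :+ con 4 ⇒
            a :+ b :+ c :≤ n ⇒ ⊢ :⊥) d n (cnt (adj G y′ without Q) vertices) (cnt (adj G w without Q) vertices) (cnt (adj G u without Q) vertices)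
          dense (degree-off y′) (degree-off w) (degree-off u)
          (≤-trans (cnt-excl₃ vertices (λ {x} x∈ h₁ h₂ → true≢false (∧-intro h₁ h₂) (any-false both vertices h x∈))
            (λ _ → far y′∉Q e₂) (λ _ → far w∉Q e)) (≤-reflexive length-vertices)))

    -- Averaging: the numbers of neighbours in `X` of the vertices outside `Q` add up to at least
    -- `(d - 4) * length X`, which is more than a third of `n * length X`.
    dominator : ∀ X → 1 ≤ length X → ∃ λ w → w ∉ Q × length X ≤ 3 * cnt (adj G w) X
    dominator X pos = by (bool (anyᵇ good vertices))
      where
      good : V → Bool
      good w = not (w ∈ᵇ Q) ∧ (length X ≤ᵇ 3 * cnt (adj G w) X)
      R : V → V → Bool
      R x w = (adj G x without Q) w
      by : anyᵇ good vertices ≡ true ⊎ anyᵇ good vertices ≡ false → ∃ λ w → w ∉ Q × length X ≤ 3 * cnt (adj G w) X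
      by (inj₁ h) with any-true good vertices h
      ... | w , _ , h′ with ∧-true (not (w ∈ᵇ Q)) h′
      ... | w∉ , le = w , ∈ᵇ⇒∉ (not-true w∉) , ≤ᵇ⇒≤ _ _ (subst T (sym le) tt)
      by (inj₂ h) = ⊥-elim (<-irrefl refl (≤-trans pos (≤-trans (≤-reflexive (sym (*-identityˡ (length X))))
          (linarith 4 (λ dX nX X S → nX :+ 13 :* X :≤ 3 :* dX ⇒ dX :≤ S :+ 4 :* X ⇒ 3 :* S :≤ nX ⇒ ⊢ 1 :* X :≤ con 0)
            (d * length X) (n * length X) (length X) (total (λ x → cnt (R x) vertices) X)
            (≤-trans (≤-reflexive (sym (*-distribʳ-+ (length X) n 13))) (≤-trans (*-monoˡ-≤ (length X) dense) (≤-reflexive (*-assoc 3 d (length X)))))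
            (≤-trans (total-≥ (λ x → cnt (R x) vertices + 4) d X (λ {x} _ → degree-off x))
              (≤-reflexive (trans (total-+ (λ x → cnt (R x) vertices) (λ _ → 4) X) (cong (total (λ x → cnt (R x) vertices) X +_)
                (≤-antisym (total-≤ (λ _ → 4) 4 X (λ _ → ≤-refl)) (total-≥ (λ _ → 4) 4 X (λ _ → ≤-refl)))))))
            (≤-trans (≤-reflexive (cong (3 *_) (double-count R X vertices)))
              (≤-trans (≤-reflexive (sym (total-scale 3 (λ w → cnt (λ x → R x w) X) vertices)))
                (≤-trans (total-≤ _ (length X) vertices (λ {w} w∈ → column w (any-false good vertices h w∈)))
                  (≤-reflexive (trans (cong (length X *_) length-vertices) (*-comm (length X) n))))))))))
        where
        column : ∀ w → good w ≡ false → 3 * cnt (λ x → R x w) X ≤ length X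
        column w e with bool (w ∈ᵇ Q)
        ... | inj₁ w∈ = ≤-trans (≤-reflexive (cong (3 *_) (cnt-none X λ {x} _ → trans (cong (adj G x w ∧_) (cong not w∈)) (Boolₚ.∧-zeroʳ (adj G x w))))) z≤n
        ... | inj₂ w∉ = <⇒≤ (≤-<-trans (*-monoʳ-≤ 3 (cnt-mono X λ {x} _ xw → ~-sym (proj₁ (without-true {adj G x} {Q} xw)))) (≰⇒> λ le →
              true≢false (∧-intro (cong not w∉) (T⇒≡true (≤⇒≤ᵇ le))) e))
          where
          T⇒≡true : ∀ {b} → T b → b ≡ true
          T⇒≡true {true} _ = refl

    Dominates : List V → List V → Set
    Dominates U X = ∀ v → v ∈ X ⊎ ∃ λ u → u ∈ U × v ~ u

    improve : ConnectedOff Q → ∀ {U u} X → Tree U → u ∈ U → Dominates U X →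
      Σ (Extension U 5) λ E → ∃ λ X′ → Dominates (U′ E) X′ × 3 * length X′ ≤ 2 * length X
    improve conn [] T u∈U dom = record { U′ = _ ; tree = T ; above = λ h → h ; small = m≤n+m _ 5 } , [] , dom , z≤n
    improve conn X@(_ ∷ _) T u∈U dom with dominator X (s≤s z≤n)
    ... | w , w∉Q , le with reach conn T u∈U w∉Q | split (adj G w) X
    ... | E , w∈ | parts ys X′ p yes′ _ len = E , X′ , dom′ ,
      linarith 4 (λ x c y x′ → x :≤ 3 :* c ⇒ y :≡ c ⇒ x :≡ y :+ x′ ⇒ ⊢ 3 :* x′ :≤ 2 :* x) (length X) (cnt (adj G w) X) (length ys) (length X′)
        le len (length-↭-++ ys X′ p)
      where
      dom′ : Dominates (U′ E) X′
      dom′ v with dom v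
      ... | inj₂ (u , u∈ , vu) = inj₂ (u , above E u∈ , vu)
      ... | inj₁ v∈X with ∈-++⁻ ys (∈-↭ p v∈X)
      ... | inj₁ v∈ys = inj₂ (w , w∈ , ~-sym (yes′ v∈ys))
      ... | inj₂ v∈X′ = inj₁ v∈X′

    -- An improvement costs at most five vertices and leaves at most two thirds of `X`. As 4/9 is
    -- less than 1/2, two of them, at a cost of ten, more than halve it.
    dominate : ConnectedOff Q → ∀ k {U u} X → Tree U → u ∈ U → Dominates U X → length X < 2 ^ k →
      Σ (Extension U (10 * k)) λ E → ∀ v → ∃ λ u → u ∈ U′ E × v ~ u
    dominate conn zero [] T u∈U dom lt = record { U′ = _ ; tree = T ; above = λ h → h ; small = ≤-refl } , λ v → case dom v of λ { (inj₂ h) → h }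
    dominate conn zero (_ ∷ _) T u∈U dom (s≤s ())
    dominate conn (suc k) X T u∈U dom lt =
      let E₁ , X₁ , dom₁ , le₁ = improve conn X T u∈U dom
          E₂ , X₂ , dom₂ , le₂ = improve conn X₁ (tree E₁) (above E₁ u∈U) dom₁
          E₃ , dom₃ = dominate conn k X₂ (tree E₂) (above E₂ (above E₁ u∈U)) dom₂
            (linarith 4 (λ x x₁ x₂ p → 3 :* x₁ :≤ 2 :* x ⇒ 3 :* x₂ :≤ 2 :* x₁ ⇒ x :< p :+ (p :+ con 0) ⇒ ⊢ x₂ :< p)
              (length X) (length X₁) (length X₂) (2 ^ k) le₁ le₂ lt)
      in record { U′ = U′ E₃ ; tree = tree E₃ ; above = above E₃ ∘ above E₂ ∘ above E₁
                ; small = linarith 5 (λ k u u₁ u₂ u₃ → u₁ :≤ con 5 :+ u ⇒ u₂ :≤ con 5 :+ u₁ ⇒ u₃ :≤ 10 :* k :+ u₂ ⇒ ⊢ u₃ :≤ 10 :* (con 1 :+ k) :+ u)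
                    k _ (length (U′ E₁)) (length (U′ E₂)) (length (U′ E₃)) (small E₁) (small E₂) (small E₃) } , dom₃

    dominating-tree : ConnectedOff Q → ∀ k → n < 2 ^ k → ∀ {v} → v ∉ Q → ∃ λ U → Tree U × length U ≤ 10 * k + 1 ×
      ∀ v → ∃ λ u → u ∈ U × v ~ u
    dominating-tree conn k lt {v} v∉Q =
      let E , dom = dominate conn k {v ∷ []} vertices (record { grown = root ; off = λ { (here refl) → v∉Q } ; uniq = [] ∷ [] }) (here refl)
                      (λ v → inj₁ (∈-vertices v)) (≤-trans (s≤s (≤-reflexive length-vertices)) lt)
      in U′ E , tree E , small E , dom

-- Dominating trees whose complement is 2-connected

module Separators {n : ℕ} (G : Graph n) where

  open Paths G
  open LongestCycles G
  open IndependentSets G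
  open DominatingTrees G

  unique-drop : ∀ xs {ys : List V} → Unique (xs ++ ys) → Unique ys
  unique-drop [] u = u
  unique-drop (x ∷ xs) (_ ∷ u) = unique-drop xs u

  avoid : ∀ P K → length K < cnt P vertices → ∃ λ w → P w ≡ true × w ∉ K
  avoid P K lt with pick (P without K) vertices (+-cancelʳ-≤ (length K) 1 _ (≤-trans lt (cnt-without P K vertices-unique)))
  ... | w , _ , _ , e = w , without-true {P} {K} e

  path-crosses : ∀ {a xs b} (f : V → Bool) → Path a xs b → f a ≡ true → f b ≡ false →
    ∃₂ λ u w → u ∈ xs × w ∈ xs × f u ≡ true × f w ≡ false × u ~ w
  path-crosses f [-] fa fb = ⊥-elim (true≢false fa fb)
  path-crosses f (_∷_ {a} {b} e p) fa fc with bool (f b)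
  ... | inj₂ fb = a , b , here refl , there (first∈ p) , fa , fb , e
  ... | inj₁ fb with path-crosses f p fb fc
  ... | u , w , u∈ , w∈ , fu , fw , uw = u , w , there u∈ , there w∈ , fu , fw , uw

  Separated : List V → Set
  Separated Q = Σ (V → Bool) λ f → (∃ λ y → y ∉ Q × f y ≡ true) × (∃ λ z → z ∉ Q × f z ≡ false) ×
    (∀ {u w} → u ∉ Q → w ∉ Q → f u ≡ true → f w ≡ false → u ~ w → ⊥)

  -- Decided by computing the component of one vertex outside `Q`; if something is left over,
  -- membership in the component is the separating colouring.
  connected-or-separated : ∀ Q → ConnectedOff Q ⊎ Separated Q
  connected-or-separated Q with split (_∈ᵇ Q) vertices
  ... | parts ys [] p in-Q _ _ = inj₁ λ f y z y∉Q z∉Q fy fz → ⊥-elim (y∉Q (∈ᵇ⇒∈ (in-Q (subst (y ∈_) (++-identityʳ ys) (∈-↭ p (∈-vertices y))))))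
  ... | parts ys (v ∷ zs) p in-Q off-Q _ with closure (length zs) (v ∷ []) zs ≤-refl root
  ... | D , [] , g , e , sub , none = inj₁ conn
    where
    inD : ∀ {y} → y ∉ Q → y ∈ D
    inD {y} y∉Q with ∈-++⁻ ys (∈-↭ p (∈-vertices y))
    ... | inj₁ y∈ys = ⊥-elim (y∉Q (∈ᵇ⇒∈ (in-Q y∈ys)))
    ... | inj₂ y∈zs = subst (y ∈_) (++-identityʳ D) (∈-↭ (↭-sym e) y∈zs)
    outQ : ∀ {y} → y ∈ D → y ∉ Q
    outQ h = ∈ᵇ⇒∉ (off-Q (∈-↭ e (∈-++⁺ˡ h)))
    conn : ConnectedOff Q
    conn f y z y∉Q z∉Q fy fz =
      let Π , L′ , e′ , P = grown-path g (inD y∉Q) (inD z∉Q)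
          u , w , u∈ , w∈ , fu , fw , uw = path-crosses f P fy fz
      in u , w , outQ (∈-↭ e′ (∈-++⁺ˡ u∈)) , outQ (∈-↭ e′ (∈-++⁺ˡ w∈)) , fu , fw , uw
  ... | D , z ∷ R′ , g , e , sub , none = inj₂ ((_∈ᵇ D) , (v , ∈ᵇ⇒∉ (off-Q (here refl)) , ∈⇒∈ᵇ (sub (here refl))) ,
      (z , ∈ᵇ⇒∉ (off-Q (∈-↭ e (∈-++⁺ʳ D (here refl)))) , ∉⇒∈ᵇ z∉D) , apart)
    where
    uniq′ : Unique (v ∷ zs)
    uniq′ = unique-drop ys (unique-↭ p vertices-unique)
    z∉D : z ∉ D
    z∉D h = unique-apart D (z ∷ R′) uniq′ (↭-sym e) h (here refl) refl
    apart : ∀ {u w} → u ∉ Q → w ∉ Q → u ∈ᵇ D ≡ true → w ∈ᵇ D ≡ false → u ~ w → ⊥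
    apart {u} {w} _ w∉Q u∈ w∉ uw with ∈-++⁻ ys (∈-↭ p (∈-vertices w))
    ... | inj₁ w∈ys = w∉Q (∈ᵇ⇒∈ (in-Q w∈ys))
    ... | inj₂ w∈zs with ∈-++⁻ D (∈-↭ (↭-sym e) w∈zs)
    ... | inj₁ w∈D = ∈ᵇ⇒∉ w∉ w∈D
    ... | inj₂ w∈R = none (∈ᵇ⇒∈ u∈) w∈R (~-sym uw)

  all-or-one : ∀ {A B : V → Set} → (∀ x → A x ⊎ B x) → (∀ x → A x) ⊎ ∃ B
  all-or-one {A} {B} h with go vertices
    where
    go : ∀ L → (∀ {x} → x ∈ L → A x) ⊎ ∃ B
    go [] = inj₁ λ ()
    go (x ∷ L) with h x | go L
    ... | inj₂ b | _ = inj₂ (x , b)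
    ... | inj₁ _ | inj₂ b = inj₂ b
    ... | inj₁ a | inj₁ as = inj₁ λ { (here refl) → a ; (there x∈) → as x∈ }
  ... | inj₁ as = inj₁ λ x → as (∈-vertices x)
  ... | inj₂ b = inj₂ b

  ≟-true : ∀ {a b} → ⌊ a Boolₚ.≟ b ⌋ ≡ true → a ≡ b
  ≟-true {a} {b} h with a Boolₚ.≟ b
  ... | yes e = e

  -- `α` divides the vertices into two sides, and the hypotheses make each side robustly connected:
  -- after the removal of any `κ` vertices, `u` and `v` on one side are still joined through normal
  -- neighbours `u′`, `v′` and a common neighbour `c` of these. One surviving edge between the sides
  -- then connects everything.
  module Glue (α norm : V → Bool) (κ : ℕ)
    (side : ∀ v → κ < cnt (λ w → adj G v w ∧ (norm w ∧ ⌊ α v Boolₚ.≟ α w ⌋)) vertices)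
    (common : ∀ v v′ → norm v ≡ true → norm v′ ≡ true → α v ≡ α v′ → κ < cnt (λ w → adj G v w ∧ adj G v′ w) vertices) where

    Crossing : List V → (V → Bool) → Set
    Crossing K f = ∃₂ λ u w → u ∉ K × w ∉ K × f u ≡ true × f w ≡ false × u ~ w

    normal-neighbour : ∀ K → length K ≤ κ → ∀ v → ∃ λ w → w ∉ K × v ~ w × norm w ≡ true × α v ≡ α w
    normal-neighbour K le v with avoid _ K (≤-<-trans le (side v))
    ... | w , h , w∉K with ∧-true (adj G v w) h
    ... | vw , h′ with ∧-true (norm w) h′
    ... | nw , h″ = w , w∉K , vw , nw , ≟-true h″

    same-side : ∀ K → length K ≤ κ → ∀ f {u v} → u ∉ K → v ∉ K → α u ≡ α v → f u ≡ true → f v ≡ false → Crossing K f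
    same-side K le f {u} {v} u∉K v∉K αuv fu fv
      with normal-neighbour K le u | normal-neighbour K le v
    ... | u′ , u′∉K , uu′ , nu′ , αu | v′ , v′∉K , vv′ , nv′ , αv with bool (f u′) | bool (f v′)
    ... | inj₂ fu′ | _ = u , u′ , u∉K , u′∉K , fu , fu′ , uu′
    ... | inj₁ _ | inj₁ fv′ = v′ , v , v′∉K , v∉K , fv′ , fv , ~-sym vv′
    ... | inj₁ fu′ | inj₂ fv′ with avoid _ K (≤-<-trans le (common u′ v′ nu′ nv′ (trans (sym αu) (trans αuv αv))))
    ... | c , h , c∉K with ∧-true (adj G u′ c) h | bool (f c)
    ... | u′c , v′c | inj₁ fc = c , v′ , c∉K , v′∉K , fc , fv′ , ~-sym v′c
    ... | u′c , v′c | inj₂ fc = u′ , c , u′∉K , c∉K , fu′ , fc , u′c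

    glue : ∀ K → length K ≤ κ → ∀ {a b} → a ∉ K → b ∉ K → α a ≡ true → α b ≡ false → a ~ b → ConnectedOff K
    glue K le {a} {b} a∉K b∉K αa αb ab f y z y∉K z∉K fy fz = by (bool (α y)) (bool (α z))
      where
      along : ∀ {c e} → c ∉ K → e ∉ K → α y ≡ α c → α e ≡ α z → c ~ e → Crossing K f
      along {c} {e} c∉K e∉K yc ez ce with bool (f c) | bool (f e)
      ... | inj₂ fc | _ = same-side K le f y∉K c∉K yc fy fc
      ... | inj₁ _ | inj₁ fe = same-side K le f e∉K z∉K ez fe fz
      ... | inj₁ fc | inj₂ fe = c , e , c∉K , e∉K , fc , fe , ce
      by : α y ≡ true ⊎ α y ≡ false → α z ≡ true ⊎ α z ≡ false → Crossing K f
      by (inj₁ αy) (inj₁ αz) = same-side K le f y∉K z∉K (trans αy (sym αz)) fy fz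
      by (inj₂ αy) (inj₂ αz) = same-side K le f y∉K z∉K (trans αy (sym αz)) fy fz
      by (inj₁ αy) (inj₂ αz) = along a∉K b∉K (trans αy (sym αa)) (trans αb (sym αz)) ab
      by (inj₂ αy) (inj₁ αz) = along b∉K a∉K (trans αy (sym αb)) (trans αa (sym αz)) (~-sym ab)

  -- König's theorem for three edges: if no two vertices cover the edges across `α`, three of these
  -- are pairwise disjoint. Two are found greedily, the third by augmentation.
  module Matching (α : V → Bool) (cross : ∀ K → length K ≤ 2 →
    ∃₂ λ a b → a ∉ K × b ∉ K × α a ≡ true × α b ≡ false × a ~ b) where

    record Edge : Set where
      field
        a b : V
        αa  : α a ≡ true
        αb  : α b ≡ false
        a~b : a ~ b

    open Edge

    Disjoint : Edge → Edge → Set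
    Disjoint e f = a e ≢ a f × b e ≢ b f

    crossing : ∀ K → length K ≤ 2 → Σ Edge λ e → a e ∉ K × b e ∉ K
    crossing K le with cross K le
    ... | u , w , u∉ , w∉ , αu , αw , uw = record { a = u ; b = w ; αa = αu ; αb = αw ; a~b = uw } , u∉ , w∉

    Three : Set
    Three = Σ Edge λ e₁ → Σ Edge λ e₂ → Σ Edge λ e₃ → Disjoint e₁ e₂ × Disjoint e₁ e₃ × Disjoint e₂ e₃

    module _ (e₁ e₂ : Edge) (e₁₂ : Disjoint e₁ e₂) where

      -- Of the two edges at b e₁ and of the two at a e₂ one can be chosen disjoint from the third edge h.
      chain : ∀ f g → a f ≢ a e₁ → a f ≢ a e₂ → b f ≡ b e₁ → b g ≢ b e₁ → b g ≢ b e₂ → a g ≡ a e₂ → Three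
      chain f g f₁ f₂ f₃ g₁ g₂ g₃ with crossing (b e₁ ∷ a e₂ ∷ []) ≤-refl
      ... | h , ha , hb with a f Fin.≟ a h | b g Fin.≟ b h
      ... | no p | no q = h , f , g , (p ∘ sym , λ e → hb (here (trans e f₃))) , ((λ e → ha (there (here (trans e g₃)))) , q ∘ sym) ,
        (λ e → f₂ (trans e g₃)) , λ e → g₁ (trans (sym e) f₃)
      ... | no p | yes q = h , f , e₂ , (p ∘ sym , λ e → hb (here (trans e f₃))) , ((λ e → ha (there (here e))) , λ e → g₂ (trans q e)) ,
        f₂ , λ e → proj₂ e₁₂ (trans (sym f₃) e)
      ... | yes p | no q = h , e₁ , g , ((λ e → f₁ (trans p e)) , λ e → hb (here e)) , ((λ e → ha (there (here (trans e g₃)))) , q ∘ sym) ,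
        (λ e → proj₁ e₁₂ (trans e g₃)) , λ e → g₁ (sym e)
      ... | yes p | yes q = h , e₁ , e₂ , ((λ e → f₁ (trans p e)) , λ e → hb (here e)) , ((λ e → ha (there (here e))) , λ e → g₂ (trans q e)) , e₁₂

      -- Of the two edges, `f` meets only `e₁`, in `b e₁`. An edge `g` avoiding `b e₁` and `b e₂` is
      -- disjoint from both, or it meets `e₁` and together with `f` replaces it, or it meets `e₂`
      -- and `chain` takes over.
      augment : ∀ f → a f ≢ a e₁ → a f ≢ a e₂ → b f ≡ b e₁ → Three
      augment f f₁ f₂ f₃ with crossing (b e₁ ∷ b e₂ ∷ []) ≤-refl
      ... | g , _ , gb with a g Fin.≟ a e₁ | a g Fin.≟ a e₂
      ... | no p | no q = e₁ , e₂ , g , e₁₂ , (p ∘ sym , λ e → gb (here (sym e))) , (q ∘ sym , λ e → gb (there (here (sym e))))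
      ... | _ | yes q = chain f g f₁ f₂ f₃ (λ e → gb (here e)) (λ e → gb (there (here e))) q
      ... | yes p | no _ = f , g , e₂ , ((λ e → f₁ (trans e p)) , λ e → gb (here (trans (sym e) f₃))) , (f₂ , λ e → proj₂ e₁₂ (trans (sym f₃) e)) ,
        ((λ e → proj₁ e₁₂ (trans (sym p) e)) , λ e → gb (there (here e)))

    three : Three
    three with crossing [] z≤n
    ... | e₁ , _ with crossing (a e₁ ∷ b e₁ ∷ []) ≤-refl
    ... | e₂ , p , q with crossing (a e₁ ∷ a e₂ ∷ []) ≤-refl
    ... | f , fa , _ with b f Fin.≟ b e₁ | b f Fin.≟ b e₂
    ... | yes r | _ = augment e₁ e₂ ((λ e → p (here (sym e))) , λ e → q (there (here (sym e)))) f (λ e → fa (here e)) (λ e → fa (there (here e))) r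
    ... | no _ | yes r = augment e₂ e₁ ((λ e → p (here e)) , λ e → q (there (here e))) f (λ e → fa (there (here e))) (λ e → fa (here e)) r
    ... | no r | no s = e₁ , e₂ , f , ((λ e → p (here (sym e))) , λ e → q (there (here (sym e)))) ,
      ((λ e → fa (here (sym e))) , r ∘ sym) , ((λ e → fa (there (here (sym e)))) , s ∘ sym)

  cnt-overlap : ∀ {P Q R : V → Bool} xs → (∀ {x} → x ∈ xs → P x ≡ true → R x ≡ true → ⊥) →
    (∀ {x} → x ∈ xs → Q x ≡ true → R x ≡ true → ⊥) → cnt P xs + cnt Q xs + cnt R xs ≤ length xs + cnt (λ x → P x ∧ Q x) xs
  cnt-overlap [] h h′ = z≤n
  cnt-overlap {P} {Q} {R} (x ∷ xs) h h′ = linarith 9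
    (λ p q r o a b c l m → p :+ q :+ r :≤ con 1 :+ o ⇒ a :+ b :+ c :≤ l :+ m ⇒ ⊢ (p :+ a) :+ (q :+ b) :+ (r :+ c) :≤ con 1 :+ l :+ (o :+ m))
    (𝟙 (P x)) (𝟙 (Q x)) (𝟙 (R x)) (𝟙 (P x ∧ Q x)) (cnt P xs) (cnt Q xs) (cnt R xs) (length xs) (cnt (λ x → P x ∧ Q x) xs)
    (one (P x) (Q x) (h (here refl)) (h′ (here refl))) (cnt-overlap xs (h ∘ there) (h′ ∘ there))
    where
    one : ∀ p q {r} → (p ≡ true → r ≡ true → ⊥) → (q ≡ true → r ≡ true → ⊥) → 𝟙 p + 𝟙 q + 𝟙 r ≤ 1 + 𝟙 (p ∧ q)
    one false q {r} h h′ = 𝟙-excl {q} {r} h′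
    one true false {r} h h′ = 𝟙-excl {a = true} {b = r} h
    one true true {false} h h′ = ≤-refl
    one true true {true} h h′ = ⊥-elim (h refl refl)

  record Spine (k : ℕ) : Set where
    field
      U          : List V
      grown      : Grown U
      uniq       : Unique U
      small      : length U ≤ 10 * k + 1
      dominating : ∀ v → ∃ λ u → u ∈ U × v ~ u
      connected  : ∀ x → ConnectedOff (x ∷ U)

  module Spines (three-connected : KConnected 3 G) (d : ℕ) (mindeg : ∀ v → d ≤ degree G v) (k : ℕ) (n<2^k : n < 2 ^ k)
    (dense : n + (40 * k + 20) ≤ 3 * d) (large : 30 * k + 20 ≤ d) where

    dense₁₃ : n + 13 ≤ 3 * d
    dense₁₃ = linarith 3 (λ n k d → n :+ (40 :* k :+ con 20) :≤ 3 :* d ⇒ ⊢ n :+ con 13 :≤ 3 :* d) n k d dense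

    module Separation (Q : List V) (smallQ : length Q ≤ 10 * k + 2) (sep : Separated Q) where

      f : V → Bool
      f = proj₁ sep

      norm : V → Bool
      norm v = not (v ∈ᵇ Q)

      S : Bool → V → ℕ
      S b v = cnt (λ w → adj G v w ∧ (norm w ∧ ⌊ b Boolₚ.≟ f w ⌋)) vertices

      -- A vertex of `Q` joins the side that has more of its neighbours outside `Q`. The colouring
      -- `f` says nothing about edges at `Q`; this extension makes a division of all vertices that
      -- remains useful when sets other than `Q` are deleted.
      α : V → Bool
      α v = if v ∈ᵇ Q then S false v ≤ᵇ S true v else f v

      ≟-refl : ∀ b → ⌊ b Boolₚ.≟ b ⌋ ≡ true
      ≟-refl true = refl
      ≟-refl false = refl

      S-total : ∀ v → d ≤ S true v + S false v + (10 * k + 2)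
      S-total v = ≤-trans (mindeg v) (≤-trans (cnt-without (adj G v) Q vertices-unique)
        (+-mono-≤ (cnt-or vertices λ {w} _ → go (adj G v w) (norm w) (f w)) smallQ))
        where
        go : ∀ a b c → a ∧ b ≡ true → a ∧ (b ∧ ⌊ true Boolₚ.≟ c ⌋) ≡ false → a ∧ (b ∧ ⌊ false Boolₚ.≟ c ⌋) ≡ true
        go true true false _ _ = refl

      norm-α : ∀ {v} → norm v ≡ true → α v ≡ f v
      norm-α {v} h with v ∈ᵇ Q
      ... | false = refl

      no-cross : ∀ {u w} → norm u ≡ true → norm w ≡ true → f u ≢ f w → u ~ w → ⊥
      no-cross {u} {w} nu nw ne uw with bool (f u) | bool (f w)
      ... | inj₁ a | inj₁ b = ne (trans a (sym b))
      ... | inj₂ a | inj₂ b = ne (trans a (sym b))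
      ... | inj₁ a | inj₂ b = proj₂ (proj₂ (proj₂ sep)) (∈ᵇ⇒∉ (not-true nu)) (∈ᵇ⇒∉ (not-true nw)) a b uw
      ... | inj₂ a | inj₁ b = proj₂ (proj₂ (proj₂ sep)) (∈ᵇ⇒∉ (not-true nw)) (∈ᵇ⇒∉ (not-true nu)) b a (~-sym uw)

      S-own : ∀ v {b} → norm v ≡ true → f v ≡ b → d ≤ S b v + (10 * k + 2)
      S-own v {b} nv fv = ≤-trans (S-total v) (+-monoˡ-≤ _ (only b fv))
        where
        other : ∀ c → f v ≢ c → S c v ≡ 0
        other c ne = cnt-none vertices λ {w} _ → go w (bool _)
          where
          go : ∀ w → _ ≡ true ⊎ _ ≡ false → adj G v w ∧ (norm w ∧ ⌊ c Boolₚ.≟ f w ⌋) ≡ false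
          go w (inj₂ e) = e
          go w (inj₁ e) with ∧-true (adj G v w) e
          ... | vw , e′ with ∧-true (norm w) e′
          ... | nw , e″ = ⊥-elim (no-cross nv nw (λ e₀ → ne (trans e₀ (sym (≟-true e″)))) vw)
        only : ∀ b → f v ≡ b → S true v + S false v ≤ S b v
        only true e = ≤-reflexive (trans (cong (S true v +_) (other false λ e′ → true≢false e e′)) (+-identityʳ _))
        only false e = ≤-reflexive (cong (_+ S false v) (other true λ e′ → true≢false e′ e))

      S-α : ∀ v → d ≤ 2 * S (α v) v + (10 * k + 2)
      S-α v with v ∈ᵇ Q in eq
      ... | false = ≤-trans (S-own v (cong not eq) refl) (+-monoˡ-≤ _ (m≤m+n (S (f v) v) (S (f v) v + 0)))
      ... | true with S false v ≤ᵇ S true v in le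
      ... | true = linarith 4 (λ d s t k → d :≤ t :+ s :+ (10 :* k :+ con 2) ⇒ s :≤ t ⇒ ⊢ d :≤ 2 :* t :+ (10 :* k :+ con 2))
        d (S false v) (S true v) k (S-total v) (≤ᵇ⇒≤ _ _ (subst T (sym le) tt))
      ... | false = linarith 4 (λ d s t k → d :≤ t :+ s :+ (10 :* k :+ con 2) ⇒ t :≤ s ⇒ ⊢ d :≤ 2 :* s :+ (10 :* k :+ con 2))
        d (S false v) (S true v) k (S-total v) (<⇒≤ (≰⇒> λ h → subst T le (≤⇒≤ᵇ h)))

      witness : ∀ b → ∃ λ o → norm o ≡ true × f o ≡ b
      witness true = let y , y∉ , e = proj₁ (proj₂ sep) in y , cong not (∉⇒∈ᵇ y∉) , e
      witness false = let z , z∉ , e = proj₁ (proj₂ (proj₂ sep)) in z , cong not (∉⇒∈ᵇ z∉) , e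

      side : ∀ v → 10 * k + 2 < cnt (λ w → adj G v w ∧ (norm w ∧ ⌊ α v Boolₚ.≟ α w ⌋)) vertices
      side v = ≤-trans (linarith 3 (λ d k s → con 20 :+ 30 :* k :≤ d ⇒ d :≤ 2 :* s :+ (10 :* k :+ con 2) ⇒ ⊢ 10 :* k :+ con 2 :< s)
          d k (S (α v) v) (≤-trans (≤-reflexive (+-comm 20 (30 * k))) large) (S-α v))
        (cnt-mono vertices λ {w} _ h → let vw , h′ = ∧-true (adj G v w) h ; nw , h″ = ∧-true (norm w) h′ in
          ∧-intro vw (∧-intro nw (subst (λ c → ⌊ α v Boolₚ.≟ c ⌋ ≡ true) (sym (norm-α nw)) h″)))

      -- The third neighbourhood is that of a vertex `o` on the other side, which outside `Q` is
      -- disjoint from those of `v` and `v′`. Hence `v` and `v′` have at least 3d - n - 3(10k + 2)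
      -- common neighbours, and this is at least 10k + 14.
      common : ∀ v v′ → norm v ≡ true → norm v′ ≡ true → α v ≡ α v′ → 10 * k + 2 < cnt (λ w → adj G v w ∧ adj G v′ w) vertices
      common v v′ nv nv′ e with witness (not (f v))
      ... | o , on , fo = ≤-trans (linarith 7 (λ n k d a b c m → n :+ (40 :* k :+ con 20) :≤ 3 :* d ⇒ d :≤ a :+ (10 :* k :+ con 2) ⇒
              d :≤ b :+ (10 :* k :+ con 2) ⇒ d :≤ c :+ (10 :* k :+ con 2) ⇒ a :+ b :+ c :≤ n :+ m ⇒ ⊢ 10 :* k :+ con 2 :< m)
            n k d (S (f v) v) (S (f v) v′) (S (not (f v)) o) (cnt both vertices) dense
            (S-own v nv refl) (S-own v′ nv′ (trans (sym (norm-α nv′)) (trans (sym e) (norm-α nv)))) (S-own o on fo)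
            (≤-trans (cnt-overlap vertices (λ {w} _ → excl (adj G v w) (adj G o w) (norm w) (f v) (f w)) (λ {w} _ → excl (adj G v′ w) (adj G o w) (norm w) (f v) (f w)))
              (≤-reflexive (cong (_+ cnt both vertices) length-vertices))))
          (cnt-mono vertices λ {w} _ h → let h₁ , h₂ = ∧-true (adj G v w ∧ (norm w ∧ ⌊ f v Boolₚ.≟ f w ⌋)) h in
            ∧-intro (proj₁ (∧-true (adj G v w) h₁)) (proj₁ (∧-true (adj G v′ w) h₂)))
        where
        both : V → Bool
        both w = (adj G v w ∧ (norm w ∧ ⌊ f v Boolₚ.≟ f w ⌋)) ∧ (adj G v′ w ∧ (norm w ∧ ⌊ f v Boolₚ.≟ f w ⌋))
        excl : ∀ a a′ b c e → a ∧ (b ∧ ⌊ c Boolₚ.≟ e ⌋) ≡ true → a′ ∧ (b ∧ ⌊ not c Boolₚ.≟ e ⌋) ≡ true → ⊥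
        excl true true true true true _ ()
        excl true true true true false ()
        excl true true true false true ()
        excl true true true false false _ ()
        excl true true false _ _ ()

      open Glue α norm (10 * k + 2) side common

      both-sides : ∀ b K → length K ≤ 2 → ∃ λ v → v ∉ K × α v ≡ b
      both-sides b K le =
        let o , on , fo = witness b
            w , e , w∉K = avoid (λ w → ⌊ α o Boolₚ.≟ α w ⌋) K (≤-<-trans (≤-trans le (m≤n+m 2 (10 * k)))
              (≤-trans (side o) (cnt-mono vertices λ {w} _ h → proj₂ (∧-true (norm w) (proj₂ (∧-true (adj G o w) h))))))
        in w , w∉K , trans (sym (≟-true e)) (trans (norm-α on) fo)

      cross : ∀ K → length K ≤ 2 → ∃₂ λ a b → a ∉ K × b ∉ K × α a ≡ true × α b ≡ false × a ~ b
      cross K le =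
        let y , y∉ , αy = both-sides true K le
            z , z∉ , αz = both-sides false K le
        in kconnected-off three-connected K (s≤s le) α y z y∉ z∉ αy αz

      open Matching α cross
      open Edge

      α-apart : ∀ {u w} → α u ≡ true → α w ≡ false → u ≢ w
      α-apart αu αw refl = true≢false αu αw

      -- By `e₁` the graph stays connected without the ends of `e₂` and `e₃`, so a dominating tree
      -- can avoid them. A further vertex `x` meets at most one of `e₂` and `e₃`, and the other one
      -- glues the two sides of what remains.
      spine : Spine k
      spine = from three
        where
        k≥1 : ∀ k → n < 2 ^ k → 20 ≤ n → 1 ≤ k
        k≥1 zero lt le = linarith 1 (λ n → n :< con 1 ⇒ con 20 :≤ n ⇒ ⊢ con 1 :≤ con 0) n lt le
        k≥1 (suc k) lt le = s≤s z≤n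
        from : Three → Spine k
        from (e₁ , e₂ , e₃ , (a₁₂ , b₁₂) , (a₁₃ , b₁₃) , (a₂₃ , b₂₃)) =
          let U , T , small , dom = Trees.dominating-tree d mindeg Q₄ ≤-refl dense₁₃ conn₄ k n<2^k a₁∉
          in record { U = U ; grown = grown T ; uniq = uniq T ; small = small ; dominating = dom
                    ; connected = λ x → conn (off T) small x (x Fin.≟ a e₂) (x Fin.≟ b e₂) }
          where
          Q₄ : List V
          Q₄ = a e₂ ∷ a e₃ ∷ b e₂ ∷ b e₃ ∷ []
          open Trees.Tree
          20≤n : 20 ≤ n
          20≤n = linarith 3 (λ k d n → 30 :* k :+ con 20 :≤ d ⇒ d :≤ n ⇒ ⊢ con 20 :≤ n) k d n large
            (≤-trans (mindeg (a e₁)) (≤-trans (cnt≤length (adj G (a e₁)) vertices) (≤-reflexive length-vertices)))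
          a₁∉ : a e₁ ∉ Q₄
          a₁∉ (here e) = a₁₂ e
          a₁∉ (there (here e)) = a₁₃ e
          a₁∉ (there (there (here e))) = α-apart (αa e₁) (αb e₂) e
          a₁∉ (there (there (there (here e)))) = α-apart (αa e₁) (αb e₃) e
          b₁∉ : b e₁ ∉ Q₄
          b₁∉ (here e) = α-apart (αa e₂) (αb e₁) (sym e)
          b₁∉ (there (here e)) = α-apart (αa e₃) (αb e₁) (sym e)
          b₁∉ (there (there (here e))) = b₁₂ e
          b₁∉ (there (there (there (here e)))) = b₁₃ e
          -- As `k` is positive, at least 10k + 2 vertices may be deleted, which allows for the four
          -- of `Q₄`.
          conn₄ : ConnectedOff Q₄
          conn₄ = glue Q₄ (linarith 1 (λ k → con 1 :≤ k ⇒ ⊢ con 4 :≤ 10 :* k :+ con 2) k (k≥1 k n<2^k 20≤n)) a₁∉ b₁∉ (αa e₁) (αb e₁) (a~b e₁)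
          conn : ∀ {U} → (∀ {u} → u ∈ U → u ∉ Q₄) → length U ≤ 10 * k + 1 → ∀ x → Dec (x ≡ a e₂) → Dec (x ≡ b e₂) → ConnectedOff (x ∷ U)
          conn {U} off le x da db = by da db
            where
            le′ : length (x ∷ U) ≤ 10 * k + 2
            le′ = ≤-trans (s≤s le) (≤-reflexive (sym (+-suc (10 * k) 1)))
            outside : ∀ {v} → v ≢ x → v ∈ Q₄ → v ∉ x ∷ U
            outside ne v∈ (here e) = ne e
            outside ne v∈ (there h) = off h v∈
            by : Dec (x ≡ a e₂) → Dec (x ≡ b e₂) → ConnectedOff (x ∷ U)
            by (no p) (no q) = glue (x ∷ U) le′ (outside (p ∘ sym) (here refl)) (outside (q ∘ sym) (there (there (here refl)))) (αa e₂) (αb e₂) (a~b e₂)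
            by (yes refl) _ = glue (x ∷ U) le′ (outside (a₂₃ ∘ sym) (there (here refl)))
              (outside (α-apart (αa e₂) (αb e₃) ∘ sym) (there (there (there (here refl))))) (αa e₃) (αb e₃) (a~b e₃)
            by (no _) (yes refl) = glue (x ∷ U) le′ (outside (α-apart (αa e₃) (αb e₂)) (there (here refl)))
              (outside (b₂₃ ∘ sym) (there (there (there (here refl))))) (αa e₃) (αb e₃) (a~b e₃)

    spine : V → Spine k
    spine v =
      let U , T , small , dom = Trees.dominating-tree d mindeg [] z≤n dense₁₃ (kconnected-off three-connected [] (s≤s z≤n)) k n<2^k {v} (λ ())
      in by T small dom (all-or-one (λ x → connected-or-separated (x ∷ U)))
      where
      open Trees.Tree
      by : ∀ {U} → Trees.Tree d mindeg [] z≤n dense₁₃ U → length U ≤ 10 * k + 1 → (∀ v → ∃ λ u → u ∈ U × v ~ u) →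
        (∀ x → ConnectedOff (x ∷ U)) ⊎ (∃ λ x → Separated (x ∷ U)) → Spine k
      by {U} T small dom (inj₁ conn) = record { U = U ; grown = grown T ; uniq = uniq T ; small = small ; dominating = dom ; connected = conn }
      by {U} T small dom (inj₂ (x , sep)) = Separation.spine (x ∷ U) (≤-trans (s≤s small) (≤-reflexive (sym (+-suc (10 * k) 1)))) sep

-- From an inner tree, private leaves and a cycle to a generalized Halin graph

module Assemblies {n : ℕ} (G : Graph n) where

  open Paths G
  open LongestCycles G
  open IndependentSets G
  open DominatingTrees G
  open Separators G

  link : List (V × V) → V → V → Bool
  link Es u w = anyᵇ (λ (v , p) → ⌊ u Fin.≟ v ⌋ ∧ ⌊ w Fin.≟ p ⌋) Es

  link⁻ : ∀ Es {u w} → link Es u w ≡ true → (u , w) ∈ Es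
  link⁻ Es {u} {w} h with any-true (λ (v , p) → ⌊ u Fin.≟ v ⌋ ∧ ⌊ w Fin.≟ p ⌋) Es h
  ... | (v , p) , ∈Es , e with u Fin.≟ v | w Fin.≟ p
  ... | yes refl | yes refl = ∈Es

  link⁺ : ∀ {Es u w} → (u , w) ∈ Es → link Es u w ≡ true
  link⁺ {Es} {u} {w} h with bool (link Es u w)
  ... | inj₁ e = e
  ... | inj₂ e with u Fin.≟ u | w Fin.≟ w | any-false (λ (v , p) → ⌊ u Fin.≟ v ⌋ ∧ ⌊ w Fin.≟ p ⌋) Es e h
  ... | yes _ | yes _ | ()
  ... | no ne | _ | _ = ⊥-elim (ne refl)
  ... | yes _ | no ne | _ = ⊥-elim (ne refl)

  -- Abstract, so that Es can be inferred from tree Es.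
  abstract

    tree : List (V × V) → Graph n
    tree Es = record
      { adj = λ u w → adj G u w ∧ (link Es u w ∨ link Es w u)
      ; sym = λ u w → cong₂ _∧_ (adj-sym G u w) (Boolₚ.∨-comm (link Es u w) (link Es w u))
      ; irrefl = λ u → cong (_∧ (link Es u u ∨ link Es u u)) (adj-irrefl G u)
      }

    tree-edge⁻ : ∀ Es {u w} → adj (tree Es) u w ≡ true → u ~ w × ((u , w) ∈ Es ⊎ (w , u) ∈ Es)
    tree-edge⁻ Es {u} {w} h with ∧-true (adj G u w) h
    ... | uw , e with bool (link Es u w)
    ... | inj₁ l = uw , inj₁ (link⁻ Es l)
    ... | inj₂ l = uw , inj₂ (link⁻ Es (subst (λ b → b ∨ link Es w u ≡ true) l e))

    tree-edge⁺ : ∀ {Es u w} → u ~ w → (u , w) ∈ Es → adj (tree Es) u w ≡ true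
    tree-edge⁺ {Es} {u} {w} uw h = ∧-intro uw (cong (_∨ link Es w u) (link⁺ h))

    tree-edge⁺′ : ∀ {Es u w} → u ~ w → (u , w) ∈ Es → adj (tree Es) w u ≡ true
    tree-edge⁺′ {Es} {u} {w} uw h = trans (adj-sym (tree Es) w u) (tree-edge⁺ uw h)

  -- A tree as a history of attached leaves, with vertices `L` and edges `Es` from child to parent.
  -- The youngest vertex has a single neighbour, so connectedness and acyclicity follow by
  -- induction.
  data Forest : List (V × V) → List V → Set where
    base   : ∀ {r} → Forest [] (r ∷ [])
    attach : ∀ {v p Es L} → v ∉ L → p ∈ L → v ~ p → Forest Es L → Forest ((v , p) ∷ Es) (v ∷ L)

  forest-∈ : ∀ {Es L u w} → Forest Es L → (u , w) ∈ Es → u ∈ L × w ∈ L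
  forest-∈ (attach _ p∈L _ F) (here refl) = here refl , there p∈L
  forest-∈ (attach _ _ _ F) (there h) = let u∈ , w∈ = forest-∈ F h in there u∈ , there w∈

  walk-append : ∀ {T : Graph n} {u w x} → Walk T (λ _ → V) u w → adj T w x ≡ true → Walk T (λ _ → V) u x
  walk-append (here p) e = step p e (here p)
  walk-append (step p e′ walk) e = step p e′ (walk-append walk e)

  walk-weaken : ∀ {e Es u w} → Walk (tree Es) (λ _ → V) u w → Walk (tree (e ∷ Es)) (λ _ → V) u w
  walk-weaken (here p) = here p
  walk-weaken {e} {Es} (step {u} {w} p uw walk) with tree-edge⁻ Es uw
  ... | h , inj₁ m = step p (tree-edge⁺ {e ∷ Es} h (there m)) (walk-weaken walk)
  ... | h , inj₂ m = step p (tree-edge⁺′ {e ∷ Es} (~-sym h) (there m)) (walk-weaken walk)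

  forest-connected : ∀ {Es L u w} → Forest Es L → u ∈ L → w ∈ L → Walk (tree Es) (λ _ → V) u w
  forest-connected (base {r}) (here refl) (here refl) = here r
  forest-connected (attach {v} _ _ _ F) (here refl) (here refl) = here v
  forest-connected (attach {v} _ p∈L vp F) (here refl) (there w∈L) =
    step v (tree-edge⁺ vp (here refl)) (walk-weaken (forest-connected F p∈L w∈L))
  forest-connected (attach _ p∈L vp F) (there u∈L) (here refl) =
    walk-append (walk-weaken (forest-connected F u∈L p∈L)) (tree-edge⁺′ vp (here refl))
  forest-connected (attach _ _ _ F) (there u∈L) (there w∈L) = walk-weaken (forest-connected F u∈L w∈L)

  module _ (T : Graph n) where

    open module PT = Paths T using () renaming (Path to Pathᵀ; Cyc to Cycᵀ)

    chain-path : ∀ {u z} ws → Chain T (u ∷ ws ++ z ∷ []) → ∃ λ b → Pathᵀ u (u ∷ ws) b × adj T b z ≡ true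
    chain-path [] (cons e single) = _ , PT.[-] , e
    chain-path (w ∷ ws) (cons e c) with chain-path ws c
    ... | b , p , f = b , e PT.∷ p , f

    before-last : ∀ {a xs b} → Pathᵀ a xs b → xs ≡ b ∷ [] ⊎ ∃ λ w → w ∈ xs × adj T w b ≡ true
    before-last PT.[-] = inj₁ refl
    before-last (e PT.∷ p) with before-last p
    ... | inj₂ (w , w∈ , f) = inj₂ (w , there w∈ , f)
    ... | inj₁ refl with PT.head≡ p
    ... | refl = inj₂ (_ , here refl , e)

    -- The cycle is cut at `v` and at another vertex `y`. The successor `c` of `v` opens `s₂`; the
    -- predecessor lies in `s₁`, or is `y` if `s₁` consists of `v` alone.
    two-neighbours : ∀ {xs v} → Cycᵀ xs → Unique xs → 3 ≤ length xs → v ∈ xs →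
      ∃₂ λ u w → u ≢ w × adj T v u ≡ true × adj T v w ≡ true
    two-neighbours {xs} {v} cyc uniq len v∈xs =
      let y , y∈ , y≢v = other v∈xs uniq len
          a , c , s₁ , s₂ , P₁ , P₂ , vc , ya , e = PT.segments cyc v∈xs y∈ (y≢v ∘ sym)
      in by P₁ P₂ vc ya e (before-last P₁)
      where
      other : ∀ {xs} → v ∈ xs → Unique xs → 3 ≤ length xs → ∃ λ y → y ∈ xs × y ≢ v
      other {_ ∷ y ∷ _} (here refl) ((v≢y ∷ _) ∷ _) _ = y , there (here refl) , v≢y ∘ sym
      other {x ∷ _} (there v∈) (x∉ ∷ _) _ = x , here refl , All.lookup x∉ v∈
      other {_ ∷ []} (here refl) _ (s≤s ())
      by : ∀ {a c y s₁ s₂} → Pathᵀ a s₁ v → Pathᵀ c s₂ y → adj T v c ≡ true → adj T y a ≡ true → s₁ ++ s₂ ↭ xs →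
        s₁ ≡ v ∷ [] ⊎ (∃ λ w → w ∈ s₁ × adj T w v ≡ true) → ∃₂ λ u w → u ≢ w × adj T v u ≡ true × adj T v w ≡ true
      by {s₁ = s₁} {s₂} P₁ P₂ vc ya e (inj₂ (w , w∈ , wv)) =
        w , _ , unique-apart s₁ s₂ uniq (↭-sym e) w∈ (PT.first∈ P₂) , trans (adj-sym T v w) wv , vc
      by {y = y} P₁ PT.[-] vc ya e (inj₁ refl) = ⊥-elim (<-irrefl (↭ₚ.↭-length e) len)
      by {c = c} {y} P₁ (f PT.∷ P₂) vc ya e (inj₁ refl) with PT.head≡ P₁
      ... | refl = c , y , (λ c≡y → c∉ (PT.last∈ P₂) c≡y) , vc , trans (adj-sym T v y) ya
        where
        c∉ : ∀ {z} → z ∈ _ → c ≢ z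
        c∉ z∈ = unique-apart (c ∷ []) _ uniq (↭-trans (↭-sym e) (permute 3 (λ v c s → ⊢ₚ v ⊕ c ⊕ s ≋ c ⊕ s ⊕ v) (v ∷ []) (c ∷ []) _))
          (here refl) (∈-++⁺ˡ z∈)

  forest-leaf : ∀ {v p Es L w} → Forest Es L → v ∉ L → adj (tree ((v , p) ∷ Es)) v w ≡ true → w ≡ p
  forest-leaf {v} {p} {Es} F v∉L e with tree-edge⁻ ((v , p) ∷ Es) e
  ... | _ , inj₁ (here refl) = refl
  ... | _ , inj₁ (there h) = ⊥-elim (v∉L (proj₁ (forest-∈ F h)))
  ... | vw , inj₂ (here refl) = refl
  ... | _ , inj₂ (there h) = ⊥-elim (v∉L (proj₂ (forest-∈ F h)))

  path-strengthen : ∀ {v p Es a xs b} → Paths.Path (tree ((v , p) ∷ Es)) a xs b → v ∉ xs → Paths.Path (tree Es) a xs b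
  edge-strengthen : ∀ {v p Es a b} → adj (tree ((v , p) ∷ Es)) a b ≡ true → a ≢ v → b ≢ v → adj (tree Es) a b ≡ true
  edge-strengthen {v} {p} {Es} e a≢v b≢v with tree-edge⁻ ((v , p) ∷ Es) e
  ... | _ , inj₁ (here refl) = ⊥-elim (a≢v refl)
  ... | _ , inj₂ (here refl) = ⊥-elim (b≢v refl)
  ... | ab , inj₁ (there h) = tree-edge⁺ ab h
  ... | ab , inj₂ (there h) = tree-edge⁺′ (~-sym ab) h
  path-strengthen Paths.[-] v∉ = Paths.[-]
  path-strengthen {v} (e Paths.∷ P) v∉ = edge-strengthen e (λ { refl → v∉ (here refl) }) (λ { refl → v∉ (there (Paths.first∈ _ P)) })
    Paths.∷ path-strengthen P (v∉ ∘ there)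

  -- A cycle through the youngest vertex would give it two neighbours; any other cycle survives in
  -- the older tree.
  forest-acyclic : ∀ {Es L xs} → Forest Es L → Unique xs → 3 ≤ length xs → Paths.Cyc (tree Es) xs → ⊥
  forest-acyclic base uniq len (a , b , P , e) with tree-edge⁻ [] e
  ... | _ , inj₁ ()
  ... | _ , inj₂ ()
  forest-acyclic {xs = xs} (attach {v} {p} {Es} v∉L p∈L vp F) uniq len cyc with v ∈ᵇ xs in eq
  ... | true = let u , w , u≢w , vu , vw = two-neighbours (tree ((v , p) ∷ Es)) cyc uniq len (∈ᵇ⇒∈ eq)
               in u≢w (trans (forest-leaf F v∉L vu) (sym (forest-leaf F v∉L vw)))
  ... | false = let a , b , P , e = cyc
                in forest-acyclic F uniq len (a , b , path-strengthen P (∈ᵇ⇒∉ eq) ,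
                     edge-strengthen e (λ { refl → ∈ᵇ⇒∉ eq (Paths.last∈ _ P) }) (λ { refl → ∈ᵇ⇒∉ eq (Paths.first∈ _ P) }))

  -- Each vertex of `us` owns two consecutive entries of `ls`. That these leaves are private to it
  -- will be expressed by uniqueness of `ls`.
  data Stars : List V → List V → Set where
    []   : Stars [] []
    star : ∀ {u c₁ c₂ us ls} → u ~ c₁ → u ~ c₂ → Stars us ls → Stars (u ∷ us) (c₁ ∷ c₂ ∷ ls)

  stars-++ : ∀ {us ls us′ ls′} → Stars us ls → Stars us′ ls′ → Stars (us ++ us′) (ls ++ ls′)
  stars-++ [] S′ = S′
  stars-++ (star e f S) S′ = star e f (stars-++ S S′)

  star-edges : ∀ {us ls} → Stars us ls → List (V × V)
  star-edges [] = []
  star-edges (star {u} {c₁} {c₂} _ _ S) = (c₁ , u) ∷ (c₂ , u) ∷ star-edges S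

  star-firsts : ∀ {us ls} (S : Stars us ls) → map proj₁ (star-edges S) ≡ ls
  star-firsts [] = refl
  star-firsts (star {c₁ = c₁} {c₂} _ _ S) = cong (λ l → c₁ ∷ c₂ ∷ l) (star-firsts S)

  star-edge : ∀ {us ls c u} (S : Stars us ls) → (c , u) ∈ star-edges S → u ∈ us × c ~ u
  star-edge (star e f S) (here refl) = here refl , ~-sym e
  star-edge (star e f S) (there (here refl)) = here refl , ~-sym f
  star-edge (star e f S) (there (there h)) = let u∈ , cu = star-edge S h in there u∈ , cu

  star-leaves : ∀ {us ls u} (S : Stars us ls) → Unique ls → u ∈ us →
    ∃₂ λ c₁ c₂ → (c₁ , u) ∈ star-edges S × (c₂ , u) ∈ star-edges S × c₁ ≢ c₂
  star-leaves (star e f S) ((c₁≢c₂ ∷ _) ∷ _) (here refl) = _ , _ , here refl , there (here refl) , c₁≢c₂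
  star-leaves (star e f S) (_ ∷ _ ∷ uniq) (there u∈) =
    let c₁ , c₂ , h₁ , h₂ , ne = star-leaves S uniq u∈ in c₁ , c₂ , there (there h₁) , there (there h₂) , ne

  rest-edges : ∀ {Us} ls → (∀ {c} → c ∈ ls → ∃ λ u → u ∈ Us × c ~ u) →
    ∃ λ ps → map proj₁ ps ≡ ls × (∀ {c u} → (c , u) ∈ ps → u ∈ Us × c ~ u)
  rest-edges [] h = [] , refl , λ ()
  rest-edges (c ∷ ls) h with h (here refl) | rest-edges ls (h ∘ there)
  ... | u , u∈ , cu | ps , e , k = (c , u) ∷ ps , cong (c ∷_) e , λ { (here refl) → u∈ , cu ; (there m) → k m }

  grown-forest : ∀ {L} → Grown L → Unique L → ∃ λ Es → Forest Es L
  grown-forest root _ = [] , base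
  grown-forest (grow p∈L vp g) (v∉ ∷ uniq) with grown-forest g uniq
  ... | Es , F = _ , attach (λ h → All.lookup v∉ h refl) p∈L vp F

  attach-all : ∀ {Es L} ps → Forest Es L → (∀ {c u} → (c , u) ∈ ps → u ∈ L × c ~ u) → Unique (map proj₁ ps ++ L) →
    Forest (ps ++ Es) (map proj₁ ps ++ L)
  attach-all [] F h uniq = F
  attach-all ((c , u) ∷ ps) F h (c∉ ∷ uniq) = let u∈L , cu = h (here refl) in
    attach (λ m → All.lookup c∉ m refl) (∈-++⁺ʳ (map proj₁ ps) u∈L) cu (attach-all ps F (h ∘ there) uniq)

  forest-neighbour : ∀ {Es L u} → Forest Es L → 2 ≤ length L → u ∈ L → ∃ λ w → w ∈ L × u ~ w × ((u , w) ∈ Es ⊎ (w , u) ∈ Es)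
  forest-neighbour base (s≤s ()) _
  forest-neighbour (attach _ p∈L vp F) _ (here refl) = _ , there p∈L , vp , inj₁ (here refl)
  forest-neighbour (attach _ (here refl) vp base) _ (there (here refl)) = _ , here refl , ~-sym vp , inj₂ (here refl)
  forest-neighbour (attach _ _ _ F@(attach {L = _ ∷ _} _ _ _ _)) _ (there u∈L) with forest-neighbour F (s≤s (s≤s z≤n)) u∈L
  ... | w , w∈ , uw , inj₁ h = w , there w∈ , uw , inj₁ (there h)
  ... | w , w∈ , uw , inj₂ h = w , there w∈ , uw , inj₂ (there h)

  unique-subset : ∀ {ys H : List V} → Unique ys → (∀ {y} → y ∈ ys → y ∈ H) → ∃ λ R → ys ++ R ↭ H
  unique-subset {[]} {H} _ _ = H , ↭-refl
  unique-subset {y ∷ ys} (y∉ ∷ uniq) h with member-pick (h (here refl))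
  ... | H′ , e with unique-subset {ys} {H′} uniq (λ {z} z∈ → case ∈-↭ e (h (there z∈)) of λ
        { (here refl) → ⊥-elim (All.lookup y∉ z∈ refl) ; (there m) → m })
  ... | R , p = R , ↭-trans (prep y p) (↭-sym e)

  unique-count : ∀ {P : V → Bool} ys → Unique ys → (∀ {y} → y ∈ ys → P y ≡ true) → length ys ≤ cnt P vertices
  unique-count {P} ys uniq h with unique-subset uniq (λ {y} _ → ∈-vertices y)
  ... | R , e = ≤-trans (≤-reflexive (sym (cnt-all ys h))) (≤-trans (m≤m+n _ _) (≤-reflexive (sym (cnt-↭-++ P ys R (↭-sym e)))))

  path-chain : ∀ {a xs b z} → Path a xs b → b ~ z → Chain G (xs ++ z ∷ [])
  path-chain [-] e = cons e single
  path-chain (_∷_ {xs = []} _ ()) _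
  path-chain (_∷_ {xs = x ∷ xs} f p) e with head≡ p
  ... | refl = cons f (path-chain p e)

  module Assembled {Us C us ls ls′ : List V} (g : Grown Us) (all : Us ++ C ↭ vertices) (two : 2 ≤ length Us)
    (cyc : Cyc C) (three : 3 ≤ length C) (S : Stars us ls) (us↭Us : us ↭ Us) (ls↭C : ls ++ ls′ ↭ C)
    (dominated : ∀ {c} → c ∈ ls′ → ∃ λ u → u ∈ Us × c ~ u) where

    uniq : Unique (Us ++ C)
    uniq = unique-↭ (↭-sym all) vertices-unique

    uniqC : Unique C
    uniqC = unique-drop Us uniq

    Es : List (V × V)
    Es = proj₁ (grown-forest g (unique-drop C (unique-↭ (↭ₚ.++-comm Us C) uniq)))

    F₀ : Forest Es Us
    F₀ = proj₂ (grown-forest g (unique-drop C (unique-↭ (↭ₚ.++-comm Us C) uniq)))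

    rests : ∃ λ ps → map proj₁ ps ≡ ls′ × (∀ {c u} → (c , u) ∈ ps → u ∈ Us × c ~ u)
    rests = rest-edges ls′ dominated

    ps : List (V × V)
    ps = star-edges S ++ proj₁ rests

    ps-firsts : map proj₁ ps ≡ ls ++ ls′
    ps-firsts = trans (map-++ proj₁ (star-edges S) (proj₁ rests)) (cong₂ _++_ (star-firsts S) (proj₁ (proj₂ rests)))

    ps-edge : ∀ {c u} → (c , u) ∈ ps → u ∈ Us × c ~ u
    ps-edge h with ∈-++⁻ (star-edges S) h
    ... | inj₁ m = let u∈ , cu = star-edge S m in ∈-↭ us↭Us u∈ , cu
    ... | inj₂ m = proj₂ (proj₂ rests) m

    firsts↭C : map proj₁ ps ↭ C
    firsts↭C = ↭-trans (↭-reflexive ps-firsts) ls↭C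

    F : Forest (ps ++ Es) (map proj₁ ps ++ Us)
    F = attach-all ps F₀ ps-edge (unique-↭ (↭-trans (↭ₚ.++-comm Us C) (↭ₚ.++⁺ʳ Us (↭-sym firsts↭C))) uniq)

    everywhere : ∀ v → v ∈ map proj₁ ps ++ Us
    everywhere v = ∈-↭ (↭-trans (↭-sym all) (↭-trans (↭ₚ.++-comm Us C) (↭ₚ.++⁺ʳ Us (↭-sym firsts↭C)))) (∈-vertices v)

    𝕋 : Graph n
    𝕋 = tree (ps ++ Es)

    T-edge : ∀ {u w} → adj 𝕋 u w ≡ true → u ~ w
    T-edge e = proj₁ (tree-edge⁻ (ps ++ Es) e)

    acyclic : ¬ Cycle 𝕋
    acyclic c = let b , P , e = chain-path 𝕋 (rest c) (closed c) in
      forest-acyclic F (Cycle.unique c) (s≤s (len≥2 c)) (_ , b , P , e)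

    disjoint : ∀ {v} → v ∈ Us → v ∈ C → ⊥
    disjoint u∈ c∈ = unique-apart Us C uniq ↭-refl u∈ c∈ refl

    ps-∈C : ∀ {c u} → (c , u) ∈ ps → c ∈ C
    ps-∈C h = ∈-↭ firsts↭C (∈-map⁺ proj₁ h)

    functional : ∀ {c u w : V} (xs : List (V × V)) → Unique (map proj₁ xs) → (c , u) ∈ xs → (c , w) ∈ xs → u ≡ w
    functional (_ ∷ xs) uq (here refl) (here refl) = refl
    functional (_ ∷ xs) (c∉ ∷ _) (here refl) (there h) = ⊥-elim (All.lookup c∉ (∈-map⁺ proj₁ h) refl)
    functional (_ ∷ xs) (c∉ ∷ _) (there h) (here refl) = ⊥-elim (All.lookup c∉ (∈-map⁺ proj₁ h) refl)
    functional (_ ∷ xs) (_ ∷ uq) (there h) (there h′) = functional xs uq h h′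

    leaf-neighbour : ∀ {c u w} → (c , u) ∈ ps → adj 𝕋 c w ≡ true → w ≡ u
    leaf-neighbour {c} {u} {w} h e with tree-edge⁻ (ps ++ Es) e
    ... | _ , inj₁ m = case ∈-++⁻ ps m of λ
      { (inj₁ m′) → functional ps (unique-↭ (↭-sym firsts↭C) uniqC) m′ h
      ; (inj₂ m′) → ⊥-elim (disjoint (proj₁ (forest-∈ F₀ m′)) (ps-∈C h)) }
    ... | _ , inj₂ m = case ∈-++⁻ ps m of λ
      { (inj₁ m′) → ⊥-elim (disjoint (proj₁ (ps-edge m′)) (ps-∈C h))
      ; (inj₂ m′) → ⊥-elim (disjoint (proj₂ (forest-∈ F₀ m′)) (ps-∈C h)) }

    ≟-refl : ∀ (v : V) → ⌊ v Fin.≟ v ⌋ ≡ true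
    ≟-refl v with v Fin.≟ v
    ... | yes _ = refl
    ... | no ne = ⊥-elim (ne refl)

    leaf-degree : ∀ {c} → c ∈ C → degree 𝕋 c ≡ 1
    leaf-degree {c} c∈C with ∈-map⁻ proj₁ (∈-↭ (↭-sym firsts↭C) c∈C)
    ... | (_ , u) , h , refl = ≤-antisym
      (≤-trans (cnt-mono {P = adj 𝕋 c} {Q = λ w → ⌊ w Fin.≟ u ⌋} vertices
        (λ {w} _ e → subst (λ z → ⌊ z Fin.≟ u ⌋ ≡ true) (sym (leaf-neighbour h e)) (≟-refl u))) (cnt-≟ u vertices-unique))
      (unique-count {P = adj 𝕋 c} (u ∷ []) ([] ∷ []) λ { (here refl) → tree-edge⁺ (proj₂ (ps-edge h)) (∈-++⁺ˡ h) })

    inner-degree : ∀ {u} → u ∈ Us → 3 ≤ degree 𝕋 u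
    inner-degree {u} u∈ with star-leaves S (unique-drop ls′ (unique-↭ (↭-trans (↭-sym ls↭C) (↭ₚ.++-comm ls ls′)) uniqC)) (∈-↭ (↭-sym us↭Us) u∈)
      | forest-neighbour F₀ two u∈
    ... | c₁ , c₂ , h₁ , h₂ , ne | w , w∈ , uw , e = unique-count {P = adj 𝕋 u} (c₁ ∷ c₂ ∷ w ∷ [])
      ((ne ∷ apart h₁ ∷ []) ∷ (apart h₂ ∷ []) ∷ [] ∷ [])
      λ { (here refl) → down h₁ ; (there (here refl)) → down h₂ ; (there (there (here refl))) → across e }
      where
      apart : ∀ {c} → (c , u) ∈ star-edges S → c ≢ w
      apart h refl = disjoint w∈ (ps-∈C (∈-++⁺ˡ h))
      down : ∀ {c} → (c , u) ∈ star-edges S → adj 𝕋 u c ≡ true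
      down h = tree-edge⁺′ (proj₂ (star-edge S h)) (∈-++⁺ˡ (∈-++⁺ˡ h))
      across : (u , w) ∈ Es ⊎ (w , u) ∈ Es → adj 𝕋 u w ≡ true
      across (inj₁ h) = tree-edge⁺ uw (∈-++⁺ʳ ps h)
      across (inj₂ h) = tree-edge⁺′ (~-sym uw) (∈-++⁺ʳ ps h)

    inner-or-leaf : ∀ v → v ∈ Us ⊎ v ∈ C
    inner-or-leaf v = ∈-++⁻ Us (∈-↭ (↭-sym all) (∈-vertices v))

    no-degree-2 : ∀ v → degree 𝕋 v ≢ 2
    no-degree-2 v e with inner-or-leaf v
    ... | inj₁ h = <-irrefl refl (subst (3 ≤_) e (inner-degree h))
    ... | inj₂ h with trans (sym e) (leaf-degree h)
    ... | ()

    cycle : Σ (Cycle G) λ c → ∀ v → (v ∈C c → v ∈ C) × (v ∈ C → v ∈C c)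
    cycle = from cyc uniqC three
      where
      from : ∀ {xs} → Cyc xs → Unique xs → 3 ≤ length xs → Σ (Cycle G) λ c → ∀ v → (v ∈C c → v ∈ xs) × (v ∈ xs → v ∈C c)
      from {x ∷ xs} (a , b , P , e) u (s≤s len) with head≡ P
      ... | refl = record { start = x ; rest = xs ; len≥2 = len ; unique = u ; closed = path-chain P e } , λ v → (λ h → h) , (λ h → h)

    halin : HasSpanningGenHalin G
    halin = 𝕋 , ((((λ u w → T-edge) , (λ u w → forest-connected F (everywhere u) (everywhere w)) , acyclic)) , no-degree-2) ,
      proj₁ cycle , λ v → mk⇔ (λ h → leaf-degree (proj₁ (proj₂ cycle v) h)) (back v)
      where
      back : ∀ v → IsLeaf 𝕋 v → v ∈C proj₁ cycle
      back v e = by (inner-or-leaf v)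
        where
        by : v ∈ Us ⊎ v ∈ C → v ∈C proj₁ cycle
        by (inj₂ h) = proj₂ (proj₂ cycle v) h
        by (inj₁ h) = ⊥-elim (<-irrefl (sym e) (≤-trans (s≤s (s≤s z≤n)) (inner-degree h)))

-- A spanning generalized Halin graph or a large independent set

module Dichotomy {n : ℕ} (G : Graph n) where

  open Paths G
  open LongestCycles G
  open IndependentSets G
  open DominatingTrees G
  open Separators G
  open Assemblies G

  stars-length : ∀ {us ls} → Stars us ls → length ls ≡ 2 * length us
  stars-length [] = refl
  stars-length (star {us = us} {ls} _ _ S) = linarith 2 (λ l u → l :≡ 2 :* u ⇒ ⊢ con 2 :+ l :≡ 2 :* (con 1 :+ u)) (length ls) (length us) (stars-length S)

  cnt-pop : ∀ {A : Set} (P : A → Bool) {x xs ys} → xs ↭ x ∷ ys → cnt P xs ≤ 1 + cnt P ys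
  cnt-pop P {x} {xs} {ys} e = ≤-trans (≤-reflexive (cnt-↭ P e)) (+-monoˡ-≤ (cnt P ys) (𝟙≤1 (P x)))

  -- Greedy choice: serving one vertex removes two candidates and lowers the requirement of the
  -- others by two.
  stars-exist : ∀ us L → (∀ {u} → u ∈ us → 2 * length us ≤ cnt (adj G u) L) → ∃₂ λ ls L′ → Stars us ls × ls ++ L′ ↭ L
  stars-exist [] L h = [] , L , [] , ↭-refl
  stars-exist (u ∷ us) L h =
    let many = h (here refl)
        c₁ , L₁ , e₁ , uc₁ = pick (adj G u) L (≤-trans (s≤s z≤n) many)
        c₂ , L₂ , e₂ , uc₂ = pick (adj G u) L₁ (linarith 3 (λ m c c₁ → 2 :* (con 1 :+ m) :≤ c ⇒ c :≤ con 1 :+ c₁ ⇒ ⊢ con 1 :≤ c₁)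
          (length us) (cnt (adj G u) L) (cnt (adj G u) L₁) many (cnt-pop (adj G u) e₁))
        ls , L′ , S , e = stars-exist us L₂ λ {w} w∈ → linarith 4
          (λ m c c₁ c₂ → 2 :* (con 1 :+ m) :≤ c ⇒ c :≤ con 1 :+ c₁ ⇒ c₁ :≤ con 1 :+ c₂ ⇒ ⊢ 2 :* m :≤ c₂)
          (length us) (cnt (adj G w) L) (cnt (adj G w) L₁) (cnt (adj G w) L₂) (h (there w∈)) (cnt-pop (adj G w) e₁) (cnt-pop (adj G w) e₂)
    in c₁ ∷ c₂ ∷ ls , L′ , star uc₁ uc₂ S ,
       ↭-trans (prep c₁ (↭-trans (prep c₂ e) (↭-sym e₂))) (↭-sym e₁)

  grown-++ : ∀ {L} xs → Grown L → (∀ {x} → x ∈ xs → ∃ λ u → u ∈ L × x ~ u) → Grown (xs ++ L)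
  grown-++ [] g h = g
  grown-++ (x ∷ xs) g h = let u , u∈ , xu = h (here refl) in grow (∈-++⁺ʳ xs u∈) xu (grown-++ xs g (h ∘ there))

  module Cases (d : ℕ) (mindeg : ∀ v → d ≤ degree G v) (k : ℕ) (spine : Spine k) (dense : n + (40 * k + 20) ≤ 3 * d)
    (large : 30 * k + 20 ≤ d) where

    open Spine spine

    t : ℕ
    t = length U

    rest-of-graph : ∃ λ H → U ++ H ↭ vertices
    rest-of-graph = unique-subset uniq (λ {y} _ → ∈-vertices y)

    H : List V
    H = proj₁ rest-of-graph

    all : U ++ H ↭ vertices
    all = proj₂ rest-of-graph

    uniqUH : Unique (U ++ H)
    uniqUH = unique-↭ (↭-sym all) vertices-unique

    uniqH : Unique H
    uniqH = unique-drop U uniqUH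

    size : n ≡ t + length H
    size = order U H all

    δ : ℕ
    δ = d ∸ t

    δ+t : d ≡ δ + t
    δ+t = sym (m∸n+n≡m (linarith 3 (λ t k d → t :≤ 10 :* k :+ con 1 ⇒ 30 :* k :+ con 20 :≤ d ⇒ ⊢ t :≤ d) t k d small large))

    degH : ∀ v → δ ≤ cnt (adj G v) H
    degH v = linarith 5 (λ d δ t a b → d :≡ δ :+ t ⇒ d :≤ a :+ b ⇒ a :≤ t ⇒ ⊢ δ :≤ b) d δ t (cnt (adj G v) U) (cnt (adj G v) H)
      δ+t (≤-trans (mindeg v) (≤-reflexive (degree-parts v U H all))) (cnt≤length (adj G v) U)

    denseH : length H + 6 ≤ 3 * δ
    denseH = linarith 6 (λ n t h d δ k → n :≡ t :+ h ⇒ d :≡ δ :+ t ⇒ t :≤ 10 :* k :+ con 1 ⇒ n :+ (40 :* k :+ con 20) :≤ 3 :* d ⇒ ⊢ h :+ con 6 :≤ 3 :* δ)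
      n t (length H) d δ k size δ+t small dense

    twoH : TwoConnected H
    twoH x f y z y∈H z∈H y≢x z≢x fy fz =
      let u , w , u∉ , w∉ , fu , fw , uw = connected x f y z (off y∈H y≢x) (off z∈H z≢x) fy fz
      in u , w , inH u∉ , inH w∉ , (λ e → u∉ (here e)) , (λ e → w∉ (here e)) , fu , fw , uw
      where
      off : ∀ {y} → y ∈ H → y ≢ x → y ∉ x ∷ U
      off y∈H y≢x (here e) = y≢x e
      off y∈H y≢x (there h) = unique-apart U H uniqUH ↭-refl h y∈H refl
      inH : ∀ {u} → u ∉ x ∷ U → u ∈ H
      inH {u} u∉ with ∈-++⁻ U (∈-↭ (↭-sym all) (∈-vertices u))
      ... | inj₁ h = ⊥-elim (u∉ (there h))
      ... | inj₂ h = h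

    open Structure uniqH δ degH denseH twoH

    δ-large : 20 * k + 19 ≤ δ
    δ-large = linarith 4 (λ d δ t k → d :≡ δ :+ t ⇒ t :≤ 10 :* k :+ con 1 ⇒ 30 :* k :+ con 20 :≤ d ⇒ ⊢ 20 :* k :+ con 19 :≤ δ) d δ t k δ+t small large

    two≤t : V → 2 ≤ t
    two≤t v = let u , u∈ , _ = dominating v ; u′ , u′∈ , uu′ = dominating u in
      unique-length (u ∷ u′ ∷ []) (((λ e → ~-irrefl (subst (u ~_) (sym e) uu′)) ∷ []) ∷ [] ∷ []) λ { (here refl) → u∈ ; (there (here refl)) → u′∈ }
      where
      unique-length : ∀ ys → Unique ys → (∀ {y} → y ∈ ys → y ∈ U) → length ys ≤ t
      unique-length ys uq h with unique-subset uq h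
      ... | R , e = ≤-trans (m≤m+n (length ys) (length R)) (≤-reflexive (sym (length-↭-++ ys R (↭-sym e))))

    first-cycle : V → ∃₂ λ C R → C ++ R ↭ H × Cyc C
    first-cycle v =
      let a , H₁ , e₁ , _ = pick (adj G v) H (≤-trans (≤-trans (s≤s z≤n) (m≤n+m 19 (20 * k))) (≤-trans δ-large (degH v)))
          b , _ , e₂ , ab = pick (adj G a) H (≤-trans (≤-trans (s≤s z≤n) (m≤n+m 19 (20 * k))) (≤-trans δ-large (degH a)))
          R , e = pair-pick (∈-↭ (↭-sym e₁) (here refl)) (∈-↭ (↭-sym e₂) (here refl)) ab
      in a ∷ b ∷ [] , R , e , a , b , ab ∷ [-] , ~-sym ab

    -- `U` is served first, its vertices having at least `δ - length R` neighbours on the cycle. A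
    -- vertex of `R` has all its neighbours in `H` on the cycle and retains at least `δ - 2t` of
    -- them, enough for `2 * length R`.
    module Few {C R} (l : Longest H C R) (few : 2 * (length R + t) ≤ δ) (v : V) where

      open Longest l

      sizeH : length H ≡ length C + length R
      sizeH = length-↭-++ C R (↭-sym perm)

      U-stars : ∃₂ λ ls L′ → Stars U ls × ls ++ L′ ↭ C
      U-stars = stars-exist U C λ {u} u∈ → linarith 6
        (λ d δ t r c a → d :≡ δ :+ t ⇒ 2 :* (r :+ t) :≤ δ ⇒ δ :≤ c :+ a ⇒ a :≤ r ⇒ ⊢ 2 :* t :≤ c)
        d δ t (length R) (cnt (adj G u) C) (cnt (adj G u) R) δ+t few
        (≤-trans (degH u) (≤-reflexive (cnt-↭-++ (adj G u) C R (↭-sym perm)))) (cnt≤length (adj G u) R)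

      R-none : ∀ {r} → r ∈ R → cnt (adj G r) R ≡ 0
      R-none r∈R = cnt-none R λ w∈R → non-adjacent (off-independent l r∈R w∈R)

      halin : HasSpanningGenHalin G
      halin =
        let ls , L , S , e = U-stars
            ls′ , L′ , S′ , e′ = stars-exist R L λ {r} r∈ → linarith 7
              (λ δ t r c b a l → 2 :* (r :+ t) :≤ δ ⇒ δ :≤ c :+ b ⇒ b :≡ con 0 ⇒ c :≤ l :+ a ⇒ l :≤ 2 :* t ⇒ ⊢ 2 :* r :≤ a)
              δ t (length R) (cnt (adj G r) C) (cnt (adj G r) R) (cnt (adj G r) L) (length ls) few
              (≤-trans (degH r) (≤-reflexive (cnt-↭-++ (adj G r) C R (↭-sym perm)))) (R-none r∈)
              (≤-trans (≤-reflexive (cnt-↭-++ (adj G r) ls L (↭-sym e))) (+-monoˡ-≤ _ (cnt≤length (adj G r) ls)))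
              (≤-reflexive (stars-length S))
        in Assembled.halin (grown-++ R grown (λ {x} _ → dominating x))
          (permute 5 (λ R U C H V → U ⊕ H ≋ V ⇒ₚ C ⊕ R ≋ H ⇒ₚ ⊢ₚ (R ⊕ U) ⊕ C ≋ V) R U C H vertices all perm)
          (≤-trans (two≤t v) (≤-trans (m≤n+m t (length R)) (≤-reflexive (sym (length-++ R)))))
          cyc
          (linarith 6 (λ c r h δ t k → h :≡ c :+ r ⇒ 2 :* (r :+ t) :≤ δ ⇒ δ :≤ h ⇒ 20 :* k :+ con 19 :≤ δ ⇒ ⊢ con 3 :≤ c)
            (length C) (length R) (length H) δ t k sizeH few (≤-trans (degH v) (cnt≤length (adj G v) H)) δ-large)
          (stars-++ S S′) (↭ₚ.++-comm U R)
          (permute 5 (λ ls L ls′ L′ C → ls ⊕ L ≋ C ⇒ₚ ls′ ⊕ L′ ≋ L ⇒ₚ ⊢ₚ (ls ⊕ ls′) ⊕ L′ ≋ C) ls L ls′ L′ C e e′)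
          (λ {c} _ → let u , u∈ , cu = dominating c in u , ∈-++⁺ʳ R u∈ , cu)

    -- The term 50k + 5 is the bound 5(10k + 1) for `5t`: the estimate of `independent-set` with
    -- `δ < 2 * (length R + t)`, rewritten by `δ = d - t` and `length H = n - t`.
    Extremal : Set
    Extremal = ∃₂ λ I J → I ++ J ↭ vertices × (∀ {v w} → v ∈ I → w ∈ I → v ~ w → ⊥) × length J + 4 * d ≤ 2 * n + 1 + (50 * k + 5)

    dichotomy : V → HasSpanningGenHalin G ⊎ Extremal
    dichotomy v =
      let C₀ , R₀ , e₀ , c₀ = first-cycle v
          C , R , l = longest-cycle e₀ c₀
      in by l (≤-<-connex (2 * (length R + t)) δ)
      where
      by : ∀ {C R} → Longest H C R → 2 * (length R + t) ≤ δ ⊎ δ < 2 * (length R + t) → HasSpanningGenHalin G ⊎ Extremal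
      by l (inj₁ few) = inj₁ (Few.halin l few v)
      by {C} {[]} l (inj₂ many) = ⊥-elim (linarith 3 (λ δ t k → δ :< 2 :* t ⇒ t :≤ 10 :* k :+ con 1 ⇒ 20 :* k :+ con 19 :≤ δ ⇒ ⊢ :⊥)
        δ t k many small δ-large)
      by {C} {r ∷ R} l (inj₂ many) =
        let I , rest , e , indep , size-I = independent-set l (here refl)
        in inj₂ (I , rest ++ U , permute 5 (λ I rest U H V → I ⊕ rest ≋ H ⇒ₚ U ⊕ H ≋ V ⇒ₚ ⊢ₚ I ⊕ rest ⊕ U ≋ V) I rest U H vertices e all ,
          indep , linarith 10 (λ n d δ t k i r h q j → n :≡ t :+ h ⇒ d :≡ δ :+ t ⇒ t :≤ 10 :* k :+ con 1 ⇒ δ :< 2 :* (r :+ t) ⇒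
              3 :* δ :+ 2 :* r :≤ i :+ h :+ con 2 ⇒ h :≡ i :+ q ⇒ j :≡ q :+ t ⇒ ⊢ j :+ 4 :* d :≤ 2 :* n :+ con 1 :+ (50 :* k :+ con 5))
            n d δ t k (length I) (suc (length R)) (length H) (length rest) (length (rest ++ U))
            size δ+t small many size-I (length-↭-++ I rest (↭-sym e)) (length-++ rest))

-- Alternating cycles in almost complete bipartite graphs

module Weaves {n : ℕ} (G : Graph n) where

  open Paths G
  open LongestCycles G
  open IndependentSets G
  open DominatingTrees G
  open Separators G
  open Assemblies G
  open Dichotomy G

  miss : V → List V → ℕ
  miss v L = cnt (λ w → not (adj G v w)) L

  miss-eq : ∀ v L → cnt (adj G v) L + miss v L ≡ length L
  miss-eq v L = cnt-not (adj G v) L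

  miss-flip : ∀ v L → miss v L ≡ cnt (λ w → not (adj G w v)) L
  miss-flip v [] = refl
  miss-flip v (w ∷ L) = cong₂ _+_ (cong (λ b → 𝟙 (not b)) (adj-sym G v w)) (miss-flip v L)

  miss-part : ∀ v {L} xs ys → L ↭ xs ++ ys → miss v ys ≤ miss v L
  miss-part v xs ys e = ≤-trans (m≤n+m (miss v ys) (miss v xs)) (≤-reflexive (sym (cnt-↭-++ _ xs ys e)))

  -- A cycle alternating between Y ++ Z and part of I, where Y is small, each vertex of Z misses at most a
  -- tenth (ι / 10) of I, and each vertex of I misses at most S vertices of Z.  In the process each vertex of Y
  -- gets a neighbour in a set K ⊆ I off the cycle.
  module Weaving (Y Z I : List V) (ι S : ℕ) (rich : ∀ {z} → z ∈ Z → 10 * miss z I ≤ ι)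
    (medium : ∀ {y} → y ∈ Y → 40 * S + 19 ≤ cnt (adj G y) I) (missI : ∀ {i} → i ∈ I → miss i Z ≤ S)
    (smallY : length Y ≤ 10 * S) (largeZ : 21 * S + 10 ≤ length Z) (sizeI : length I + 1 ≡ ι)
    (room : 5 * (length Y + length Z + (10 * S + 1)) < 4 * ι) where

    -- A path under construction with both ends in `Z`. `Ya` and `Za` are still to be visited, `Ia`
    -- is free, and `K` holds one neighbour off the path for each vertex of `Y` already visited.
    record Partial (Ya Za : List V) : Set where
      field
        {a b}     : V
        P IP JP K Ia ZP : List V
        path    : Path a P b
        a∈Z     : a ∈ Z
        b∈Z     : b ∈ Z
        P↭      : P ↭ IP ++ JP
        I↭      : I ↭ (IP ++ K) ++ Ia
        J↭      : Y ++ Z ↭ JP ++ Ya ++ Za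
        Z↭      : Z ↭ ZP ++ Za
        balance : length JP ≡ 1 + length IP
        sizeK   : length K + length Ya ≡ length Y
        cover   : ∀ {y} → y ∈ Y → y ∈ Ya ⊎ ∃ λ κ → κ ∈ K × y ~ κ

    -- Two vertices of `Z` together miss at most a fifth of `ι` vertices of `I`, and more than a
    -- fifth is still free.
    bridge : ∀ IX Ia → I ↭ IX ++ Ia → ι < 5 * length Ia → ∀ {a z} → a ∈ Z → z ∈ Z → ∃₂ λ i I′ → Ia ↭ i ∷ I′ × a ~ i × z ~ i
    bridge IX Ia e lt {a} {z} a∈ z∈ =
      let i , I′ , p , q = pick (λ w → adj G a w ∧ adj G z w) Ia (linarith 9
            (λ l c c′ m m′ M M′ ι o → ι :< 5 :* l ⇒ c :+ m :≡ l ⇒ c′ :+ m′ :≡ l ⇒ m :≤ M ⇒ m′ :≤ M′ ⇒ 10 :* M :≤ ι ⇒ 10 :* M′ :≤ ι ⇒ c :+ c′ :≤ l :+ o ⇒ ⊢ con 1 :≤ o)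
            (length Ia) (cnt (adj G a) Ia) (cnt (adj G z) Ia) (miss a Ia) (miss z Ia) (miss a I) (miss z I) ι _
            lt (miss-eq a Ia) (miss-eq z Ia) (miss-part a IX Ia e) (miss-part z IX Ia e) (rich a∈) (rich z∈) (cnt-both (adj G a) (adj G z) Ia))
          ai , zi = ∧-true (adj G a i) q
      in i , I′ , p , ai , zi

    sizes : ∀ {Ya Za} (p : Partial Ya Za) → let open Partial p in
      length I ≡ length IP + length K + length Ia × length Y + length Z ≡ length JP + (length Ya + length Za)
    sizes {Ya} {Za} p = trans (length-↭-++ (IP ++ K) Ia I↭) (cong (_+ length Ia) (length-++ IP)) ,
      trans (sym (length-++ Y)) (trans (length-↭-++ JP (Ya ++ Za) J↭) (cong (length JP +_) (length-++ Ya)))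
      where open Partial p

    -- The path uses `I` and `Y ++ Z` evenly and `K` never outgrows `Y`. So by `room` the free part
    -- of `I` exceeds the rest of `Z` by more than a fifth of `ι` at every stage.
    roomy : ∀ {Ya Za} (p : Partial Ya Za) → let open Partial p in ι + 5 * length Za < 5 * length Ia
    roomy {Ya} {Za} p = linarith 11 (λ i ip k ia y z jp ya za ι S → i :≡ ip :+ k :+ ia ⇒ y :+ z :≡ jp :+ (ya :+ za) ⇒ i :+ con 1 :≡ ι ⇒ jp :≡ con 1 :+ ip ⇒ k :+ ya :≡ y ⇒
        y :≤ 10 :* S ⇒ 5 :* (y :+ z :+ (10 :* S :+ con 1)) :< 4 :* ι ⇒ ⊢ ι :+ 5 :* za :< 5 :* ia)
      (length I) (length IP) (length K) (length Ia) (length Y) (length Z) (length JP) (length Ya) (length Za) ι S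
      (proj₁ (sizes p)) (proj₂ (sizes p)) sizeI balance sizeK smallY room
      where open Partial p

    add-rich : ∀ {z Za} → Partial [] (z ∷ Za) → Partial [] Za
    add-rich {z} {Za} p =
      let open Partial p
          z∈Z = ∈-↭ (↭-sym Z↭) (∈-++⁺ʳ ZP (here refl))
          i , I′ , e , ai , zi = bridge (IP ++ K) Ia I↭ (≤-trans (s≤s (m≤m+n ι _)) (roomy p)) a∈Z z∈Z
      in record
        { P = z ∷ i ∷ P ; IP = i ∷ IP ; JP = z ∷ JP ; K = K ; Ia = I′ ; ZP = ZP ++ z ∷ []
        ; path = zi ∷ ~-sym ai ∷ path ; a∈Z = z∈Z ; b∈Z = b∈Z
        ; P↭ = permute 5 (λ z i P IP JP → P ≋ IP ⊕ JP ⇒ₚ ⊢ₚ z ⊕ i ⊕ P ≋ (i ⊕ IP) ⊕ z ⊕ JP) (z ∷ []) (i ∷ []) P IP JP P↭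
        ; I↭ = permute 6 (λ I IP K Ia i I′ → I ≋ (IP ⊕ K) ⊕ Ia ⇒ₚ Ia ≋ i ⊕ I′ ⇒ₚ ⊢ₚ I ≋ ((i ⊕ IP) ⊕ K) ⊕ I′) I IP K Ia (i ∷ []) I′ I↭ e
        ; J↭ = permute 4 (λ J JP z Za → J ≋ JP ⊕ z ⊕ Za ⇒ₚ ⊢ₚ J ≋ (z ⊕ JP) ⊕ Za) (Y ++ Z) JP (z ∷ []) Za J↭
        ; Z↭ = permute 4 (λ Z ZP z Za → Z ≋ ZP ⊕ z ⊕ Za ⇒ₚ ⊢ₚ Z ≋ (ZP ⊕ z) ⊕ Za) Z ZP (z ∷ []) Za Z↭
        ; balance = cong suc balance ; sizeK = sizeK ; cover = cover }

    add-all : ∀ Za → Partial [] Za → Partial [] []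
    add-all [] p = p
    add-all (z ∷ Za) p = add-all Za (add-rich p)

    -- The vertices `z₂ i₂ y i₁ z₁ i₀` are put in front of the path, whose end is then rich again,
    -- and `i₃` goes to `K`. This consumes four vertices of `I` and two of `Z`, at most `40 * S` and
    -- `20 * S` over all of `Y`; hence the thresholds `40 * S + 19` and `21 * S + 10`.
    add-medium : ∀ {y Ya Za} (p : Partial (y ∷ Ya) Za) → y ∈ Y → let open Partial p in
      length IP + length K ≤ 40 * S → S + 3 ≤ length Za →
      ∃ λ Za′ → Σ (Partial Ya Za′) λ p′ → length (Partial.IP p′) + length (Partial.K p′) ≡ 4 + (length IP + length K) × length Za ≡ 2 + length Za′
    add-medium {y} {Ya} {Za} p y∈Y few many =
      case pick (adj G y) Ia (≤-trans (s≤s z≤n) avail) of λ { (i₁ , I₁ , e₁ , yi₁) →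
      case pick (adj G y) I₁ (≤-trans (s≤s z≤n) (fewer e₁ avail)) of λ { (i₂ , I₂ , e₂ , yi₂) →
      case pick (adj G y) I₂ (fewer e₂ (fewer e₁ avail)) of λ { (i₃ , I₃ , e₃ , yi₃) →
      case pick (adj G i₁) Za (≤-trans (s≤s z≤n) (seen (member (↭-trans e₁ (prep i₁ (↭-trans e₂ (prep i₂ e₃)))) (here refl)))) of λ { (z₁ , Z₁ , f₁ , iz₁) →
      case pick (adj G i₂) Z₁ (fewer f₁ (seen (member (↭-trans e₁ (prep i₁ (↭-trans e₂ (prep i₂ e₃)))) (there (here refl))))) of λ { (z₂ , Z₂ , f₂ , iz₂) →
        finish e₁ e₂ e₃ f₁ f₂ yi₁ yi₂ yi₃ iz₁ iz₂ } } } } }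
      where
      open Partial p
      avail : 3 ≤ cnt (adj G y) Ia
      avail = linarith 6 (λ S i x a ip k → 40 :* S :+ con 19 :≤ i ⇒ i :≡ x :+ a ⇒ x :≤ ip :+ k ⇒ ip :+ k :≤ 40 :* S ⇒ ⊢ con 3 :≤ a)
        S (cnt (adj G y) I) (cnt (adj G y) (IP ++ K)) (cnt (adj G y) Ia) (length IP) (length K) (medium y∈Y) (cnt-↭-++ (adj G y) (IP ++ K) Ia I↭)
        (≤-trans (cnt≤length (adj G y) (IP ++ K)) (≤-reflexive (length-++ IP))) few
      fewer : ∀ {P : V → Bool} {x xs ys k} → xs ↭ x ∷ ys → suc k ≤ cnt P xs → k ≤ cnt P ys
      fewer {P} e le = ≤-pred (≤-trans le (cnt-pop P e))
      member : ∀ {i L} → Ia ↭ L → i ∈ L → i ∈ I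
      member e m = ∈-↭ (↭-sym I↭) (∈-++⁺ʳ (IP ++ K) (∈-↭ (↭-sym e) m))
      seen : ∀ {i} → i ∈ I → 2 ≤ cnt (adj G i) Za
      seen {i} i∈I = linarith 5 (λ S c m M z → S :+ con 3 :≤ z ⇒ c :+ m :≡ z ⇒ m :≤ M ⇒ M :≤ S ⇒ ⊢ con 2 :≤ c)
        S (cnt (adj G i) Za) (miss i Za) (miss i Z) (length Za) many (miss-eq i Za) (miss-part i ZP Za Z↭) (missI i∈I)
      finish : ∀ {i₁ I₁ i₂ I₂ i₃ I₃ z₁ Z₁ z₂ Z₂} → Ia ↭ i₁ ∷ I₁ → I₁ ↭ i₂ ∷ I₂ → I₂ ↭ i₃ ∷ I₃ → Za ↭ z₁ ∷ Z₁ → Z₁ ↭ z₂ ∷ Z₂ →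
        y ~ i₁ → y ~ i₂ → y ~ i₃ → i₁ ~ z₁ → i₂ ~ z₂ →
        ∃ λ Za′ → Σ (Partial Ya Za′) λ p′ → length (Partial.IP p′) + length (Partial.K p′) ≡ 4 + (length IP + length K) × length Za ≡ 2 + length Za′
      finish {i₁} {I₁} {i₂} {I₂} {i₃} {I₃} {z₁} {Z₁} {z₂} {Z₂} e₁ e₂ e₃ f₁ f₂ yi₁ yi₂ yi₃ iz₁ iz₂ =
        case bridge (IP ++ K ++ i₁ ∷ i₂ ∷ i₃ ∷ []) I₃ I↭₃
            (linarith 5 (λ ι za ia i₃ S → ι :+ 5 :* za :< 5 :* ia ⇒ ia :≡ con 3 :+ i₃ ⇒ S :+ con 3 :≤ za ⇒ ⊢ ι :< 5 :* i₃)
              ι (length Za) (length Ia) (length I₃) S (roomy p) (↭ₚ.↭-length (↭-trans e₁ (prep i₁ (↭-trans e₂ (prep i₂ e₃))))) many) a∈Z z₁∈Z of λ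
          { (i₀ , I₄ , e₄ , ai₀ , zi₀) → Z₂ , record
            { P = z₂ ∷ i₂ ∷ y ∷ i₁ ∷ z₁ ∷ i₀ ∷ P ; IP = i₂ ∷ i₁ ∷ i₀ ∷ IP ; JP = z₂ ∷ y ∷ z₁ ∷ JP ; K = i₃ ∷ K ; Ia = I₄ ; ZP = z₂ ∷ z₁ ∷ ZP
            ; path = ~-sym iz₂ ∷ ~-sym yi₂ ∷ yi₁ ∷ iz₁ ∷ zi₀ ∷ ~-sym ai₀ ∷ path ; a∈Z = z₂∈Z ; b∈Z = b∈Z
            ; P↭ = permute 9 (λ z₂ i₂ y i₁ z₁ i₀ P IP JP → P ≋ IP ⊕ JP ⇒ₚ ⊢ₚ z₂ ⊕ i₂ ⊕ y ⊕ i₁ ⊕ z₁ ⊕ i₀ ⊕ P ≋ (i₂ ⊕ i₁ ⊕ i₀ ⊕ IP) ⊕ z₂ ⊕ y ⊕ z₁ ⊕ JP)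
                (z₂ ∷ []) (i₂ ∷ []) (y ∷ []) (i₁ ∷ []) (z₁ ∷ []) (i₀ ∷ []) P IP JP P↭
            ; I↭ = permute 9 (λ I IP K i₁ i₂ i₃ I₃ i₀ I₄ → I ≋ (IP ⊕ K ⊕ i₁ ⊕ i₂ ⊕ i₃) ⊕ I₃ ⇒ₚ I₃ ≋ i₀ ⊕ I₄ ⇒ₚ ⊢ₚ I ≋ ((i₂ ⊕ i₁ ⊕ i₀ ⊕ IP) ⊕ i₃ ⊕ K) ⊕ I₄)
                I IP K (i₁ ∷ []) (i₂ ∷ []) (i₃ ∷ []) I₃ (i₀ ∷ []) I₄ I↭₃ e₄
            ; J↭ = permute 9 (λ J JP y Ya Za z₁ Z₁ z₂ Z₂ → J ≋ JP ⊕ (y ⊕ Ya) ⊕ Za ⇒ₚ Za ≋ z₁ ⊕ Z₁ ⇒ₚ Z₁ ≋ z₂ ⊕ Z₂ ⇒ₚ ⊢ₚ J ≋ (z₂ ⊕ y ⊕ z₁ ⊕ JP) ⊕ Ya ⊕ Z₂)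
                (Y ++ Z) JP (y ∷ []) Ya Za (z₁ ∷ []) Z₁ (z₂ ∷ []) Z₂ J↭ f₁ f₂
            ; Z↭ = permute 7 (λ Z ZP Za z₁ Z₁ z₂ Z₂ → Z ≋ ZP ⊕ Za ⇒ₚ Za ≋ z₁ ⊕ Z₁ ⇒ₚ Z₁ ≋ z₂ ⊕ Z₂ ⇒ₚ ⊢ₚ Z ≋ (z₂ ⊕ z₁ ⊕ ZP) ⊕ Z₂)
                Z ZP Za (z₁ ∷ []) Z₁ (z₂ ∷ []) Z₂ Z↭ f₁ f₂
            ; balance = cong (3 +_) balance
            ; sizeK = trans (sym (+-suc (length K) (length Ya))) sizeK
            ; cover = λ m → case cover m of λ
                { (inj₁ (here refl)) → inj₂ (i₃ , here refl , yi₃)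
                ; (inj₁ (there h)) → inj₁ h
                ; (inj₂ (κ , κ∈ , yκ)) → inj₂ (κ , there κ∈ , yκ) }
            } , cong (3 +_) (+-suc (length IP) (length K)) , sizeZa }
        where
        I↭₃ : I ↭ (IP ++ K ++ i₁ ∷ i₂ ∷ i₃ ∷ []) ++ I₃
        I↭₃ = permute 10 (λ I IP K Ia i₁ I₁ i₂ I₂ i₃ I₃ → I ≋ (IP ⊕ K) ⊕ Ia ⇒ₚ Ia ≋ i₁ ⊕ I₁ ⇒ₚ I₁ ≋ i₂ ⊕ I₂ ⇒ₚ I₂ ≋ i₃ ⊕ I₃ ⇒ₚ
          ⊢ₚ I ≋ (IP ⊕ K ⊕ i₁ ⊕ i₂ ⊕ i₃) ⊕ I₃) I IP K Ia (i₁ ∷ []) I₁ (i₂ ∷ []) I₂ (i₃ ∷ []) I₃ I↭ e₁ e₂ e₃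
        z₁∈Z : z₁ ∈ Z
        z₁∈Z = ∈-↭ (↭-sym Z↭) (∈-++⁺ʳ ZP (∈-↭ (↭-sym f₁) (here refl)))
        z₂∈Z : z₂ ∈ Z
        z₂∈Z = ∈-↭ (↭-sym Z↭) (∈-++⁺ʳ ZP (∈-↭ (↭-sym f₁) (there (∈-↭ (↭-sym f₂) (here refl)))))
        sizeZa : length Za ≡ 2 + length Z₂
        sizeZa = ↭ₚ.↭-length (↭-trans f₁ (prep z₁ f₂))

    -- `Y` is treated before the bulk of `Z`, while at most `40 * S` vertices of `I` are in use: its
    -- vertices may have hardly more neighbours than that.
    add-mediums : ∀ Ya Za (p : Partial Ya Za) → (∀ {y} → y ∈ Ya → y ∈ Y) → let open Partial p in
      length IP + length K + 4 * length Ya ≤ 4 * length Y → length Z + 2 * length Ya ≡ length Za + 1 + 2 * length Y → ∃ λ Za′ → Partial [] Za′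
    add-mediums [] Za p _ _ _ = Za , p
    add-mediums (y ∷ Ya) Za p sub e e′ =
      let open Partial p
          Za′ , p′ , f , f′ = add-medium p (sub (here refl))
            (linarith 4 (λ u m y S → u :+ 4 :* (con 1 :+ m) :≤ 4 :* y ⇒ y :≤ 10 :* S ⇒ ⊢ u :≤ 40 :* S) (length IP + length K) (length Ya) (length Y) S e smallY)
            (linarith 5 (λ z m za y S → z :+ 2 :* (con 1 :+ m) :≡ za :+ con 1 :+ 2 :* y ⇒ y :≤ 10 :* S ⇒ 21 :* S :+ con 10 :≤ z ⇒ ⊢ S :+ con 3 :≤ za)
              (length Z) (length Ya) (length Za) (length Y) S e′ smallY largeZ)
      in add-mediums Ya Za′ p′ (sub ∘ there)
        (linarith 4 (λ u u′ m y → u′ :≡ con 4 :+ u ⇒ u :+ 4 :* (con 1 :+ m) :≤ 4 :* y ⇒ ⊢ u′ :+ 4 :* m :≤ 4 :* y)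
          (length IP + length K) (length (Partial.IP p′) + length (Partial.K p′)) (length Ya) (length Y) f e)
        (linarith 5 (λ z m za za′ y → z :+ 2 :* (con 1 :+ m) :≡ za :+ con 1 :+ 2 :* y ⇒ za :≡ con 2 :+ za′ ⇒ ⊢ z :+ 2 :* m :≡ za′ :+ con 1 :+ 2 :* y)
          (length Z) (length Ya) (length Za) (length Za′) (length Y) e′ f′)

    record Woven : Set where
      field
        C IC K Ia : List V
        cyc     : Cyc C
        C↭      : C ↭ IC ++ Y ++ Z
        I↭      : I ↭ IC ++ K ++ Ia
        balance : length IC ≡ length (Y ++ Z)
        cover   : ∀ {y} → y ∈ Y → ∃ λ κ → κ ∈ K × y ~ κ

    start-path : ∀ {z Z′} → Z ↭ z ∷ Z′ → Partial Y Z′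
    start-path {z} {Z′} e = record
      { P = z ∷ [] ; IP = [] ; JP = z ∷ [] ; K = [] ; Ia = I ; ZP = z ∷ [] ; path = [-] ; a∈Z = z∈Z ; b∈Z = z∈Z
      ; P↭ = ↭-refl ; I↭ = ↭-refl ; Z↭ = e
      ; J↭ = permute 4 (λ Y Z z Z′ → Z ≋ z ⊕ Z′ ⇒ₚ ⊢ₚ Y ⊕ Z ≋ z ⊕ Y ⊕ Z′) Y Z (z ∷ []) Z′ e
      ; balance = refl ; sizeK = refl ; cover = inj₁ }
      where
      z∈Z : z ∈ Z
      z∈Z = ∈-↭ (↭-sym e) (here refl)

    close : Partial [] [] → Woven
    close p =
      let open Partial p
          i , I′ , e , ai , bi = bridge (IP ++ K) Ia I↭ (≤-trans (s≤s (m≤m+n ι _)) (roomy p)) a∈Z b∈Z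
      in record
        { C = i ∷ P ; IC = i ∷ IP ; K = K ; Ia = I′ ; cyc = _ , _ , ~-sym ai ∷ path , bi
        ; C↭ = permute 5 (λ i P IP JP J → P ≋ IP ⊕ JP ⇒ₚ JP ≋ J ⇒ₚ ⊢ₚ i ⊕ P ≋ (i ⊕ IP) ⊕ J) (i ∷ []) P IP JP (Y ++ Z) P↭ (JP↭ J↭)
        ; I↭ = permute 6 (λ I IP K Ia i I′ → I ≋ (IP ⊕ K) ⊕ Ia ⇒ₚ Ia ≋ i ⊕ I′ ⇒ₚ ⊢ₚ I ≋ (i ⊕ IP) ⊕ K ⊕ I′) I IP K Ia (i ∷ []) I′ I↭ e
        ; balance = trans (sym balance) (↭ₚ.↭-length (JP↭ J↭))
        ; cover = λ m → case cover m of λ { (inj₂ h) → h } }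
      where
      JP↭ : ∀ {JP} → Y ++ Z ↭ JP ++ [] → JP ↭ Y ++ Z
      JP↭ {JP} e = ↭-sym (↭-trans e (↭-reflexive (++-identityʳ JP)))

    woven : Woven
    woven =
      let z , Z′ , e , _ = pick (λ _ → true) Z (≤-trans (≤-trans (s≤s z≤n) (m≤n+m 10 (21 * S))) (≤-trans largeZ (≤-reflexive (sym (cnt-all Z λ _ → refl)))))
          Za , p = add-mediums Y Z′ (start-path e) (λ h → h) ≤-refl
            (linarith 3 (λ z z′ y → z :≡ con 1 :+ z′ ⇒ ⊢ z :+ 2 :* y :≡ z′ :+ con 1 :+ 2 :* y) (length Z) (length Z′) (length Y) (↭ₚ.↭-length e))
      in close (add-all Za p)

-- The almost complete bipartite case

module ExtremalCase {n : ℕ} (G : Graph n) where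

  open Paths G
  open LongestCycles G
  open IndependentSets G
  open DominatingTrees G
  open Separators G
  open Assemblies G
  open Dichotomy G
  open Weaves G

  cnt-any : ∀ {A B : Set} (R : A → B → Bool) ys xs → cnt (λ x → anyᵇ (R x) ys) xs ≤ total (λ y → cnt (λ x → R x y) xs) ys
  cnt-any R [] xs = ≤-reflexive (cnt-none xs λ _ → refl)
  cnt-any R (y ∷ ys) xs = ≤-trans (cnt-or {Q = λ x → R x y} {R = λ x → anyᵇ (R x) ys} xs (λ {x} _ h e → subst (λ b → b ∨ anyᵇ (R x) ys ≡ true) e h))
    (+-monoʳ-≤ _ (cnt-any R ys xs))

  take-some : ∀ {A : Set} h (xs : List A) → h ≤ length xs → ∃₂ λ ys zs → ys ++ zs ≡ xs × length ys ≡ h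
  take-some zero xs _ = [] , xs , refl , refl
  take-some (suc h) (x ∷ xs) (s≤s le) = let ys , zs , e , l = take-some h xs le in x ∷ ys , zs , cong (x ∷_) e , cong suc l

  module Extreme (d : ℕ) (mindeg : ∀ v → d ≤ degree G v) (I J : List V) (all : I ++ J ↭ vertices)
    (indep : ∀ {v w} → v ∈ I → w ∈ I → v ~ w → ⊥) (s S : ℕ) (sizeJ : length J ≡ d + s) (tight : 2 * n + 3 ≤ 5 * d)
    (upper : 5 * d + s ≤ 2 * n + 1 + S) where

    -- `θ` separates the poor vertices of `J` from the medium ones, `B` bounds the number of
    -- vertices of `I` adjacent to a poor one, and `M` the number of vertices of `Z` that are unfit
    -- to be hubs.
    θ B M : ℕ
    θ = 40 * S + 20
    B = θ * (10 * S)
    M = (S + θ) * (B + (10 * S + 1))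

    size : n ≡ length I + length J
    size = order I J all

    s≤S : s ≤ S
    s≤S = linarith 4 (λ n d s S → 2 :* n :+ con 3 :≤ 5 :* d ⇒ 5 :* d :+ s :≤ 2 :* n :+ con 1 :+ S ⇒ ⊢ s :≤ S) n d s S tight upper

    module Big (big : M + 10 * B + 600 * S + 600 ≤ d) where

      big′ : 600 * S + 600 ≤ d
      big′ = linarith 4 (λ M B S d → M :+ 10 :* B :+ 600 :* S :+ con 600 :≤ d ⇒ ⊢ 600 :* S :+ con 600 :≤ d) M B S d big

      size′ : n ≡ length I + (d + s)
      size′ = trans size (cong (length I +_) sizeJ)

      I-upper : 2 * length I + 3 ≤ 3 * d
      I-upper = linarith 4 (λ n i d s → n :≡ i :+ (d :+ s) ⇒ 2 :* n :+ con 3 :≤ 5 :* d ⇒ ⊢ 2 :* i :+ con 3 :≤ 3 :* d) n (length I) d s size′ tight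

      I-lower : 3 * d ≤ 2 * length I + (2 * S + 1)
      I-lower = linarith 5 (λ n i d s S → n :≡ i :+ (d :+ s) ⇒ 5 :* d :+ s :≤ 2 :* n :+ con 1 :+ S ⇒ s :≤ S ⇒ ⊢ 3 :* d :≤ 2 :* i :+ (2 :* S :+ con 1))
        n (length I) d s S size′ upper s≤S

      I-large : d + S + B + 10 ≤ length I
      I-large = linarith 5 (λ i d S B M → 3 :* d :≤ 2 :* i :+ (2 :* S :+ con 1) ⇒ M :+ 10 :* B :+ 600 :* S :+ con 600 :≤ d ⇒ ⊢ d :+ S :+ B :+ con 10 :≤ i)
        (length I) d S B M I-lower big

      deg-I : ∀ {i} → i ∈ I → d ≤ cnt (adj G i) J
      deg-I {i} i∈I = ≤-trans (mindeg i) (≤-reflexive (independent-degree all indep i∈I))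

      miss-J : ∀ {i} → i ∈ I → miss i J ≤ s
      miss-J {i} i∈I = linarith 5 (λ d s c m j → d :≤ c ⇒ c :+ m :≡ j ⇒ j :≡ d :+ s ⇒ ⊢ m :≤ s) d s (cnt (adj G i) J) (miss i J) (length J)
        (deg-I i∈I) (miss-eq i J) sizeJ

      rich poor : V → Bool
      rich z = 10 * miss z I ≤ᵇ length I
      poor x = cnt (adj G x) I <ᵇ θ

      abstract
        split-rich : Split rich J
        split-rich = split rich J

      Z N′ : List V
      Z = Split.yeses split-rich
      N′ = Split.nos split-rich

      J↭₁ : J ↭ Z ++ N′
      J↭₁ = Split.partition split-rich

      ≡true⇒T : ∀ {b} → b ≡ true → T b
      ≡true⇒T refl = tt

      rich-Z : ∀ {z} → z ∈ Z → 10 * miss z I ≤ length I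
      rich-Z h = ≤ᵇ⇒≤ _ _ (≡true⇒T (Split.yes-true split-rich h))

      not-rich : ∀ {z} → z ∈ N′ → length I ≤ 10 * miss z I
      not-rich {z} h = <⇒≤ (≰⇒> λ le → subst T (Split.no-false split-rich h) (≤⇒≤ᵇ le))

      -- Each vertex of `I` has `d` neighbours among the `d + s` vertices of `J`, so at most
      -- `s * length I` pairs between `I` and `J` are non-adjacent, while a vertex that is not rich
      -- accounts for a tenth of `length I`.
      N′-small : length N′ ≤ 10 * S
      N′-small = ≤-trans (*-cancelʳ-≤ (length N′) (10 * s) (length I) {{>-nonZero (≤-trans (s≤s z≤n) I≥1)}}
          (≤-trans (≤-reflexive (*-comm (length N′) (length I)))
          (≤-trans (total-≥ (λ z → 10 * miss z I) (length I) N′ not-rich)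
          (≤-trans (≤-reflexive (total-scale 10 (λ z → miss z I) N′))
          (≤-trans (*-monoʳ-≤ 10 missing) (≤-reflexive (sym (*-assoc 10 s (length I)))))))))
        (*-monoʳ-≤ 10 s≤S)
        where
        I≥1 : 1 ≤ length I
        I≥1 = linarith 4 (λ d S B i → d :+ S :+ B :+ con 10 :≤ i ⇒ ⊢ con 1 :≤ i) d S B (length I) I-large
        missing : total (λ z → miss z I) N′ ≤ s * length I
        missing = ≤-trans (≤-reflexive (double-count (λ z i → not (adj G z i)) N′ I)) (total-≤ _ s I λ {i} i∈I →
          ≤-trans (≤-reflexive (sym (miss-flip i N′))) (≤-trans (≤-trans (m≤n+m (miss i N′) (miss i Z)) (≤-reflexive (sym (cnt-↭-++ _ Z N′ J↭₁)))) (miss-J i∈I)))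

      abstract
        split-poor : Split poor N′
        split-poor = split poor N′

      X Y : List V
      X = Split.yeses split-poor
      Y = Split.nos split-poor

      N′↭ : N′ ↭ X ++ Y
      N′↭ = Split.partition split-poor

      poor-X : ∀ {x} → x ∈ X → cnt (adj G x) I ≤ θ
      poor-X h = <⇒≤ (<ᵇ⇒< _ _ (≡true⇒T (Split.yes-true split-poor h)))

      medium-Y : ∀ {y} → y ∈ Y → θ ≤ cnt (adj G y) I
      medium-Y h = ≮⇒≥ λ lt → subst T (Split.no-false split-poor h) (<⇒<ᵇ lt)

      XY-small : length X + length Y ≤ 10 * S
      XY-small = ≤-trans (≤-reflexive (sym (length-↭-++ X Y N′↭))) N′-small

      J↭₂ : J ↭ Z ++ X ++ Y
      J↭₂ = ↭-trans J↭₁ (↭ₚ.++⁺ˡ Z N′↭)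

      sizeZ : d + s ≡ length Z + (length X + length Y)
      sizeZ = trans (sym sizeJ) (trans (length-↭-++ Z (X ++ Y) J↭₂) (cong (length Z +_) (length-++ X)))

      sees-X : V → Bool
      sees-X i = anyᵇ (adj G i) X

      abstract
        split-I : Split sees-X I
        split-I = split sees-X I

      W I′ : List V
      W = Split.yeses split-I
      I′ = Split.nos split-I

      I↭ : I ↭ W ++ I′
      I↭ = Split.partition split-I

      sees-small : cnt sees-X I ≤ B
      sees-small = ≤-trans (cnt-any (adj G) X I) (≤-trans (total-≤ _ θ X λ {x} h →
          ≤-trans (cnt-mono I (λ {w} _ e → ~-sym e)) (poor-X h))
        (*-monoʳ-≤ θ (≤-trans (m≤m+n (length X) (length Y)) XY-small)))

      W-small : length W ≤ B
      W-small = ≤-trans (≤-reflexive (Split.size-yes split-I)) sees-small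

      unseen : ∀ {i} → sees-X i ≡ false → cnt (adj G i) X ≡ 0
      unseen {i} e = cnt-none X (any-false (adj G i) X e)

      unseen-I′ : ∀ {i} → i ∈ I′ → sees-X i ≡ false
      unseen-I′ = Split.no-false split-I

      abstract
        root-exists : ∃₂ λ w I₀ → I′ ↭ w ∷ I₀
        root-exists = by I′ (linarith 7 (λ d S B i w i′ z → d :+ S :+ B :+ con 10 :≤ i ⇒ w :≤ B ⇒ i :≡ w :+ i′ ⇒ ⊢ con 1 :≤ i′)
            d S B (length I) (length W) (length I′) 0 I-large W-small (length-↭-++ W I′ I↭)) ↭-refl
          where
          by : ∀ L → 1 ≤ length L → I′ ↭ L → ∃₂ λ w I₀ → I′ ↭ w ∷ I₀
          by (w ∷ I₀) _ e = w , I₀ , e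

      r : V
      r = proj₁ root-exists

      I₀ : List V
      I₀ = W ++ proj₁ (proj₂ root-exists)

      I↭r : I ↭ r ∷ I₀
      I↭r = permute 5 (λ I W I′ r I₁ → I ≋ W ⊕ I′ ⇒ₚ I′ ≋ r ⊕ I₁ ⇒ₚ ⊢ₚ I ≋ r ⊕ W ⊕ I₁) I W I′ (r ∷ []) (proj₁ (proj₂ root-exists)) I↭ (proj₂ (proj₂ root-exists))

      r-unseen : sees-X r ≡ false
      r-unseen = unseen-I′ (∈-↭ (↭-sym (proj₂ (proj₂ root-exists))) (here refl))

      ∈I : ∀ {i} → i ∈ r ∷ I₀ → i ∈ I
      ∈I = ∈-↭ (↭-sym I↭r)

      cnt-J : ∀ P → cnt P J ≡ cnt P Z + (cnt P X + cnt P Y)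
      cnt-J P = trans (cnt-↭-++ P Z (X ++ Y) J↭₂) (cong (cnt P Z +_) (cnt-++ P X Y))

      -- The root sees no poor vertex, so `X` lies among the at most `s` vertices of `J` that `r`
      -- misses.
      p≤s : length X ≤ s
      p≤s = linarith 9 (λ d s z x y cz cx cy c → d :+ s :≡ z :+ (x :+ y) ⇒ d :≤ c ⇒ c :≡ cz :+ (cx :+ cy) ⇒ cx :≡ con 0 ⇒ cz :≤ z ⇒ cy :≤ y ⇒ ⊢ x :≤ s)
        d s (length Z) (length X) (length Y) (cnt (adj G r) Z) (cnt (adj G r) X) (cnt (adj G r) Y) (cnt (adj G r) J) sizeZ (deg-I (∈I (here refl)))
        (cnt-J (adj G r)) (unseen r-unseen) (cnt≤length (adj G r) Z) (cnt≤length (adj G r) Y)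

      -- The least number of hubs that leaves only `d - 1` vertices of `J` outside `X` and the hubs.
      h : ℕ
      h = suc (s ∸ length X)

      h-eq : h + length X ≡ s + 1
      h-eq = trans (cong suc (m∸n+n≡m p≤s)) (+-comm 1 s)

      targets : List V
      targets = r ∷ W ++ X

      good : V → Bool
      good z = not (anyᵇ (λ v → not (adj G z v)) targets)

      -- A poor vertex has at most `θ` neighbours in `I`, hence at least `d - θ` in `J` itself; so
      -- poor vertices, too, can hang on hubs.
      miss-target : ∀ {v} → v ∈ targets → cnt (λ z → not (adj G z v)) Z ≤ S + θ
      miss-target {v} v∈ = ≤-trans (≤-reflexive (sym (miss-flip v Z))) (≤-trans (≤-trans (m≤m+n (miss v Z) _) (≤-reflexive (sym (cnt-↭-++ _ Z (X ++ Y) J↭₂)))) (bound v∈))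
        where
        from-I : v ∈ I → miss v J ≤ S + θ
        from-I i∈ = ≤-trans (miss-J i∈) (≤-trans s≤S (m≤m+n S θ))
        bound : v ∈ targets → miss v J ≤ S + θ
        bound (here refl) = from-I (∈I (here refl))
        bound (there m) with ∈-++⁻ W m
        ... | inj₁ w∈ = from-I (∈-↭ (↭-sym I↭) (∈-++⁺ˡ w∈))
        ... | inj₂ x∈ = linarith 8 (λ d s S θ i j m l → d :≤ i :+ j ⇒ i :≤ θ ⇒ j :+ m :≡ l ⇒ l :≡ d :+ s ⇒ s :≤ S ⇒ ⊢ m :≤ S :+ θ)
          d s S θ (cnt (adj G v) I) (cnt (adj G v) J) (miss v J) (length J) (≤-trans (mindeg v) (≤-reflexive (degree-parts v I J all)))
          (poor-X x∈) (miss-eq v J) sizeJ s≤S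

      good-many : length Z ≤ cnt good Z + M
      good-many = ≤-trans (≤-reflexive (sym (cnt-not good Z))) (+-monoʳ-≤ (cnt good Z)
        (≤-trans (cnt-mono Z λ {z} _ e → double-not e) (≤-trans (cnt-any (λ z v → not (adj G z v)) targets Z) (≤-trans (total-≤ _ (S + θ) targets miss-target)
          (*-monoʳ-≤ (S + θ) (≤-trans (≤-reflexive (cong suc (length-++ W)))
            (linarith 5 (λ w x y S B → w :≤ B ⇒ x :+ y :≤ 10 :* S ⇒ ⊢ con 1 :+ (w :+ x) :≤ B :+ (10 :* S :+ con 1))
              (length W) (length X) (length Y) S B W-small XY-small)))))))
        where
        double-not : ∀ {b} → not (not b) ≡ true → b ≡ true
        double-not {true} _ = refl

      abstract
        split-good : Split good Z
        split-good = split good Z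

      abstract
        some-hubs : ∃₂ λ ys zs → ys ++ zs ≡ Split.yeses split-good × length ys ≡ h
        some-hubs = take-some h (Split.yeses split-good) (≤-trans (linarith 10
          (λ d s S z x y M B c h → d :+ s :≡ z :+ (x :+ y) ⇒ x :+ y :≤ 10 :* S ⇒ s :≤ S ⇒ z :≤ c :+ M ⇒ h :+ x :≡ s :+ con 1 ⇒ M :+ 10 :* B :+ 600 :* S :+ con 600 :≤ d ⇒ ⊢ h :≤ c)
          d s S (length Z) (length X) (length Y) M B (cnt good Z) h sizeZ XY-small s≤S good-many h-eq big)
          (≤-reflexive (sym (Split.size-yes split-good))))

      hubs Z₁ : List V
      hubs = proj₁ some-hubs
      Z₁ = proj₁ (proj₂ some-hubs) ++ Split.nos split-good

      hubs-size : length hubs ≡ h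
      hubs-size = proj₂ (proj₂ (proj₂ some-hubs))

      Z↭ : Z ↭ hubs ++ Z₁
      Z↭ = ↭-trans (Split.partition split-good) (↭-trans (↭ₚ.++⁺ʳ (Split.nos split-good) (↭-reflexive (sym (proj₁ (proj₂ (proj₂ some-hubs))))))
        (↭-reflexive (++-assoc hubs (proj₁ (proj₂ some-hubs)) (Split.nos split-good))))

      hub-Z : ∀ {z} → z ∈ hubs → z ∈ Z
      hub-Z m = ∈-↭ (↭-sym Z↭) (∈-++⁺ˡ m)

      Z₁-Z : ∀ {z} → z ∈ Z₁ → z ∈ Z
      Z₁-Z m = ∈-↭ (↭-sym Z↭) (∈-++⁺ʳ hubs m)

      hub-target : ∀ {z v} → z ∈ hubs → v ∈ targets → v ~ z
      hub-target {z} z∈ v∈ = ~-sym (all-true (adj G z) targets (not-true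
        (Split.yes-true split-good (subst (z ∈_) (proj₁ (proj₂ (proj₂ some-hubs))) (∈-++⁺ˡ z∈)))) v∈)

      some-hub : ∃ λ z → z ∈ hubs
      some-hub = by hubs hubs-size
        where
        by : ∀ L → length L ≡ h → ∃ λ z → z ∈ L
        by (z ∷ _) _ = z , here refl

      J₁ : List V
      J₁ = Y ++ Z₁

      J↭ : J ↭ X ++ hubs ++ J₁
      J↭ = permute 6 (λ J Z X Y hubs Z₁ → J ≋ Z ⊕ X ⊕ Y ⇒ₚ Z ≋ hubs ⊕ Z₁ ⇒ₚ ⊢ₚ J ≋ X ⊕ hubs ⊕ Y ⊕ Z₁) J Z X Y hubs Z₁ J↭₂ Z↭

      cnt-J₁ : ∀ P → cnt P J ≡ cnt P X + (cnt P hubs + cnt P J₁)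
      cnt-J₁ P = trans (cnt-↭-++ P X (hubs ++ J₁) J↭) (cong (cnt P X +_) (cnt-++ P hubs J₁))

      J₁-size : length J₁ + 1 ≡ d
      J₁-size = linarith 7 (λ j x u j₁ d s h → j :≡ x :+ (u :+ j₁) ⇒ j :≡ d :+ s ⇒ u :≡ h ⇒ h :+ x :≡ s :+ con 1 ⇒ ⊢ j₁ :+ con 1 :≡ d)
        (length J) (length X) (length hubs) (length J₁) d s h (trans (length-↭-++ X (hubs ++ J₁) J↭) (cong (length X +_) (length-++ hubs))) sizeJ hubs-size h-eq

      -- A vertex that sees `X` is in `W`, and hubs are adjacent to all of `W`. Any other one has
      -- `d` neighbours among the hubs and `J₁`, and `J₁` has only `d - 1` vertices.
      hub-neighbour : ∀ {i} → i ∈ I → ∃ λ z → z ∈ hubs × i ~ z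
      hub-neighbour {i} i∈I = by (bool (sees-X i))
        where
        by : sees-X i ≡ true ⊎ sees-X i ≡ false → ∃ λ z → z ∈ hubs × i ~ z
        by (inj₁ e) with ∈-++⁻ W (∈-↭ I↭ i∈I)
        ... | inj₁ w∈ = proj₁ some-hub , proj₂ some-hub , hub-target (proj₂ some-hub) (there (∈-++⁺ˡ w∈))
        ... | inj₂ i′∈ = ⊥-elim (true≢false e (unseen-I′ i′∈))
        by (inj₂ e) =
          let z , _ , q , iz = pick (adj G i) hubs (linarith 6 (λ d c x u j j₁ → d :≤ c ⇒ c :≡ x :+ (u :+ j) ⇒ x :≡ con 0 ⇒ j :≤ j₁ ⇒ j₁ :+ con 1 :≡ d ⇒ ⊢ con 1 :≤ u)
                d (cnt (adj G i) J) (cnt (adj G i) X) (cnt (adj G i) hubs) (cnt (adj G i) J₁) (length J₁)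
                (deg-I i∈I) (cnt-J₁ (adj G i)) (unseen e) (cnt≤length (adj G i) J₁) J₁-size)
          in z , ∈-↭ (↭-sym q) (here refl) , iz

      XhubsY-J : J ↭ (X ++ hubs ++ Y) ++ Z₁
      XhubsY-J = permute 5 (λ J X u Y Z₁ → J ≋ X ⊕ u ⊕ Y ⊕ Z₁ ⇒ₚ ⊢ₚ J ≋ (X ⊕ u ⊕ Y) ⊕ Z₁) J X hubs Y Z₁ J↭

      sizeI₀ : length I₀ + 1 ≡ length I
      sizeI₀ = trans (+-comm (length I₀) 1) (sym (↭ₚ.↭-length I↭r))

      abstract
        weave : Weaving.Woven Y Z₁ I₀ (length I) S
          (λ {z} z∈ → ≤-trans (*-monoʳ-≤ 10 (miss-part z (r ∷ []) I₀ I↭r)) (rich-Z (Z₁-Z z∈)))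
          -- The root, which stays off the cycle, may be a neighbour of `y`: hence 20 in `θ` against
          -- 19 in `Weaving`.
          (λ {y} y∈ → ≤-pred (≤-trans (≤-reflexive (sym (+-suc (40 * S) 19))) (≤-trans (medium-Y y∈) (cnt-pop (adj G y) I↭r))))
          (λ {i} i∈ → ≤-trans (miss-part i (X ++ hubs ++ Y) Z₁ XhubsY-J) (≤-trans (miss-J (∈I (there i∈))) s≤S))
          (≤-trans (m≤n+m (length Y) (length X)) XY-small)
          (linarith 6 (λ j₁ d y z x S → j₁ :+ con 1 :≡ d ⇒ j₁ :≡ y :+ z ⇒ x :+ y :≤ 10 :* S ⇒ 600 :* S :+ con 600 :≤ d ⇒ ⊢ 21 :* S :+ con 10 :≤ z)
            (length J₁) d (length Y) (length Z₁) (length X) S J₁-size (length-++ Y) XY-small big′)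
          sizeI₀
          (linarith 6 (λ j₁ d y z S i → j₁ :+ con 1 :≡ d ⇒ j₁ :≡ y :+ z ⇒ 3 :* d :≤ 2 :* i :+ (2 :* S :+ con 1) ⇒
              600 :* S :+ con 600 :≤ d ⇒ ⊢ 5 :* (y :+ z :+ (10 :* S :+ con 1)) :< 4 :* i)
            (length J₁) d (length Y) (length Z₁) S (length I) J₁-size (length-++ Y) I-lower big′)
        weave = Weaving.woven Y Z₁ I₀ (length I) S _ _ _ _ _ _ _

      open Weaving.Woven weave renaming (I↭ to I₀↭)

      N : List V
      N = K ++ Ia

      abstract
        split-N : Split sees-X N
        split-N = split sees-X N

      N₁ N₂ : List V
      N₁ = Split.yeses split-N
      N₂ = Split.nos split-N

      N↭ : N ↭ N₁ ++ N₂
      N↭ = Split.partition split-N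

      I↭₃ : I ↭ (r ∷ IC) ++ N
      I↭₃ = ↭-trans I↭r (prep r I₀↭)

      N-I : ∀ {i} → i ∈ N → i ∈ I
      N-I m = ∈-↭ (↭-sym I↭₃) (∈-++⁺ʳ (r ∷ IC) m)

      IC-I : ∀ {i} → i ∈ IC → i ∈ I
      IC-I m = ∈-↭ (↭-sym I↭₃) (there (∈-++⁺ˡ m))

      N₁-small : length N₁ ≤ B
      N₁-small = ≤-trans (≤-reflexive (Split.size-yes split-N))
        (≤-trans (≤-trans (m≤n+m (cnt sees-X N) (cnt sees-X (r ∷ IC))) (≤-reflexive (sym (cnt-↭-++ sees-X (r ∷ IC) N I↭₃)))) sees-small)

      N₂-unseen : ∀ {i} → i ∈ N₂ → sees-X i ≡ false
      N₂-unseen = Split.no-false split-N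

      sizeIC : length IC + 1 ≡ d
      sizeIC = trans (cong (_+ 1) balance) J₁-size

      sizeN : length I ≡ 1 + (length IC + (length N₁ + length N₂))
      sizeN = trans (length-↭-++ (r ∷ IC) N I↭₃) (cong (λ l → 1 + (length IC + l)) (length-↭-++ N₁ N₂ N↭))

      -- A vertex of `N₁` may lose neighbours to `X` as well as to the hubs, too many for the final
      -- count. But `X` and `N₁` are small and can be served first, while candidates abound. A
      -- vertex of `group₂` has at least `d - h` neighbours in `J₁`.
      group₁ group₂ : List V
      group₁ = X ++ N₁
      group₂ = r ∷ N₂

      sees-J₁ : ∀ {u} → u ∈ group₁ → d ≤ θ + (s + 1) + cnt (adj G u) J₁
      sees-J₁ {u} m = linarith 11 (λ d θ s i j x q c lx lq h → d :≤ i :+ j ⇒ i :≤ θ ⇒ j :≡ x :+ (q :+ c) ⇒ x :≤ lx ⇒ q :≤ lq ⇒ lq :≡ h ⇒ h :+ lx :≡ s :+ con 1 ⇒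
          ⊢ d :≤ θ :+ (s :+ con 1) :+ c)
        d θ s (cnt (adj G u) I) (cnt (adj G u) J) (cnt (adj G u) X) (cnt (adj G u) hubs) (cnt (adj G u) J₁) (length X) (length hubs) h
        (≤-trans (mindeg u) (≤-reflexive (degree-parts u I J all))) (few (∈-++⁻ X m)) (cnt-J₁ (adj G u)) (cnt≤length _ X) (cnt≤length _ hubs) hubs-size h-eq
        where
        few : u ∈ X ⊎ u ∈ N₁ → cnt (adj G u) I ≤ θ
        few (inj₁ x∈) = poor-X x∈
        few (inj₂ w∈) = ≤-trans (≤-reflexive (cnt-none I λ i∈ → non-adjacent (indep (N-I (∈-↭ (↭-sym N↭) (∈-++⁺ˡ w∈))) i∈))) z≤n

      abstract
        stars₁ : ∃₂ λ ls L → Stars group₁ ls × ls ++ L ↭ J₁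
        stars₁ = stars-exist group₁ J₁ λ {u} m → linarith 11
          (λ d S s c x y w g M B θ → d :≤ θ :+ (s :+ con 1) :+ c ⇒ s :≤ S ⇒ g :≡ x :+ w ⇒ x :+ y :≤ 10 :* S ⇒ w :≤ B ⇒ θ :≡ 40 :* S :+ con 20 ⇒
            M :+ 10 :* B :+ 600 :* S :+ con 600 :≤ d ⇒ ⊢ 2 :* g :≤ c)
          d S s (cnt (adj G u) J₁) (length X) (length Y) (length N₁) (length group₁) M B θ (sees-J₁ m) s≤S (length-++ X) XY-small N₁-small refl big

      ls₁ L₁ : List V
      ls₁ = proj₁ stars₁
      L₁ = proj₁ (proj₂ stars₁)

      sizeN₂ : length N₁ + length N₂ + 2 * d + s ≡ n
      sizeN₂ = linarith 7 (λ n d s w n₀ i ic → i :≡ con 1 :+ (ic :+ (w :+ n₀)) ⇒ ic :+ con 1 :≡ d ⇒ n :≡ i :+ (d :+ s) ⇒ ⊢ w :+ n₀ :+ 2 :* d :+ s :≡ n)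
        n d s (length N₁) (length N₂) (length I) (length IC) sizeN sizeIC (trans size (cong (length I +_) sizeJ))

      in-group₂ : ∀ {u} → u ∈ group₂ → u ∈ I × sees-X u ≡ false
      in-group₂ (here refl) = ∈I (here refl) , r-unseen
      in-group₂ (there m) = N-I (∈-↭ (↭-sym N↭) (∈-++⁺ʳ N₁ m)) , N₂-unseen m

      unseen-J₁ : ∀ {u} → u ∈ group₂ → d ≤ h + cnt (adj G u) J₁
      unseen-J₁ {u} m = linarith 6 (λ d j x q c h → d :≤ j ⇒ j :≡ x :+ (q :+ c) ⇒ x :≡ con 0 ⇒ q :≤ h ⇒ ⊢ d :≤ h :+ c)
        d (cnt (adj G u) J) (cnt (adj G u) X) (cnt (adj G u) hubs) (cnt (adj G u) J₁) h
        (deg-I (proj₁ (in-group₂ m))) (cnt-J₁ (adj G u)) (unseen (proj₂ (in-group₂ m))) (≤-trans (cnt≤length _ hubs) (≤-reflexive hubs-size))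

      left-over : ∀ u → cnt (adj G u) J₁ ≤ cnt (adj G u) L₁ + 2 * (length X + length N₁)
      left-over u = linarith 6 (λ k l c ll g x → k :≡ l :+ c ⇒ l :≤ ll ⇒ ll :≡ 2 :* g ⇒ g :≡ x ⇒ ⊢ k :≤ c :+ 2 :* x)
        (cnt (adj G u) J₁) (cnt (adj G u) ls₁) (cnt (adj G u) L₁) (length ls₁) (length group₁) (length X + length N₁)
        (cnt-↭-++ _ ls₁ L₁ (↭-sym (proj₂ (proj₂ (proj₂ stars₁))))) (cnt≤length _ ls₁) (stars-length (proj₁ (proj₂ (proj₂ stars₁)))) (length-++ X)

      abstract
        stars₂ : ∃₂ λ ls L → Stars group₂ ls × ls ++ L ↭ L₁
        -- This is where the degree condition is used up. Let `p`, `n₁`, `n₂` be the sizes of `X`,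
        -- `N₁`, `N₂`, so that n₁ + n₂ = n - 2d - s. At least d - (s - p + 1) - 2(p + n₁) candidates
        -- remain, and 2(1 + n₂) are needed: the requirement is 2n + 3 + p ≤ 5d + s, which holds
        -- since p ≤ s.
        stars₂ = stars-exist group₂ L₁ λ {u} m → linarith 9
          (λ d h k c x w s n₀ n → d :≤ h :+ k ⇒ k :≤ c :+ 2 :* (x :+ w) ⇒ h :+ x :≡ s :+ con 1 ⇒ w :+ n₀ :+ 2 :* d :+ s :≡ n ⇒ 2 :* n :+ con 3 :≤ 5 :* d ⇒ x :≤ s ⇒
            ⊢ 2 :* (con 1 :+ n₀) :≤ c)
          d h (cnt (adj G u) J₁) (cnt (adj G u) L₁) (length X) (length N₁) s (length N₂) n (unseen-J₁ m) (left-over u) h-eq sizeN₂ tight p≤s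

        stars₃ : ∃₂ λ ls L → Stars hubs ls × ls ++ L ↭ IC
        stars₃ = stars-exist hubs IC λ {z} m → subst (λ l → 2 * l ≤ cnt (adj G z) IC) (sym hubs-size) (linarith 8
          (λ d S h ic i c m m′ → c :+ m :≡ ic ⇒ m :≤ m′ ⇒ 10 :* m′ :≤ i ⇒ ic :+ con 1 :≡ d ⇒ 2 :* i :+ con 3 :≤ 3 :* d ⇒ h :≤ S :+ con 1 ⇒
            600 :* S :+ con 600 :≤ d ⇒ ⊢ 2 :* h :≤ c) d S h (length IC) (length I)
          (cnt (adj G z) IC) (miss z IC) (miss z I) (miss-eq z IC) (miss-part z (r ∷ N) IC (↭-trans I↭₃ (prep r (↭ₚ.++-comm IC N))))
          (rich-Z (hub-Z m)) sizeIC I-upper (≤-trans (m≤m+n h (length X)) (≤-trans (≤-reflexive h-eq) (+-monoˡ-≤ 1 s≤S))) big′)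

      ls₂ L₂ ls₃ L₃ : List V
      ls₂ = proj₁ stars₂
      L₂ = proj₁ (proj₂ stars₂)
      ls₃ = proj₁ stars₃
      L₃ = proj₁ (proj₂ stars₃)

      inner : List V
      inner = X ++ N ++ hubs ++ r ∷ []

      inner-grown : Grown inner
      inner-grown = grown-++ X (grown-++ N (grown-++ hubs root λ m → r , here refl , ~-sym (hub-target m (here refl)))
        λ m → let z , z∈ , iz = hub-neighbour (N-I m) in z , ∈-++⁺ˡ z∈ , iz)
        λ m → proj₁ some-hub , ∈-++⁺ʳ N (∈-++⁺ˡ (proj₂ some-hub)) , hub-target (proj₂ some-hub) (there (∈-++⁺ʳ W m))

      -- A vertex of `Y` hangs on its neighbour kept in `K`; a vertex of `Z₁` misses at most a tenth
      -- of `I`, while `N` makes up about a third of it; a vertex of `IC` hangs on a hub.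
      dominated : ∀ {c} → c ∈ L₂ ++ L₃ → ∃ λ u → u ∈ inner × c ~ u
      dominated {c} m = by (∈-++⁻ L₂ m)
        where
        in-N : (∃ λ κ → κ ∈ N × c ~ κ) → ∃ λ u → u ∈ inner × c ~ u
        in-N (κ , κ∈ , e) = κ , ∈-++⁺ʳ X (∈-++⁺ˡ κ∈) , e
        by-J : c ∈ Y ⊎ c ∈ Z₁ → ∃ λ u → u ∈ inner × c ~ u
        by-J (inj₁ y∈) = let κ , κ∈ , e = cover y∈ in in-N (κ , ∈-++⁺ˡ κ∈ , e)
        by-J (inj₂ z∈) =
          let κ , _ , p , e = pick (adj G c) N (linarith 9
                (λ d S ic i c m m′ w n₀ → c :+ m :≡ w :+ n₀ ⇒ m :≤ m′ ⇒ 10 :* m′ :≤ i ⇒ i :≡ con 1 :+ (ic :+ (w :+ n₀)) ⇒ ic :+ con 1 :≡ d ⇒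
                  3 :* d :≤ 2 :* i :+ (2 :* S :+ con 1) ⇒ 600 :* S :+ con 600 :≤ d ⇒ ⊢ con 1 :≤ c)
                d S (length IC) (length I) (cnt (adj G c) N) (miss c N) (miss c I) (length N₁) (length N₂)
                (trans (miss-eq c N) (length-↭-++ N₁ N₂ N↭)) (miss-part c (r ∷ IC) N I↭₃) (rich-Z (Z₁-Z z∈)) sizeN sizeIC I-lower big′)
          in in-N (κ , ∈-↭ (↭-sym p) (here refl) , e)
        by : c ∈ L₂ ⊎ c ∈ L₃ → ∃ λ u → u ∈ inner × c ~ u
        by (inj₂ m₃) = let z , z∈ , e = hub-neighbour (IC-I (∈-↭ (proj₂ (proj₂ (proj₂ stars₃))) (∈-++⁺ʳ ls₃ m₃)))
                       in z , ∈-++⁺ʳ X (∈-++⁺ʳ N (∈-++⁺ˡ z∈)) , e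
        by (inj₁ m₂) = by-J (∈-++⁻ Y (∈-↭ (proj₂ (proj₂ (proj₂ stars₁))) (∈-++⁺ʳ ls₁ (∈-↭ (proj₂ (proj₂ (proj₂ stars₂))) (∈-++⁺ʳ ls₂ m₂)))))

      halin : HasSpanningGenHalin G
      halin = Assembled.halin inner-grown
        (permute 10 (λ I J V r IC N X u J₁ C → C ≋ IC ⊕ J₁ ⇒ₚ (r ⊕ IC) ⊕ N ≋ I ⇒ₚ X ⊕ u ⊕ J₁ ≋ J ⇒ₚ I ⊕ J ≋ V ⇒ₚ ⊢ₚ (X ⊕ N ⊕ u ⊕ r) ⊕ C ≋ V)
          I J vertices (r ∷ []) IC N X hubs J₁ C C↭ (↭-sym I↭₃) (↭-sym J↭) all)
        (≤-trans (≤-trans (≤-trans (s≤s (s≤s z≤n)) (≤-reflexive (trans (cong (1 +_) (sym hubs-size)) (trans (+-comm 1 (length hubs)) (sym (length-++ hubs))))))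
          (≤-trans (m≤n+m _ (length N)) (≤-reflexive (sym (length-++ N))))) (≤-trans (m≤n+m _ (length X)) (≤-reflexive (sym (length-++ X)))))
        cyc
        (linarith 5 (λ c ic j₁ d S → c :≡ ic :+ j₁ ⇒ ic :+ con 1 :≡ d ⇒ 600 :* S :+ con 600 :≤ d ⇒ ⊢ con 3 :≤ c)
          (length C) (length IC) (length J₁) d S (length-↭-++ IC J₁ C↭) sizeIC big′)
        (stars-++ (proj₁ (proj₂ (proj₂ stars₁))) (stars-++ (proj₁ (proj₂ (proj₂ stars₂))) (proj₁ (proj₂ (proj₂ stars₃)))))
        (permute 6 (λ X N₁ N₂ N u r → N₁ ⊕ N₂ ≋ N ⇒ₚ ⊢ₚ (X ⊕ N₁) ⊕ (r ⊕ N₂) ⊕ u ≋ X ⊕ N ⊕ u ⊕ r) X N₁ N₂ N hubs (r ∷ []) (↭-sym N↭))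
        (permute 9 (λ ls₁ L₁ ls₂ L₂ ls₃ L₃ IC J₁ C → ls₂ ⊕ L₂ ≋ L₁ ⇒ₚ ls₁ ⊕ L₁ ≋ J₁ ⇒ₚ ls₃ ⊕ L₃ ≋ IC ⇒ₚ IC ⊕ J₁ ≋ C ⇒ₚ ⊢ₚ (ls₁ ⊕ ls₂ ⊕ ls₃) ⊕ L₂ ⊕ L₃ ≋ C)
          ls₁ L₁ ls₂ L₂ ls₃ L₃ IC J₁ C (proj₂ (proj₂ (proj₂ stars₂))) (proj₂ (proj₂ (proj₂ stars₁))) (proj₂ (proj₂ (proj₂ stars₃))) (↭-sym C↭))
        dominated

-- Numerical estimates for large `n`

n<2^n : ∀ m → m < 2 ^ m
n<2^n zero = s≤s z≤n
n<2^n (suc m) = linarith 2 (λ m p → m :< p ⇒ ⊢ con 1 :+ m :< p :+ (p :+ con 0)) m (2 ^ m) (n<2^n m)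

bracket : ∀ (f : ℕ → ℕ) n m y → f y ≤ n → n < f (m + y) → ∃ λ y′ → y ≤ y′ × f y′ ≤ n × n < f (suc y′)
bracket f n zero y le lt = ⊥-elim (<-irrefl refl (<-≤-trans lt le))
bracket f n (suc m) y le lt with n <? f (suc y)
... | yes lt′ = y , ≤-refl , le , lt′
... | no ≮ with bracket f n m (suc y) (≮⇒≥ ≮) (subst (λ x → n < f x) (sym (+-suc m y)) lt)
... | y′ , y≤ , rest = y′ , <⇒≤ y≤ , rest

fourth : ℕ → ℕ
fourth p = p * (p * (p * p))

fourth-power : ∀ y → fourth (2 ^ y) ≡ 2 ^ (4 * y)
fourth-power y = sym (begin
  2 ^ (4 * y)                             ≡⟨ ^-distribˡ-+-* 2 y (3 * y) ⟩
  2 ^ y * 2 ^ (3 * y)                     ≡⟨ cong (2 ^ y *_) (^-distribˡ-+-* 2 y (2 * y)) ⟩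
  2 ^ y * (2 ^ y * 2 ^ (2 * y))           ≡⟨ cong (λ x → 2 ^ y * (2 ^ y * x)) (^-distribˡ-+-* 2 y (1 * y)) ⟩
  2 ^ y * (2 ^ y * (2 ^ y * 2 ^ (1 * y))) ≡⟨ cong (λ x → 2 ^ y * (2 ^ y * (2 ^ y * 2 ^ x))) (*-identityˡ y) ⟩
  fourth (2 ^ y)                          ∎)
  where open ≡-Reasoning

-- Of the four factors of `fourth p`, three match the cube of `q` and the last one absorbs all
-- constants.
cube-bound : ∀ a c {p q n} → q ≤ c * p → a * (c * (c * c)) ≤ p → fourth p ≤ n → a * (q * (q * q)) ≤ n
cube-bound a c {p} {q} {n} q≤ c≤ le = begin
  a * (q * (q * q))                   ≤⟨ *-monoʳ-≤ a (*-mono-≤ q≤ (*-mono-≤ q≤ q≤)) ⟩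
  a * (c * p * (c * p * (c * p)))     ≡⟨ cong (λ x → a * (c * p * x)) ([m*n]*[o*p]≡[m*o]*[n*p] c p c p) ⟩
  a * (c * p * (c * c * (p * p)))     ≡⟨ cong (a *_) ([m*n]*[o*p]≡[m*o]*[n*p] c p (c * c) (p * p)) ⟩
  a * (c * (c * c) * (p * (p * p)))   ≡⟨ sym (*-assoc a (c * (c * c)) (p * (p * p))) ⟩
  a * (c * (c * c)) * (p * (p * p))   ≤⟨ *-monoˡ-≤ (p * (p * p)) c≤ ⟩
  fourth p                            ≤⟨ le ⟩
  n                                   ∎
  where open ≤-Reasoning

regroup : ∀ a b c {y p} → y ≤ p → a * (b * (c * y)) ≤ a * (b * c) * p
regroup a b c {y} {p} le = begin
  a * (b * (c * y)) ≤⟨ *-monoʳ-≤ a (*-monoʳ-≤ b (*-monoʳ-≤ c le)) ⟩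
  a * (b * (c * p)) ≡⟨ cong (a *_) (sym (*-assoc b c p)) ⟩
  a * (b * c * p)   ≡⟨ sym (*-assoc a (b * c) p) ⟩
  a * (b * c) * p   ∎
  where open ≤-Reasoning

-- k is taken to be a multiple 4 (y + 1) of 4, where 16 ^ y ≤ n < 16 ^ (y + 1) and y ≥ 50.
log-bound : ∀ n → 2 ^ 200 ≤ n → ∃ λ k → 1 ≤ k × n < 2 ^ k × (let q = 64 * (64 * k) in 100 * (q * (q * q)) ≤ n)
log-bound n big = from (bracket (λ y → fourth (2 ^ y)) n n 50 (≤-trans (≤-reflexive (fourth-power 50)) big)
    (≤-trans (≤-trans (n<2^n n) (^-monoʳ-≤ 2 (linarith 1 (λ n → ⊢ n :≤ 4 :* (n :+ con 50)) n))) (≤-reflexive (sym (fourth-power (n + 50))))))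
  where
  from : (∃ λ y → 50 ≤ y × fourth (2 ^ y) ≤ n × n < fourth (2 ^ suc y)) → ∃ λ k → 1 ≤ k × n < 2 ^ k × (let q = 64 * (64 * k) in 100 * (q * (q * q)) ≤ n)
  from (y , 50≤y , lower , upper) = 4 * suc y , s≤s z≤n , ≤-trans upper (≤-reflexive (fourth-power (suc y))) ,
    -- With 4(y + 1) for `k`, `q` is at most 16384 times 2 ^ y. The constant to be absorbed is 100
    -- times the cube of 16384, less than 2 ^ 50; hence y ≥ 50, and 2 ^ 200 as the bound for `n`.
    cube-bound 100 (64 * (64 * 4)) (regroup 64 64 4 (n<2^n y)) (≤-trans (≤ᵇ⇒≤ (100 * (16384 * (16384 * 16384))) (2 ^ 50) tt) (^-monoʳ-≤ 2 50≤y)) lower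

-- `q` bounds both `θ` and `10 * S`, so `B` is at most q², and `(S + θ) * (B + (10 * S + 1))` at
-- most 2q times 3q². The whole left side is at most 35 q³, whereas `d` exceeds 2n/5, which is at
-- least 40 q³.
polynomial-bound : ∀ k d n → 1 ≤ k → (let q = 64 * (64 * k) in 100 * (q * (q * q)) ≤ n) → 2 * n + 3 ≤ 5 * d →
  let S = 50 * k + 5 ; θ = 40 * S + 20 ; B = θ * (10 * S) in (S + θ) * (B + (10 * S + 1)) + 10 * B + 600 * S + 600 ≤ d
polynomial-bound k d n k≥1 n-large tight = linarith 9
  (λ M B S k′ q q₂ q₃ n d → M :≤ 6 :* q₃ ⇒ B :≤ q₂ ⇒ S :≤ k′ ⇒ q :≡ 64 :* k′ ⇒ con 1 :≤ k′ ⇒ q :≤ q₂ ⇒ q₂ :≤ q₃ ⇒ 100 :* q₃ :≤ n ⇒ 2 :* n :+ con 3 :≤ 5 :* d ⇒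
    ⊢ M :+ 10 :* B :+ 600 :* S :+ con 600 :≤ d)
  ((S + θ) * (B + (10 * S + 1))) B S k′ q (q * q) (q * (q * q)) n d
  M≤ B≤ S≤k′ refl k′≥1 q≤q² (m≤m*n′ (q * q)) n-large tight
  where
  S θ B k′ q : ℕ
  S = 50 * k + 5
  θ = 40 * S + 20
  B = θ * (10 * S)
  k′ = 64 * k
  q = 64 * k′
  k′≥1 : 1 ≤ k′
  k′≥1 = linarith 1 (λ k → con 1 :≤ k ⇒ ⊢ con 1 :≤ 64 :* k) k k≥1
  S≤k′ : S ≤ k′
  S≤k′ = linarith 1 (λ k → con 1 :≤ k ⇒ ⊢ 50 :* k :+ con 5 :≤ 64 :* k) k k≥1
  q≥1 : 1 ≤ q
  q≥1 = linarith 1 (λ k′ → con 1 :≤ k′ ⇒ ⊢ con 1 :≤ 64 :* k′) k′ k′≥1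
  m≤m*n′ : ∀ m → m ≤ q * m
  m≤m*n′ m = ≤-trans (≤-reflexive (sym (*-identityˡ m))) (*-monoˡ-≤ m q≥1)
  q≤q² : q ≤ q * q
  q≤q² = m≤m*n′ q
  θ≤ : θ ≤ q
  θ≤ = linarith 3 (λ k S k′ → S :≡ 50 :* k :+ con 5 ⇒ k′ :≡ 64 :* k ⇒ con 1 :≤ k ⇒ ⊢ 40 :* S :+ con 20 :≤ 64 :* k′) k S k′ refl refl k≥1
  S≤ : 10 * S ≤ q
  S≤ = linarith 2 (λ S k′ → S :≤ k′ ⇒ ⊢ 10 :* S :≤ 64 :* k′) S k′ S≤k′
  B≤ : B ≤ q * q
  B≤ = *-mono-≤ θ≤ S≤
  M≤ : (S + θ) * (B + (10 * S + 1)) ≤ 6 * (q * (q * q))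
  M≤ = ≤-trans (*-mono-≤ (linarith 3 (λ S θ q → 10 :* S :≤ q ⇒ θ :≤ q ⇒ ⊢ S :+ θ :≤ 2 :* q) S θ q S≤ θ≤)
      (linarith 4 (λ B S q q₂ → B :≤ q₂ ⇒ 10 :* S :≤ q ⇒ con 1 :≤ q ⇒ q :≤ q₂ ⇒ ⊢ B :+ (10 :* S :+ con 1) :≤ 3 :* q₂) B S q (q * q) B≤ S≤ q≥1 q≤q²))
    (≤-reflexive ([m*n]*[o*p]≡[m*o]*[n*p] 2 q 3 (q * q)))

-- Combination of the two cases

module _ {n : ℕ} (G : Graph n) where

  open Paths G
  open DominatingTrees G
  open Dichotomy G

  extremal-halin : ∀ k d (large : 64 * (64 * k) ≤ n) (n-large : let q = 64 * (64 * k) in 100 * (q * (q * q)) ≤ n) → 1 ≤ k →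
    (mindeg : ∀ v → d ≤ degree G v) → 2 * n + 3 ≤ 5 * d → ∀ I J → I ++ J ↭ vertices → (∀ {v w} → v ∈ I → w ∈ I → v ~ w → ⊥) →
    length J + 4 * d ≤ 2 * n + 1 + (50 * k + 5) → HasSpanningGenHalin G
  extremal-halin k d large n-large k≥1 mindeg tight I J all indep small =
    ExtremalCase.Extreme.Big.halin G d mindeg I J all indep (length J ∸ d) (50 * k + 5) (sym (m+[n∸m]≡n d≤J)) tight
      (linarith 5 (λ j d s n S → j :+ 4 :* d :≤ 2 :* n :+ con 1 :+ S ⇒ d :+ s :≡ j ⇒ ⊢ 5 :* d :+ s :≤ 2 :* n :+ con 1 :+ S)
        (length J) d (length J ∸ d) n (50 * k + 5) small (m+[n∸m]≡n d≤J))
      (polynomial-bound k d n k≥1 n-large tight)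
    where
    size : n ≡ length I + length J
    size = order I J all
    d≤J : d ≤ length J
    d≤J =
      let i , _ , e , _ = pick (λ _ → true) I (≤-trans (linarith 6 (λ n i j d k k′ → n :≡ i :+ j ⇒ j :+ 4 :* d :≤ 2 :* n :+ con 1 :+ (50 :* k :+ con 5) ⇒
            2 :* n :+ con 3 :≤ 5 :* d ⇒ k′ :≡ 64 :* k ⇒ 64 :* k′ :≤ n ⇒ con 1 :≤ k ⇒ ⊢ con 1 :≤ i)
            n (length I) (length J) d k (64 * k) size small tight refl large k≥1) (≤-reflexive (sym (cnt-all I λ _ → refl))))
          i∈I = ∈-↭ (↭-sym e) (here refl)
      in ≤-trans (mindeg i) (≤-trans (≤-reflexive (independent-degree all indep i∈I)) (cnt≤length (adj G i) J))

  halin : ∀ k → 1 ≤ k → n < 2 ^ k → (let q = 64 * (64 * k) in 100 * (q * (q * q)) ≤ n) → KConnected 3 G → ∀ d → (∀ v → d ≤ degree G v) →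
    2 * n + 3 ≤ 5 * d → V → HasSpanningGenHalin G
  halin k k≥1 n<2^k n-large conn d mindeg tight v =
    by (Cases.dichotomy d mindeg k (Separators.Spines.spine G conn d mindeg k n<2^k dense d-large v) dense d-large v)
    where
    q : ℕ
    q = 64 * (64 * k)
    large : q ≤ n
    large = ≤-trans (cube q (linarith 2 (λ k k′ → k′ :≡ 64 :* k ⇒ con 1 :≤ k ⇒ ⊢ con 1 :≤ 64 :* k′) k (64 * k) refl k≥1)) n-large
      where
      cube : ∀ q → 1 ≤ q → q ≤ 100 * (q * (q * q))
      cube (suc q) _ = ≤-trans (m≤m*n (suc q) (suc q * suc q)) (m≤n*m (suc q * (suc q * suc q)) 100)
    dense : n + (40 * k + 20) ≤ 3 * d
    dense = linarith 4 (λ n k k′ d → k′ :≡ 64 :* k ⇒ 64 :* k′ :≤ n ⇒ con 1 :≤ k ⇒ 2 :* n :+ con 3 :≤ 5 :* d ⇒ ⊢ n :+ (40 :* k :+ con 20) :≤ 3 :* d)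
      n k (64 * k) d refl large k≥1 tight
    d-large : 30 * k + 20 ≤ d
    d-large = linarith 4 (λ n k k′ d → k′ :≡ 64 :* k ⇒ 64 :* k′ :≤ n ⇒ con 1 :≤ k ⇒ 2 :* n :+ con 3 :≤ 5 :* d ⇒ ⊢ 30 :* k :+ con 20 :≤ d)
      n k (64 * k) d refl large k≥1 tight
    by : HasSpanningGenHalin G ⊎ Cases.Extremal d mindeg k (Separators.Spines.spine G conn d mindeg k n<2^k dense d-large v) dense d-large → HasSpanningGenHalin G
    by (inj₁ h) = h
    by (inj₂ (I , J , all , indep , small)) = extremal-halin k d large n-large k≥1 mindeg tight I J all indep small

theorem1p2 : Σ ℕ λ n₀ → 1 ≤ n₀ ×
    (∀ (n : ℕ) (G : Graph n) → n₀ ≤ n → KConnected 3 G →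
    (∀ (v : Fin n) → 2 * n + 3 ≤ 5 * degree G v) →
    HasSpanningGenHalin G)
theorem1p2 = 2 ^ 200 , m^n>0 2 200 , main
  where
  main : ∀ (n : ℕ) (G : Graph n) → 2 ^ 200 ≤ n → KConnected 3 G →
    (∀ (v : Fin n) → 2 * n + 3 ≤ 5 * degree G v) → HasSpanningGenHalin G
  main zero G big = ⊥-elim (<-irrefl refl (≤-trans (m^n>0 2 200) big))
  main n@(suc _) G big conn mindeg = let k , k≥1 , n<2^k , n-large = log-bound n big in
    halin G k k≥1 n<2^k n-large conn d mindeg′ tight zero
    where
    d : ℕ
    -- Adding 4 before rounding down yields the ceiling of (2n + 3) / 5.
    d = (2 * n + 7) / 5
    tight : 2 * n + 3 ≤ 5 * d
    tight = linarith 3 (λ n r d → 2 :* n :+ con 7 :≡ r :+ d ⇒ r :< con 5 ⇒ ⊢ 2 :* n :+ con 3 :≤ d) n ((2 * n + 7) % 5) (5 * d)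
      (trans (m≡m%n+[m/n]*n (2 * n + 7) 5) (cong ((2 * n + 7) % 5 +_) (*-comm d 5))) (m%n<n (2 * n + 7) 5)
    mindeg′ : ∀ v → d ≤ degree G v
    mindeg′ v = linarith 3 (λ n d e → 5 :* d :≤ 2 :* n :+ con 7 ⇒ 2 :* n :+ con 3 :≤ 5 :* e ⇒ ⊢ d :≤ e) n d (degree G v)
      (≤-trans (≤-reflexive (*-comm 5 d)) (m/n*n≤m (2 * n + 7) 5)) (mindeg v)
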